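{- For $k \ge 2$, the function $F_k(x,y)$ is expressed as $F_k = f_k(Z,W)$ with \[ f_k(z,w) = \frac{w^2}{(1-w)^{3(k-1)}} \sum_{j=0}^{k-1} q_{k,j}(w)z^j, \] where each $q_{k,j}(w)$ is a polynomial in $w$.
   Context: For integers $r,s\ge 0$ and $k$, $N_{\rm bi}(r,s,k)$ is the number of connected bipartite simple graphs with labeled bipartition $V_1\sqcup V_2$, $|V_1|=r$, $|V_2|=s$, having exactly $r+s+k-1$ edges; equivalently, the number of connected spanning subgraphs of the complete bipartite graph $K_{r,s}$ with $r+s+k-1$ edges (so the Betti number is $k$). Conventions: if $rs=0$, then $N_{\rm bi}(r,s,k)=1$ if $k=0$ and $(r,s)\in\{(1,0),(0,1)\}$, and $0$ otherwise. It is known that $N_{\rm bi}(r,s,0)=r^{s-1}s^{r-1}$ for $r,s\ge1$. For $k\ge 0$ let $F_k(x,y) = \sum_{r,s=0}^{\infty} \frac{N_{\rm bi}(r,s,k)}{r!s!}x^r y^s$ (formal power series), and put $T:=F_0$. With the Euler operators $D_x=x\partial_x$, $D_y=y\partial_y$, put $T_x = D_xT$, $T_y=D_yT$, $Z=T_x+T_y$, $W=T_xT_y$. -}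

module Defs where

open import Algebra.Bundles.Raw using (RawRing)
import Algebra.Definitions.RawMonoid as RawMonoidDefs
import Algebra.Definitions.RawSemiring as RawSemiringDefs
open import Data.Fin.Base using (Fin; zero; suc; toℕ; splitAt; join)
open import Data.Fin.Properties using (all?; any?; join-splitAt; splitAt-join)
open import Data.Fin.Subset using (Side; inside; outside; Subset; ∣_∣; _∈_)
open import Data.Fin.Subset.Properties using (_∈?_)
open import Data.Integer.Base using (+_)
open import Data.List.Base as List using (List; []; _∷_; length; filter; cartesianProductWith)
open import Data.Nat.Base as ℕ using (ℕ; zero; suc; _∸_; _!)
open import Data.Nat.Properties using (_≟_; _!*_!≢0)
open import Data.Product.Base using (∃; _×_; _,_)
open import Data.Rational.Base as ℚ using (ℚ; 0ℚ; 1ℚ; _/_)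
open import Data.Sum.Base using (_⊎_; inj₁; inj₂)
open import Data.Vec.Base as Vec using (Vec; []; _∷_; lookup)
open import Level using (0ℓ)
open import Relation.Binary.Construct.Closure.ReflexiveTransitive
  using (Star; ε; _◅_; _◅◅_; gmap)
open import Relation.Binary.Core using (Rel)
open import Relation.Binary.Definitions using (Decidable)
open import Relation.Binary.PropositionalEquality using (_≡_; subst₂; sym)
open import Relation.Nullary.Decidable using (Dec; yes; no; map′; _×-dec_; _⊎-dec_)
open import Relation.Unary using () renaming (Decidable to Decidable₁)

-- Entry i of a bipartite graph is the set of neighbours in V₂ = Fin s of the
-- vertex i of V₁ = Fin r.

BipartiteGraph : ℕ → ℕ → Set
BipartiteGraph r s = Vec (Subset s) r

Vertex : ℕ → ℕ → Set
Vertex r s = Fin r ⊎ Fin s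

data Adj {r s} (G : BipartiteGraph r s) : Rel (Vertex r s) 0ℓ where
  forth : ∀ {i j} → j ∈ lookup G i → Adj G (inj₁ i) (inj₂ j)
  back  : ∀ {i j} → j ∈ lookup G i → Adj G (inj₂ j) (inj₁ i)

edges : ∀ {r s} → BipartiteGraph r s → ℕ
edges G = Vec.sum (Vec.map ∣_∣ G)

-- Vacuously true when r = s = 0; it is only used for r, s ≥ 1.
Connected : ∀ {r s} → BipartiteGraph r s → Set
Connected G = ∀ u v → Star (Adj G) u v

allVecs : ∀ {A : Set} → List A → ∀ n → List (Vec A n)
allVecs xs zero    = [] ∷ []
allVecs xs (suc n) = cartesianProductWith _∷_ xs (allVecs xs n)

allGraphs : ∀ r s → List (BipartiteGraph r s)
allGraphs r s = allVecs (allVecs (inside ∷ outside ∷ []) s) r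

-- Reachability on Fin n is decidable: eliminate vertex zero, adding a shortcut
-- for every path of length two through it, and recurse.

private
  module Elim {n} (R : Rel (Fin (suc n)) 0ℓ) where

    Short : Rel (Fin n) 0ℓ
    Short i j = R (suc i) (suc j) ⊎ (R (suc i) zero × R zero (suc j))

    short : ∀ {i j} → Star Short i j → Star R (suc i) (suc j)
    short ε                     = ε
    short (inj₁ a ◅ p)       = a ◅ short p
    short (inj₂ (a , b) ◅ p) = a ◅ b ◅ short p

    Out : Fin n → Set
    Out j = ∃ λ i → R zero (suc i) × Star Short i j

    In : Fin n → Set
    In i = ∃ λ j → Star Short i j × R (suc j) zero

    mutual
      fromSuc : ∀ {i j} → Star R (suc i) (suc j) → Star Short i j
      fromSuc ε                    = ε
      fromSuc (_◅_ {j = suc _} a p) = inj₁ a ◅ fromSuc p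
      fromSuc (_◅_ {j = zero} a p) with fromZero p
      ... | _ , b , q = inj₂ (a , b) ◅ q

      fromZero : ∀ {j} → Star R zero (suc j) → Out j
      fromZero (_◅_ {j = suc _} a p) = _ , a , fromSuc p
      fromZero (_◅_ {j = zero} a p)  = fromZero p

    toZero : ∀ {i} → Star R (suc i) zero → In i
    toZero (_◅_ {j = zero} a p)  = _ , ε , a
    toZero (_◅_ {j = suc _} a p) with toZero p
    ... | _ , q , b = _ , inj₁ a ◅ q , b

star? : ∀ {n} {R : Rel (Fin n) 0ℓ} → Decidable R → Decidable (Star R)
star? {suc n} {R} R? = go
  where
  open Elim R

  short? : Decidable (Star Short)
  short? = star? λ i j →
    R? (suc i) (suc j) ⊎-dec (R? (suc i) zero ×-dec R? zero (suc j))

  go : Decidable (Star R)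
  go zero    zero    = yes ε
  go zero    (suc j) = map′ (λ (_ , a , p) → a ◅ short p) fromZero
                         (any? λ i → R? zero (suc i) ×-dec short? i j)
  go (suc i) zero    = map′ (λ (_ , p , a) → short p ◅◅ a ◅ ε) toZero
                         (any? λ j → short? i j ×-dec R? (suc j) zero)
  go (suc i) (suc j) = map′ short fromSuc (short? i j)

adj? : ∀ {r s} (G : BipartiteGraph r s) → Decidable (Adj G)
adj? G (inj₁ i) (inj₂ j) = map′ forth (λ { (forth p) → p }) (j ∈? lookup G i)
adj? G (inj₂ j) (inj₁ i) = map′ back (λ { (back p) → p }) (j ∈? lookup G i)
adj? G (inj₁ _) (inj₁ _) = no λ ()
adj? G (inj₂ _) (inj₂ _) = no λ ()

connected? : ∀ {r s} → Decidable₁ (Connected {r} {s})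
connected? {r} {s} G = map′ to from (all? λ a → all? λ b → star? R? a b)
  where
  vertex : Fin (r ℕ.+ s) → Vertex r s
  vertex = splitAt r

  R : Rel (Fin (r ℕ.+ s)) 0ℓ
  R a b = Adj G (vertex a) (vertex b)

  R? : Decidable R
  R? a b = adj? G (vertex a) (vertex b)

  to : (∀ a b → Star R a b) → Connected G
  to h u v = subst₂ (Star (Adj G)) (splitAt-join r s u) (splitAt-join r s v)
               (gmap vertex (λ e → e) (h (join r s u) (join r s v)))

  from : Connected G → ∀ a b → Star R a b
  from h a b = subst₂ (Star R) (join-splitAt r s a) (join-splitAt r s b)
    (gmap (join r s)
      (λ {u} {v} → subst₂ (Adj G) (sym (splitAt-join r s u)) (sym (splitAt-join r s v)))
      (h (vertex a) (vertex b)))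

-- For rs = 0 the value is a convention.
Nbi : ℕ → ℕ → ℕ → ℕ
Nbi 1         0         0 = 1
Nbi 0         1         0 = 1
Nbi 0         _         _ = 0
Nbi (suc _)   0         _ = 0
Nbi r@(suc _) s@(suc _) k = length (filter
  (λ G → connected? G ×-dec (edges G ≟ r ℕ.+ s ℕ.+ k ∸ 1)) (allGraphs r s))

-- Formal power series over ℚ in two variables: f m n is the coefficient of
-- xᵐ yⁿ.

Series : Set
Series = ℕ → ℕ → ℚ

sumℚ : ∀ {n} → (Fin n → ℚ) → ℚ
sumℚ = RawMonoidDefs.sum ℚ.+-0-rawMonoid

constant : ℚ → Series
constant c zero zero = c
constant c _    _    = 0ℚ

Series-rawRing : RawRing 0ℓ 0ℓ
Series-rawRing = record
  { Carrier = Series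
  ; _≈_ = λ f g → ∀ m n → f m n ≡ g m n
  ; _+_ = λ f g m n → f m n ℚ.+ g m n
  ; _*_ = λ f g m n → sumℚ {suc m} λ i → sumℚ {suc n} λ j →
            f (toℕ i) (toℕ j) ℚ.* g (m ∸ toℕ i) (n ∸ toℕ j)
  ; -_  = λ f m n → ℚ.- f m n
  ; 0#  = constant 0ℚ
  ; 1#  = constant 1ℚ
  }

open RawRing Series-rawRing public
  using (_≈_; _+_; _*_; -_; 0#; 1#)
open RawSemiringDefs (RawRing.rawSemiring Series-rawRing) public
  using (_^_; sum)

infixl 6 _-_
_-_ : Series → Series → Series
f - g = f + (- g)

-- Multiplicative inverse of a series h with constant term 1, by the geometric
-- series h⁻¹ = ∑ₗ (1 - h)ˡ.  As 1 - h has no constant term, the summands with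
-- l > m + n do not contribute to the coefficient of xᵐ yⁿ.  For series h with
-- another constant term the value is meaningless.
infix 8 _⁻¹
_⁻¹ : Series → Series
(h ⁻¹) m n = sumℚ {suc (m ℕ.+ n)} λ l → ((1# - h) ^ toℕ l) m n

-- A polynomial in one variable over ℚ, as its coefficients in increasing degree.
Polynomial : Set
Polynomial = List ℚ

eval : Polynomial → Series → Series
eval p w = List.foldr (λ c acc → constant c + w * acc) 0# p

-- The exponential generating function of N_bi(·,·,k).
F : ℕ → Series
F k r s = _/_ (+ Nbi r s k) (r ! ℕ.* s !) {{r !* s !≢0}}

Dx Dy : Series → Series
Dx f m n = (+ m / 1) ℚ.* f m n
Dy f m n = (+ n / 1) ℚ.* f m n

T Tx Ty Z W : Series
T  = F 0
Tx = Dx T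
Ty = Dy T
Z  = Tx + Ty
W  = Tx * Ty

-- The rational function with numerator polynomials q, evaluated at series z, w.
-- The inverse is the genuine one whenever w has no constant term, as for w = W.
f : ∀ k → (Fin k → Polynomial) → Series → Series → Series
f k q z w =
  w ^ 2 * ((1# - w) ^ (3 ℕ.* (k ∸ 1))) ⁻¹ * sum (λ j → eval (q j) w * z ^ toℕ j)

{-# OPTIONS --safe #-}

-- Let G = ∑ (1+u)^(rs) xʳ yˢ / r! s! and C = ∑ₖ u^(k-1) Fₖ(ux, uy) count all and connected bipartite graphs,
-- with u marking edges.  Splitting off the component of a root gives Dx G = G · Dx C, so C = log G.  The identities
-- Dx G = x G(x, (1+u)y) and (1+u) Du G = u Dx Dy G become, after a logarithmic derivative and with C rescaled,
--
--   k Dx Fₖ = ∑_{m=1}^{k} m Sₘ Dx F_{k-m},   Sₘ = ∑_{n≥1} binom(Dy, n) F_{m+1-n},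
--   (Dx + Dy + k-1) Fₖ + (Dx + Dy + k-2) F_{k-1} = Dx Dy F_{k-1} + ∑_{i+j=k} Dx Fᵢ Dy Fⱼ.
--
-- The first has the form Dx Fₖ = Tx Dy Fₖ + Kₖ with Kₖ known from smaller k.  With its mirror image it determines the
-- derivatives of Fₖ rationally in Tx and Ty, with a pole only at W = 1, and then the second one yields (k-1) Fₖ without
-- any integration.  The exponents i - j of Tx^i Ty^j stay between -(k-1) and k-1 throughout, which bounds the degree
-- in Z.  This gives the pole order 3k-2; it drops to 3k-3 because L = (1-Ty) Dx + (1-Tx) Dy raises the pole order of
-- every non-zero rational expression in Tx, Ty having a pole, whereas L Fₖ = Kₖ + σ Kₖ has order at most 3k-2.
-- Finally Fₖ is symmetric in x and y, so Tx and Ty enter only through Z and W.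

module Submission where

import Algebra.Definitions.RawMonoid as RawMonoidDefs
import Algebra.Properties.AbelianGroup as AbelianGroupProperties
import Algebra.Properties.CommutativeMonoid.Mult as CMult
import Algebra.Properties.CommutativeSemiring.Exp as Exp
import Algebra.Properties.Group as GroupProperties
import Algebra.Properties.Ring as RingProperties
import Algebra.Properties.Semiring.Mult as SemiringMult
import Algebra.Solver.Ring.NaturalCoefficients.Default as NatSolver
open import Algebra.Bundles using (CommutativeRing)
open import Algebra.Structures using (IsCommutativeRing)
open import Data.Bool.Base using (Bool; true; false)
open import Data.Bool.Properties using () renaming (_≟_ to _≟ᵇ_)
open import Data.Fin.Base using (Fin; toℕ)
open import Data.Fin.Subset using (Subset; inside; outside; _∈_; _∉_; ∁) renaming (∣_∣ to card)
import Data.Integer.Base as ℤ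
open import Data.List.Base as List
  using (List; []; _∷_; _++_; length; filter; cartesianProductWith)
open import Data.Nat.Base as ℕ using (ℕ; zero; suc; _≤_; z≤n; s≤s; _∸_; _!)
import Data.Nat.Properties as ℕP
open import Data.Nat.Tactic.RingSolver using (solve-∀)
open import Data.Product.Base using (∃; ∃₂; _,_; proj₁; proj₂) renaming (_×_ to _∧_)
open import Data.Rational.Base as ℚ using (ℚ; 0ℚ; 1ℚ; _/_; toℚᵘ; fromℚᵘ)
import Data.Rational.Properties as ℚP
open import Data.Sum.Base as Sum using (inj₁; inj₂)
open import Data.Vec.Base as Vec using (Vec; []; _∷_; lookup; here; there; replicate; tabulate; zipWith)
open import Data.Vec.Properties using (≡-dec)
open import Function.Base using (_∘_; id)
open import Level using (0ℓ)
open import Relation.Binary.Construct.Closure.ReflexiveTransitive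
  using (Star; ε; _◅_; _◅◅_; gmap; reverse)
open import Relation.Binary.Definitions using (Decidable; Tri; tri<; tri≈; tri>)
open import Relation.Binary.PropositionalEquality as ≡ using (_≡_; _≢_)
import Relation.Binary.Reasoning.Setoid as SetoidReasoning
open import Relation.Nullary using (¬_; Dec; yes; no; does; contradiction)
open import Relation.Nullary.Decidable using (map′; _×-dec_; dec-true)

import Defs
open Defs using
  ( BipartiteGraph; Vertex; Adj; forth; back; edges; Connected; adj?; star?; connected?
  ; allVecs; allGraphs; Nbi; Polynomial)

-- Power series over a commutative ring

-- The first recursion yields only derivatives, and integrating them can leave the rational
-- functions: F₁ is -(log(1 - W) + W)/2. So the induction runs on the derivatives, and Fₖ itself is
-- taken from the edge equation, whose factor k - 1 vanishes exactly in the logarithmic case. The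
-- rate of three poles per unit of k is the one that reproduces itself: if derivatives have order 3k
-- - 1, the products in Kₖ have order (3i - 1) + (3j - 1) = 3k - 2 for i + j = k, and solving for
-- the derivatives divides by 1 - W once more. The operator L arises by adding Dx Fₖ = Tx Dy Fₖ + Kₖ
-- to its mirror image. In the coordinates Tx, Ty it is the Euler field Tx ∂/∂Tx + Ty ∂/∂Ty, so it
-- doubles W and sends (1 - W)^(-q) to 2q W (1 - W)^(-q-1). Rational expressions have no unique form
-- as combinations of monomials in Tx, Ty and 1/(1 - W); the drop of the order is therefore obtained
-- by comparing L f with 2p W f/(1 - W) monomial by monomial.

Ring₀ : Set₁
Ring₀ = CommutativeRing 0ℓ 0ℓ

tail : ∀ {A : Set} → (ℕ → A) → ℕ → A
tail f n = f (suc n)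

module Convolution (K : Ring₀) where
  open CommutativeRing K
  open SetoidReasoning setoid
  private module S = NatSolver commutativeSemiring
  open S using (_:+_; _:*_; _:=_)

  infix 4 _≋_
  _≋_ : (f g : ℕ → Carrier) → Set
  f ≋ g = ∀ n → f n ≈ g n

  infixl 7 _⊛_
  -- The Cauchy product, peeled at the index of the left factor. Recursion on `tail f` involves
  -- neither subtraction of indices nor finite sums, and the ring laws become inductions on the
  -- index with f generalised.
  _⊛_ : (f g : ℕ → Carrier) → ℕ → Carrier
  (f ⊛ g) zero    = f 0 * g 0
  (f ⊛ g) (suc n) = f 0 * g (suc n) + (tail f ⊛ g) n

  one : ℕ → Carrier
  one zero    = 1#
  one (suc _) = 0#

  ⊛-cong : ∀ {f f′ g g′} → f ≋ f′ → g ≋ g′ → f ⊛ g ≋ f′ ⊛ g′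
  ⊛-cong p q zero    = *-cong (p 0) (q 0)
  ⊛-cong p q (suc n) = +-cong (*-cong (p 0) (q (suc n))) (⊛-cong (λ i → p (suc i)) q n)

  ⊛-zeroˡ : ∀ {f} → f ≋ (λ _ → 0#) → ∀ g → f ⊛ g ≋ λ _ → 0#
  ⊛-zeroˡ p g zero    = trans (*-congʳ (p 0)) (zeroˡ _)
  ⊛-zeroˡ p g (suc n) = trans (+-cong (trans (*-congʳ (p 0)) (zeroˡ _)) (⊛-zeroˡ (λ i → p (suc i)) g n)) (+-identityˡ _)

  ⊛-identityˡ : ∀ g → one ⊛ g ≋ g
  ⊛-identityˡ g zero    = *-identityˡ _
  ⊛-identityˡ g (suc n) = trans (+-cong (*-identityˡ _) (⊛-zeroˡ (λ _ → refl) g n)) (+-identityʳ _)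

  ⊛-distribʳ : ∀ f g h → (λ n → f n + g n) ⊛ h ≋ λ n → (f ⊛ h) n + (g ⊛ h) n
  ⊛-distribʳ f g h zero    = distribʳ _ _ _
  ⊛-distribʳ f g h (suc n) = begin
    (f 0 + g 0) * h (suc n) + ((λ i → f (suc i) + g (suc i)) ⊛ h) n
      ≈⟨ +-congˡ (⊛-distribʳ (tail f) (tail g) h n) ⟩
    (f 0 + g 0) * h (suc n) + ((tail f ⊛ h) n + (tail g ⊛ h) n)
      ≈⟨ S.solve 5 (λ a b c d e → (a :+ b) :* c :+ (d :+ e) := a :* c :+ d :+ (b :* c :+ e)) refl _ _ _ _ _ ⟩
    f 0 * h (suc n) + (tail f ⊛ h) n + (g 0 * h (suc n) + (tail g ⊛ h) n) ∎

  ⊛-scaleˡ : ∀ a f g → (λ n → a * f n) ⊛ g ≋ λ n → a * (f ⊛ g) n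
  ⊛-scaleˡ a f g zero    = *-assoc _ _ _
  ⊛-scaleˡ a f g (suc n) = trans (+-cong (*-assoc _ _ _) (⊛-scaleˡ a (tail f) g n)) (sym (distribˡ _ _ _))

  -- Peels the product at the other end, where the index of the right factor is 0. Both recursions
  -- together give commutativity.
  ⊛-step : ∀ f g n → (f ⊛ g) (suc n) ≈ f (suc n) * g 0 + (f ⊛ tail g) n
  ⊛-step f g zero    = +-comm _ _
  ⊛-step f g (suc n) = begin
    f 0 * g (suc (suc n)) + (tail f ⊛ g) (suc n) ≈⟨ +-congˡ (⊛-step (tail f) g n) ⟩
    f 0 * g (suc (suc n)) + (f (suc (suc n)) * g 0 + (tail f ⊛ tail g) n)
      ≈⟨ S.solve 3 (λ a b c → a :+ (b :+ c) := b :+ (a :+ c)) refl _ _ _ ⟩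
    f (suc (suc n)) * g 0 + (f 0 * g (suc (suc n)) + (tail f ⊛ tail g) n) ∎

  ⊛-comm : ∀ f g → f ⊛ g ≋ g ⊛ f
  ⊛-comm f g zero    = *-comm _ _
  ⊛-comm f g (suc n) = trans (+-cong (*-comm _ _) (⊛-comm (tail f) g n)) (sym (⊛-step g f n))

  ⊛-assoc : ∀ f g h → (f ⊛ g) ⊛ h ≋ f ⊛ (g ⊛ h)
  ⊛-assoc f g h zero    = *-assoc _ _ _
  ⊛-assoc f g h (suc n) = begin
    f 0 * g 0 * h (suc n) + ((λ i → f 0 * g (suc i) + (tail f ⊛ g) i) ⊛ h) n
      ≈⟨ +-congˡ (⊛-distribʳ (λ i → f 0 * g (suc i)) (tail f ⊛ g) h n) ⟩
    f 0 * g 0 * h (suc n) + (((λ i → f 0 * g (suc i)) ⊛ h) n + ((tail f ⊛ g) ⊛ h) n)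
      ≈⟨ +-congˡ (+-cong (⊛-scaleˡ (f 0) (tail g) h n) (⊛-assoc (tail f) g h n)) ⟩
    f 0 * g 0 * h (suc n) + (f 0 * (tail g ⊛ h) n + (tail f ⊛ (g ⊛ h)) n)
      ≈⟨ S.solve 5 (λ a b c d e → a :* b :* c :+ (a :* d :+ e) := a :* (b :* c :+ d) :+ e) refl _ _ _ _ _ ⟩
    f 0 * (g 0 * h (suc n) + (tail g ⊛ h) n) + (tail f ⊛ (g ⊛ h)) n ∎

  ⊛-isCommutativeRing : IsCommutativeRing _≋_ (λ f g n → f n + g n) _⊛_ (λ f n → - f n) (λ _ → 0#) one
  ⊛-isCommutativeRing = record
    { isRing = record
      { +-isAbelianGroup = record
        { isGroup = record
          { isMonoid = record
            { isSemigroup = record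
              { isMagma = record
                { isEquivalence = record
                  { refl  = λ _ → refl
                  ; sym   = λ p n → sym (p n)
                  ; trans = λ p q n → trans (p n) (q n)
                  }
                ; ∙-cong = λ p q n → +-cong (p n) (q n)
                }
              ; assoc = λ f g h n → +-assoc _ _ _
              }
            ; identity = (λ f n → +-identityˡ _) , (λ f n → +-identityʳ _)
            }
          ; inverse = (λ f n → -‿inverseˡ _) , (λ f n → -‿inverseʳ _)
          ; ⁻¹-cong = λ p n → -‿cong (p n)
          }
        ; comm = λ f g n → +-comm _ _
        }
      ; *-cong = ⊛-cong
      ; *-assoc = ⊛-assoc
      ; *-identity = ⊛-identityˡ , (λ g n → trans (⊛-comm g one n) (⊛-identityˡ g n))
      ; distrib = (λ f g h n → trans (⊛-comm f _ n) (trans (⊛-distribʳ g h f n) (+-cong (⊛-comm g f n) (⊛-comm h f n))))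
                , (λ f g h → ⊛-distribʳ g h f)
      }
    ; *-comm = ⊛-comm
    }

PS : Ring₀ → Ring₀
PS K = record { isCommutativeRing = Convolution.⊛-isCommutativeRing K }

-- Derivations and endomorphisms of rings of power series

module Notions (K : Ring₀) where
  open CommutativeRing K
  open SemiringMult semiring using (_×_)

  TorsionFree : Set
  TorsionFree = ∀ n {x y} → suc n × x ≈ suc n × y → x ≈ y

  Regular : Carrier → Set
  Regular g = ∀ {x y} → x * g ≈ y * g → x ≈ y

  record IsDerivation (d : Carrier → Carrier) : Set where
    field
      d-cong : ∀ {x y} → x ≈ y → d x ≈ d y
      d-+    : ∀ x y → d (x + y) ≈ d x + d y
      d-*    : ∀ x y → d (x * y) ≈ d x * y + x * d y

    open GroupProperties +-group using (∙-cancelˡ)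

    d-0 : d 0# ≈ 0#
    d-0 = ∙-cancelˡ (d 0#) _ _ (trans (sym (d-+ 0# 0#)) (trans (d-cong (+-identityˡ 0#)) (sym (+-identityʳ _))))

    d-1 : d 1# ≈ 0#
    d-1 = ∙-cancelˡ (d 1#) _ _ (trans
      (sym (trans (d-* 1# 1#) (+-cong (*-identityʳ _) (*-identityˡ _))))
      (trans (d-cong (*-identityˡ 1#)) (sym (+-identityʳ _))))

    d-× : ∀ n x → d (n × x) ≈ n × d x
    d-× zero    x = d-0
    d-× (suc n) x = trans (d-+ x _) (+-congˡ (d-× n x))

  record IsEndo (h : Carrier → Carrier) : Set where
    field
      h-cong : ∀ {x y} → x ≈ y → h x ≈ h y
      h-+    : ∀ x y → h (x + y) ≈ h x + h y
      h-*    : ∀ x y → h (x * y) ≈ h x * h y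

module Euler (K : Ring₀) where
  open CommutativeRing K
  open Convolution K
  open SetoidReasoning setoid
  open SemiringMult semiring using (_×_; ×-congʳ; ×-comm-*; ×-assoc-*)
  open CMult +-commutativeMonoid using (×-distrib-+)
  open Exp commutativeSemiring using (_^_)
  open GroupProperties +-group using (∙-cancelˡ)
  private
    module S = NatSolver commutativeSemiring
    module N = Notions K
    module NP = Notions (PS K)
    module P = CommutativeRing (PS K)
  open SemiringMult P.semiring using () renaming (_×_ to _P×_)
  open S using (_:+_; _:*_; _:=_)
  open NP.IsDerivation
  open NP.IsEndo

  ×-zeroʳ : ∀ n → n × 0# ≈ 0#
  ×-zeroʳ zero    = refl
  ×-zeroʳ (suc n) = trans (+-identityˡ _) (×-zeroʳ n)

  euler : (ℕ → Carrier) → ℕ → Carrier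
  euler f n = n × f n

  private
    euler-* : ∀ f g → euler (f ⊛ g) ≋ λ n → (euler f ⊛ g) n + (f ⊛ euler g) n
    euler-* f g zero    = sym (trans (+-cong (zeroˡ _) (zeroʳ _)) (+-identityˡ _))
    euler-* f g (suc n) = begin
      suc n × (f 0 * g (suc n) + (tail f ⊛ g) n)
        ≈⟨ ×-distrib-+ _ _ (suc n) ⟩
      suc n × (f 0 * g (suc n)) + ((tail f ⊛ g) n + n × (tail f ⊛ g) n)
        ≈⟨ +-cong (sym (×-comm-* (suc n) (f 0) (g (suc n)))) (+-congˡ (euler-* (tail f) g n)) ⟩
      f 0 * (suc n × g (suc n)) + ((tail f ⊛ g) n + ((euler (tail f) ⊛ g) n + (tail f ⊛ euler g) n))
        ≈⟨ S.solve 4 (λ a b c d → a :+ (b :+ (c :+ d)) := (b :+ c) :+ (a :+ d)) refl _ _ _ _ ⟩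
      ((tail f ⊛ g) n + (euler (tail f) ⊛ g) n) + (f 0 * (suc n × g (suc n)) + (tail f ⊛ euler g) n)
        ≈⟨ +-congʳ (⊛-distribʳ (tail f) (euler (tail f)) g n) ⟨
      (tail (euler f) ⊛ g) n + (f ⊛ euler g) (suc n)
        ≈⟨ +-congʳ (trans (+-congʳ (zeroˡ _)) (+-identityˡ _)) ⟨
      (euler f ⊛ g) (suc n) + (f ⊛ euler g) (suc n) ∎

  euler-isDerivation : NP.IsDerivation euler
  euler-isDerivation .d-cong p n  = ×-congʳ n (p n)
  euler-isDerivation .d-+ f g n   = ×-distrib-+ _ _ n
  euler-isDerivation .d-*         = euler-*

  lift : (Carrier → Carrier) → (ℕ → Carrier) → ℕ → Carrier
  lift h f n = h (f n)

  lift-isDerivation : ∀ {d} → N.IsDerivation d → NP.IsDerivation (lift d)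
  lift-isDerivation {d} D = record { d-cong = λ p n → D.d-cong (p n) ; d-+ = λ f g n → D.d-+ _ _ ; d-* = leibniz }
    where
    module D = N.IsDerivation D
    leibniz : ∀ f g → lift d (f ⊛ g) ≋ λ n → (lift d f ⊛ g) n + (f ⊛ lift d g) n
    leibniz f g zero    = D.d-* _ _
    leibniz f g (suc n) = begin
      d (f 0 * g (suc n) + (tail f ⊛ g) n)
        ≈⟨ D.d-+ _ _ ⟩
      d (f 0 * g (suc n)) + d ((tail f ⊛ g) n)
        ≈⟨ +-cong (D.d-* _ _) (leibniz (tail f) g n) ⟩
      d (f 0) * g (suc n) + f 0 * d (g (suc n)) + ((lift d (tail f) ⊛ g) n + (tail f ⊛ lift d g) n)
        ≈⟨ S.solve 4 (λ a b c e → a :+ b :+ (c :+ e) := a :+ c :+ (b :+ e)) refl _ _ _ _ ⟩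
      (lift d f ⊛ g) (suc n) + (f ⊛ lift d g) (suc n) ∎

  lift-isEndo : ∀ {h} → N.IsEndo h → NP.IsEndo (lift h)
  lift-isEndo {h} H = record { h-cong = λ p n → H.h-cong (p n) ; h-+ = λ f g n → H.h-+ _ _ ; h-* = mult }
    where
    module H = N.IsEndo H
    mult : ∀ f g → lift h (f ⊛ g) ≋ lift h f ⊛ lift h g
    mult f g zero    = H.h-* _ _
    mult f g (suc n) = trans (H.h-+ _ _) (+-cong (H.h-* _ _) (mult (tail f) g n))

  -- The substitution of a t for the variable t.
  scale : Carrier → (ℕ → Carrier) → ℕ → Carrier
  scale a f n = a ^ n * f n

  scale-isEndo : ∀ a → NP.IsEndo (scale a)
  scale-isEndo a = record { h-cong = λ p n → *-congˡ (p n) ; h-+ = λ f g n → distribˡ _ _ _ ; h-* = mult }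
    where
    mult : ∀ f g → scale a (f ⊛ g) ≋ scale a f ⊛ scale a g
    mult f g zero    = S.solve 2 (λ x y → S.con 1 :* (x :* y) := S.con 1 :* x :* (S.con 1 :* y)) refl _ _
    mult f g (suc n) = begin
      a * a ^ n * (f 0 * g (suc n) + (tail f ⊛ g) n)
        ≈⟨ S.solve 5 (λ a p x y z → a :* p :* (x :* y :+ z) := S.con 1 :* x :* (a :* p :* y) :+ a :* (p :* z)) refl a (a ^ n) _ _ _ ⟩
      1# * f 0 * (a * a ^ n * g (suc n)) + a * (a ^ n * (tail f ⊛ g) n)
        ≈⟨ +-congˡ (*-congˡ (mult (tail f) g n)) ⟩
      1# * f 0 * (a * a ^ n * g (suc n)) + a * (scale a (tail f) ⊛ scale a g) n
        ≈⟨ +-congˡ (⊛-scaleˡ a _ _ n) ⟨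
      1# * f 0 * (a * a ^ n * g (suc n)) + ((λ i → a * scale a (tail f) i) ⊛ scale a g) n
        ≈⟨ +-congˡ (⊛-cong (λ i → sym (*-assoc a (a ^ i) (f (suc i)))) (λ _ → refl) n) ⟩
      (scale a f ⊛ scale a g) (suc n) ∎

  euler-scale : ∀ a f → euler (scale a f) ≋ scale a (euler f)
  euler-scale a f n = sym (×-comm-* n (a ^ n) (f n))

  -- the chain rule for a substitution a with d a = a
  derivation-scale : ∀ {d} → N.IsDerivation d → ∀ {a} → d a ≈ a → ∀ f →
    lift d (scale a f) ≋ λ n → scale a (λ i → lift d f i + euler f i) n
  derivation-scale {d} D {a} da f n = begin
    d (a ^ n * f n) ≈⟨ D.d-* _ _ ⟩
    d (a ^ n) * f n + a ^ n * d (f n) ≈⟨ +-congʳ (*-congʳ (power n)) ⟩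
    n × a ^ n * f n + a ^ n * d (f n) ≈⟨ +-congʳ (trans (×-assoc-* n _ _) (sym (×-comm-* n _ _))) ⟩
    a ^ n * (n × f n) + a ^ n * d (f n) ≈⟨ trans (+-comm _ _) (sym (distribˡ _ _ _)) ⟩
    a ^ n * (d (f n) + n × f n) ∎
    where
    module D = N.IsDerivation D
    power : ∀ n → d (a ^ n) ≈ n × a ^ n
    power zero    = D.d-1
    power (suc n) = trans (D.d-* _ _) (+-cong (*-congʳ da) (trans (*-congˡ (power n)) (×-comm-* n _ _)))

  ×-pointwise : ∀ n f i → (n P× f) i ≡ n × f i
  ×-pointwise zero    f i = ≡.refl
  ×-pointwise (suc n) f i = ≡.cong (f i +_) (×-pointwise n f i)

  PS-torsionFree : N.TorsionFree → NP.TorsionFree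
  PS-torsionFree tf n {f} {g} p i =
    tf n (trans (reflexive (≡.sym (×-pointwise (suc n) f i))) (trans (p i) (reflexive (×-pointwise (suc n) g i))))

  -- At index 0 the hypothesis on `g 0` gives x 0 ≈ y 0; cancelling these terms at the later indices
  -- leaves the same situation for the tails.
  PS-regular : ∀ g → N.Regular (g 0) → NP.Regular g
  PS-regular g reg {x} {y} p zero    = reg (p 0)
  PS-regular g reg {x} {y} p (suc n) = PS-regular g reg {tail x} {tail y}
    (λ i → ∙-cancelˡ (x 0 * g (suc i)) _ _ (trans (p (suc i)) (+-congʳ (*-congʳ (sym (reg (p 0))))))) n

  -- (A ⊛ p)(n) only involves A(0), …, A(n-1) because p(0) = 0.
  euler-unique : N.TorsionFree → ∀ {A B p X : ℕ → Carrier} → p 0 ≈ 0# → A 0 ≈ B 0 →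
    euler A ≋ (λ n → (A ⊛ p) n + X n) → euler B ≋ (λ n → (B ⊛ p) n + X n) → A ≋ B
  euler-unique tf {A} {B} {p = p} {X} p0 AB0 eA eB n = below (suc n) n (ℕP.n<1+n n)
    where
    import Data.Nat.Properties as ℕP
    agree : ∀ f g n → (∀ i → i ℕ.< n → f i ≈ g i) → (f ⊛ p) n ≈ (g ⊛ p) n
    agree f g zero    h = trans (vanish f) (sym (vanish g))
      where
      vanish : ∀ f → f 0 * p 0 ≈ 0#
      vanish f = trans (*-congˡ p0) (zeroʳ (f 0))
    agree f g (suc n) h = +-cong (*-congʳ (h 0 (ℕ.s≤s ℕ.z≤n))) (agree (tail f) (tail g) n (λ i i<n → h (suc i) (ℕ.s≤s i<n)))
    below : ∀ n i → i ℕ.< n → A i ≈ B i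
    below (suc n) zero    _           = AB0
    below (suc n) (suc i) (ℕ.s≤s i<n) = tf i (begin
      suc i × A (suc i) ≈⟨ eA (suc i) ⟩
      (A ⊛ p) (suc i) + X (suc i) ≈⟨ +-congʳ (agree A B (suc i) (λ j j<i → below n j (ℕP.≤-trans j<i i<n))) ⟩
      (B ⊛ p) (suc i) + X (suc i) ≈⟨ eB (suc i) ⟨
      suc i × B (suc i) ∎)

module Swap (K : Ring₀) where
  open CommutativeRing K
  private
    module P = CommutativeRing (PS K)
    module C = Convolution K
    module CC = Convolution (PS K)
    module S = NatSolver commutativeSemiring
  open S using (_:+_; _:=_)
  open CC using () renaming (_⊛_ to _⊠_)
  open C using (_⊛_)
  open SetoidReasoning setoid

  swap : (ℕ → ℕ → Carrier) → ℕ → ℕ → Carrier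
  swap f m n = f n m

  -- The double product peeled in the inner variable. This is the defining recursion for the product
  -- of the exchanged series, so `swap` is multiplicative.
  ⊠-step : ∀ h k n m → (h ⊠ k) n (suc m) ≈
    ((λ i → h i 0) ⊛ (λ i → k i (suc m))) n + ((λ i → tail (h i)) ⊠ k) n m
  ⊠-step h k zero    m = refl
  ⊠-step h k (suc n) m = begin
    h 0 0 * k (suc n) (suc m) + (tail (h 0) ⊛ k (suc n)) m + (tail h ⊠ k) n (suc m)
      ≈⟨ +-congˡ (⊠-step (tail h) k n m) ⟩
    h 0 0 * k (suc n) (suc m) + (tail (h 0) ⊛ k (suc n)) m
      + (((λ i → h (suc i) 0) ⊛ (λ i → k i (suc m))) n + ((λ i → tail (h (suc i))) ⊠ k) n m)
      ≈⟨ S.solve 4 (λ a b c d → a :+ b :+ (c :+ d) := a :+ c :+ (b :+ d)) refl _ _ _ _ ⟩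
    h 0 0 * k (suc n) (suc m) + ((λ i → h (suc i) 0) ⊛ (λ i → k i (suc m))) n
      + ((tail (h 0) ⊛ k (suc n)) m + ((λ i → tail (h (suc i))) ⊠ k) n m) ∎

  ⊠-zero : ∀ h k n → (h ⊠ k) n 0 ≈ ((λ i → h i 0) ⊛ (λ i → k i 0)) n
  ⊠-zero h k zero    = refl
  ⊠-zero h k (suc n) = +-congˡ (⊠-zero (tail h) k n)

  swap-* : ∀ f g m n → swap (f ⊠ g) m n ≈ (swap f ⊠ swap g) m n
  swap-* f g m zero    = sym (⊠-zero (swap f) (swap g) m)
  swap-* f g m (suc n) = sym (trans (⊠-step (swap f) (swap g) m n) (+-congˡ (sym (swap-* (tail f) g m n))))

  swap-isEndo : Notions.IsEndo (PS (PS K)) swap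
  swap-isEndo = record { h-cong = λ p m n → p n m ; h-+ = λ f g m n → refl ; h-* = swap-* }

module Closure (R : Ring₀) where
  open CommutativeRing R
  open Convolution R

  -- A coefficient of a product is a finite sum of terms f i * g j with i + j = n. The form with a
  -- predicate closed under addition serves both the vanishing of coefficients and membership in a
  -- span.
  ⊛-closed : ∀ {P : Carrier → Set} → (∀ {x y} → P x → P y → P (x + y)) → ∀ f g n →
    (∀ i j → i ℕ.+ j ≡ n → P (f i * g j)) → P ((f ⊛ g) n)
  ⊛-closed {P} P-+ f g zero    h = h 0 0 ≡.refl
  ⊛-closed {P} P-+ f g (suc n) h = P-+ (h 0 (suc n) ≡.refl) (⊛-closed {P} P-+ (tail f) g n (λ i j p → h (suc i) j (≡.cong suc p)))

  ⊛-agree : ∀ (g h h′ : ℕ → Carrier) (_~_ : Carrier → Carrier → Set) →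
    (∀ {x x′ y y′} → x ~ x′ → y ~ y′ → (x + y) ~ (x′ + y′)) → ∀ n →
    (∀ i j → i ℕ.+ j ≡ n → (g i * h j) ~ (g i * h′ j)) → (g ⊛ h) n ~ (g ⊛ h′) n
  ⊛-agree g h h′ _~_ ~-+ zero    k = k 0 0 ≡.refl
  ⊛-agree g h h′ _~_ ~-+ (suc n) k = ~-+ (k 0 (suc n) ≡.refl) (⊛-agree (tail g) h h′ _~_ ~-+ n (λ i j p → k (suc i) j (≡.cong suc p)))

-- Components of bipartite graphs

module Components where
  open import Data.Bool.Base using (true; false)
  open import Data.Fin.Base using (zero; suc; splitAt; join)
  open import Data.Fin.Properties using (splitAt-join; suc-injective)
  open import Data.Fin.Subset.Properties using (_∈?_; ⊆-antisym; x∉p⇒x∈∁p; x∈∁p⇒x∉p)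
  open import Data.Nat.Properties using (+-assoc; +-comm; +-suc; +-commutativeSemigroup)
  open import Algebra.Properties.CommutativeSemigroup +-commutativeSemigroup using (interchange)
  open import Data.Product.Base using (_×_)
  open import Data.Vec.Properties
    using (lookup-map; lookup-replicate; lookup∘tabulate; tabulate∘lookup; tabulate-cong; []=⇒lookup; lookup⇒[]=)
  open ≡ using (refl; sym; trans; cong; cong₂; subst₂; _≗_)

  module _ {X : Set} where

    select : ∀ {n} (A : Subset n) → Vec X n → Vec X (card A)
    select []            []      = []
    select (inside  ∷ A) (x ∷ v) = x ∷ select A v
    select (outside ∷ A) (x ∷ v) = select A v

    -- The entries on A and on its complement are renumbered in increasing order, so a subgraph is
    -- again a `BipartiteGraph` and no relabellings have to be counted.
    merge : ∀ {n} (A : Subset n) → Vec X (card A) → Vec X (card (∁ A)) → Vec X n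
    merge []            []      []      = []
    merge (inside  ∷ A) (x ∷ v) w       = x ∷ merge A v w
    merge (outside ∷ A) v       (y ∷ w) = y ∷ merge A v w

    select-merge : ∀ {n} (A : Subset n) v w → select A (merge A v w) ≡ v
    select-merge []            []      []      = refl
    select-merge (inside  ∷ A) (x ∷ v) w       = cong (x ∷_) (select-merge A v w)
    select-merge (outside ∷ A) v       (y ∷ w) = select-merge A v w

    select-∁-merge : ∀ {n} (A : Subset n) v w → select (∁ A) (merge A v w) ≡ w
    select-∁-merge []            []      []      = refl
    select-∁-merge (inside  ∷ A) (x ∷ v) w       = select-∁-merge A v w
    select-∁-merge (outside ∷ A) v       (y ∷ w) = cong (y ∷_) (select-∁-merge A v w)

    lookup-injective : ∀ {n} {v w : Vec X n} → lookup v ≗ lookup w → v ≡ w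
    lookup-injective {v = v} {w} p =
      trans (sym (tabulate∘lookup v)) (trans (tabulate-cong p) (tabulate∘lookup w))

  emb : ∀ {n} (A : Subset n) → Fin (card A) → Fin n
  emb (inside  ∷ A) zero    = zero
  emb (inside  ∷ A) (suc k) = suc (emb A k)
  emb (outside ∷ A) k       = suc (emb A k)

  lookup-select : ∀ {X : Set} {n} (A : Subset n) (v : Vec X n) k → lookup (select A v) k ≡ lookup v (emb A k)
  lookup-select (inside  ∷ A) (x ∷ v) zero    = refl
  lookup-select (inside  ∷ A) (x ∷ v) (suc k) = lookup-select A v k
  lookup-select (outside ∷ A) (x ∷ v) k       = lookup-select A v k

  emb∈ : ∀ {n} (A : Subset n) k → emb A k ∈ A
  emb∈ (inside  ∷ A) zero    = here
  emb∈ (inside  ∷ A) (suc k) = there (emb∈ A k)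
  emb∈ (outside ∷ A) k       = there (emb∈ A k)

  emb-surjective : ∀ {n} (A : Subset n) {i} → i ∈ A → ∃ λ k → emb A k ≡ i
  emb-surjective (inside  ∷ A) here      = zero , refl
  emb-surjective (inside  ∷ A) (there p) with emb-surjective A p
  ... | k , refl = suc k , refl
  emb-surjective (outside ∷ A) (there p) with emb-surjective A p
  ... | k , refl = k , refl

  emb-injective : ∀ {n} (A : Subset n) {k l} → emb A k ≡ emb A l → k ≡ l
  emb-injective (inside  ∷ A) {zero}  {zero}  p = refl
  emb-injective (inside  ∷ A) {suc k} {suc l} p = cong suc (emb-injective A (suc-injective p))
  emb-injective (outside ∷ A) p = emb-injective A (suc-injective p)

  -- The subgraph induced on A and B; with one of the two complemented it holds edges that leave (A,
  -- B).
  block : ∀ {r s} (A : Subset r) (B : Subset s) → BipartiteGraph r s → BipartiteGraph (card A) (card B)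
  block A B G = Vec.map (select B) (select A G)

  ∅ : ∀ {r s} → BipartiteGraph r s
  ∅ {r} {s} = replicate r (replicate s outside)

  lookup-block : ∀ {r s} (A : Subset r) (B : Subset s) (G : BipartiteGraph r s) k l →
    lookup (lookup (block A B G) k) l ≡ lookup (lookup G (emb A k)) (emb B l)
  lookup-block A B G k l =
    trans (cong (λ row → lookup row l) (lookup-map k (select B) (select A G)))
      (trans (lookup-select B (lookup (select A G) k) l)
        (cong (λ row → lookup row (emb B l)) (lookup-select A G k)))

  lookup-∅ : ∀ {r s} k l → lookup (lookup (∅ {r} {s}) k) l ≡ outside
  lookup-∅ {r} {s} k l =
    trans (cong (λ row → lookup row l) (lookup-replicate k (replicate s outside))) (lookup-replicate l outside)

  -- (A , B) is the vertex set of a union of components of G, and it is connected.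
  IsComponent : ∀ {r s} → BipartiteGraph r s → Subset r → Subset s → Set
  IsComponent G A B = (block A (∁ B) G ≡ ∅ × block (∁ A) B G ≡ ∅) × Connected (block A B G)

  module _ {r s} (A : Subset r) (B : Subset s) where

    In : Vertex r s → Set
    In (inj₁ i) = i ∈ A
    In (inj₂ j) = j ∈ B

    embᵛ : Vertex (card A) (card B) → Vertex r s
    embᵛ = Sum.map (emb A) (emb B)

    In-embᵛ : ∀ v → In (embᵛ v)
    In-embᵛ (inj₁ k) = emb∈ A k
    In-embᵛ (inj₂ l) = emb∈ B l

    embᵛ-surjective : ∀ v → In v → ∃ λ w → embᵛ w ≡ v
    embᵛ-surjective (inj₁ i) p with emb-surjective A p
    ... | k , refl = inj₁ k , refl
    embᵛ-surjective (inj₂ j) p with emb-surjective B p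
    ... | l , refl = inj₂ l , refl

    embᵛ-injective : ∀ v w → embᵛ v ≡ embᵛ w → v ≡ w
    embᵛ-injective (inj₁ k) (inj₁ l) p = cong inj₁ (emb-injective A (inj₁-inj p))
      where
      inj₁-inj : ∀ {i j} → inj₁ i ≡ inj₁ j → i ≡ j
      inj₁-inj refl = refl
    embᵛ-injective (inj₂ k) (inj₂ l) p = cong inj₂ (emb-injective B (inj₂-inj p))
      where
      inj₂-inj : ∀ {i j} → inj₂ i ≡ inj₂ j → i ≡ j
      inj₂-inj refl = refl

    module _ (G : BipartiteGraph r s) where

      entry⁺ : ∀ {k l} → emb B l ∈ lookup G (emb A k) → l ∈ lookup (block A B G) k
      entry⁺ {k} {l} p = lookup⇒[]= l _ (trans (lookup-block A B G k l) ([]=⇒lookup p))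

      entry⁻ : ∀ {k l} → l ∈ lookup (block A B G) k → emb B l ∈ lookup G (emb A k)
      entry⁻ {k} {l} p = lookup⇒[]= (emb B l) _ (trans (sym (lookup-block A B G k l)) ([]=⇒lookup p))

      Adj⁺ : ∀ v w → Adj G (embᵛ v) (embᵛ w) → Adj (block A B G) v w
      Adj⁺ (inj₁ k) (inj₂ l) (forth p) = forth (entry⁺ p)
      Adj⁺ (inj₂ l) (inj₁ k) (back p)  = back (entry⁺ p)

      Adj⁻ : ∀ {v w} → Adj (block A B G) v w → Adj G (embᵛ v) (embᵛ w)
      Adj⁻ (forth p) = forth (entry⁻ p)
      Adj⁻ (back p)  = back (entry⁻ p)

  block-∅⇒∉ : ∀ {r s} (A : Subset r) (B : Subset s) (G : BipartiteGraph r s) → block A B G ≡ ∅ →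
    ∀ {i j} → i ∈ A → j ∈ B → j ∉ lookup G i
  block-∅⇒∉ A B G empty i∈A j∈B j∈Gi with emb-surjective A i∈A | emb-surjective B j∈B
  ... | k , refl | l , refl
    with trans (sym (lookup-∅ k l)) (trans (cong (λ H → lookup (lookup H k) l) (sym empty)) ([]=⇒lookup (entry⁺ A B G j∈Gi)))
  ... | ()

  ∉⇒block-∅ : ∀ {r s} (A : Subset r) (B : Subset s) (G : BipartiteGraph r s) →
    (∀ {i j} → i ∈ A → j ∈ B → j ∉ lookup G i) → block A B G ≡ ∅
  ∉⇒block-∅ A B G h = lookup-injective λ k → lookup-injective λ l → entry k l
    where
    entry : ∀ k l → lookup (lookup (block A B G) k) l ≡ lookup (lookup ∅ k) l
    entry k l with lookup (lookup (block A B G) k) l in eq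
    ... | true  = contradiction (entry⁻ A B G (lookup⇒[]= l _ eq)) (h (emb∈ A k) (emb∈ B l))
    ... | false = sym (lookup-∅ k l)

  Adj-sym : ∀ {r s} {G : BipartiteGraph r s} {u v} → Adj G u v → Adj G v u
  Adj-sym (forth p) = back p
  Adj-sym (back p)  = forth p

  reachable? : ∀ {r s} (G : BipartiteGraph r s) → Decidable (Star (Adj G))
  reachable? {r} {s} G u v = map′ to from (star? (λ a b → adj? G (splitAt r a) (splitAt r b)) (join r s u) (join r s v))
    where
    to : Star (λ a b → Adj G (splitAt r a) (splitAt r b)) (join r s u) (join r s v) → Star (Adj G) u v
    to = subst₂ (Star (Adj G)) (splitAt-join r s u) (splitAt-join r s v) ∘ gmap (splitAt r) id
    from : Star (Adj G) u v → Star (λ a b → Adj G (splitAt r a) (splitAt r b)) (join r s u) (join r s v)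
    from = gmap (join r s) (λ {a} {b} → subst₂ (Adj G) (sym (splitAt-join r s a)) (sym (splitAt-join r s b)))

  separate : ∀ {n} {P : Fin n → Set} → (∀ i → Dec (P i)) → Subset n
  separate P? = tabulate (does ∘ P?)

  ∈-separate⁺ : ∀ {n} {P : Fin n → Set} (P? : ∀ i → Dec (P i)) {i} → P i → i ∈ separate P?
  ∈-separate⁺ P? {i} p = lookup⇒[]= i _ (trans (lookup∘tabulate _ i) (dec-true (P? i) p))

  ∈-separate⁻ : ∀ {n} {P : Fin n → Set} (P? : ∀ i → Dec (P i)) {i} → i ∈ separate P? → P i
  ∈-separate⁻ P? {i} p with P? i in eq
  ... | yes q = q
  ... | no _  with trans (sym ([]=⇒lookup p)) (trans (lookup∘tabulate _ i) (cong does eq))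
  ...   | ()

  module _ {r s} (G : BipartiteGraph r s) where

    module _ {A : Subset r} {B : Subset s} (C : IsComponent G A B) where

      closed : ∀ {u v} → Adj G u v → In A B u → In A B v
      closed (forth {i} {j} p) i∈A with j ∈? B
      ... | yes j∈B = j∈B
      ... | no  j∉B = contradiction p (block-∅⇒∉ A (∁ B) G (proj₁ (proj₁ C)) i∈A (x∉p⇒x∈∁p j∉B))
      closed (back {i} {j} p) j∈B with i ∈? A
      ... | yes i∈A = i∈A
      ... | no  i∉A = contradiction p (block-∅⇒∉ (∁ A) B G (proj₂ (proj₁ C)) (x∉p⇒x∈∁p i∉A) j∈B)

      closed⋆ : ∀ {u v} → Star (Adj G) u v → In A B u → In A B v
      closed⋆ ε       p = p
      closed⋆ (e ◅ q) p = closed⋆ q (closed e p)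

      joined : ∀ {u v} → In A B u → In A B v → Star (Adj G) u v
      joined {u} {v} p q with embᵛ-surjective A B u p | embᵛ-surjective A B v q
      ... | u′ , refl | v′ , refl = gmap (embᵛ A B) (Adj⁻ A B G) (proj₂ C u′ v′)

    -- A component is closed under adjacency and any two of its vertices are joined, so both pairs
    -- consist of the vertices reachable from v.
    component-unique : ∀ {A A′ B B′ v} → IsComponent G A B → IsComponent G A′ B′ →
      In A B v → In A′ B′ v → A ≡ A′ × B ≡ B′
    component-unique {A} {A′} {B} {B′} {v} C C′ p p′ =
      ⊆-antisym (λ {i} → to (inj₁ i)) (λ {i} → from (inj₁ i)) ,
      ⊆-antisym (λ {j} → to (inj₂ j)) (λ {j} → from (inj₂ j))
      where
      to : ∀ w → In A B w → In A′ B′ w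
      to w q = closed⋆ C′ (joined C p q) p′
      from : ∀ w → In A′ B′ w → In A B w
      from w q = closed⋆ C (joined C′ p′ q) p

    module _ (v : Vertex r s) where

      reachable₁ : Subset r
      reachable₁ = separate (λ i → reachable? G v (inj₁ i))

      reachable₂ : Subset s
      reachable₂ = separate (λ j → reachable? G v (inj₂ j))

      In-reachable⁺ : ∀ {w} → Star (Adj G) v w → In reachable₁ reachable₂ w
      In-reachable⁺ {inj₁ i} = ∈-separate⁺ (λ i → reachable? G v (inj₁ i))
      In-reachable⁺ {inj₂ j} = ∈-separate⁺ (λ j → reachable? G v (inj₂ j))

      In-reachable⁻ : ∀ {w} → In reachable₁ reachable₂ w → Star (Adj G) v w
      In-reachable⁻ {inj₁ i} = ∈-separate⁻ (λ i → reachable? G v (inj₁ i))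
      In-reachable⁻ {inj₂ j} = ∈-separate⁻ (λ j → reachable? G v (inj₂ j))

      component-exists : IsComponent G reachable₁ reachable₂
      component-exists = (∉⇒block-∅ A (∁ B) G leave₁ , ∉⇒block-∅ (∁ A) B G leave₂) , connected
        where
        A = reachable₁
        B = reachable₂
        leave₁ : ∀ {i j} → i ∈ A → j ∈ ∁ B → j ∉ lookup G i
        leave₁ {i} {j} i∈A j∈∁B j∈Gi =
          x∈∁p⇒x∉p j∈∁B (In-reachable⁺ {inj₂ j} (In-reachable⁻ {inj₁ i} i∈A ◅◅ (forth j∈Gi ◅ ε)))
        leave₂ : ∀ {i j} → i ∈ ∁ A → j ∈ B → j ∉ lookup G i
        leave₂ {i} {j} i∈∁A j∈B j∈Gi =
          x∈∁p⇒x∉p i∈∁A (In-reachable⁺ {inj₁ i} (In-reachable⁻ {inj₂ j} j∈B ◅◅ (back j∈Gi ◅ ε)))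
        -- A path of G from a reachable vertex never leaves the reachable set; `va` carries this
        -- along the path, so that each of its vertices can be renumbered.
        restrict : ∀ {a b} → Star (Adj G) a b → Star (Adj G) v a → ∀ a′ b′ → embᵛ A B a′ ≡ a → embᵛ A B b′ ≡ b →
          Star (Adj (block A B G)) a′ b′
        restrict ε va a′ b′ refl q with embᵛ-injective A B a′ b′ (sym q)
        ... | refl = ε
        restrict (_◅_ {j = c} e p) va a′ b′ refl q with embᵛ-surjective A B c (In-reachable⁺ (va ◅◅ (e ◅ ε)))
        ... | c′ , refl = Adj⁺ A B G a′ c′ e ◅ restrict p (va ◅◅ (e ◅ ε)) c′ b′ refl q
        connected : Connected (block A B G)
        connected a b = restrict (reverse Adj-sym va ◅◅ vb) va a b refl refl
          where
          va = In-reachable⁻ (In-embᵛ A B a)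
          vb = In-reachable⁻ (In-embᵛ A B b)

  card-merge : ∀ {n} (B : Subset n) p q → card (merge B p q) ≡ card p ℕ.+ card q
  card-merge []            []            []            = refl
  card-merge (inside  ∷ B) (inside  ∷ p) q             = cong suc (card-merge B p q)
  card-merge (inside  ∷ B) (outside ∷ p) q             = card-merge B p q
  card-merge (outside ∷ B) p             (inside  ∷ q) = trans (cong suc (card-merge B p q)) (sym (+-suc (card p) (card q)))
  card-merge (outside ∷ B) p             (outside ∷ q) = card-merge B p q

  edges-merge : ∀ {n s} (A : Subset n) (X : BipartiteGraph (card A) s) Y → edges (merge A X Y) ≡ edges X ℕ.+ edges Y
  edges-merge []            []      []      = refl
  edges-merge (inside  ∷ A) (x ∷ X) Y       = trans (cong (card x ℕ.+_) (edges-merge A X Y)) (sym (+-assoc (card x) (edges X) (edges Y)))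
  edges-merge (outside ∷ A) X       (y ∷ Y) = trans (cong (card y ℕ.+_) (edges-merge A X Y)) (swap∙ (card y) (edges X) (edges Y))
    where
    swap∙ : ∀ a b c → a ℕ.+ (b ℕ.+ c) ≡ b ℕ.+ (a ℕ.+ c)
    swap∙ a b c = trans (sym (+-assoc a b c)) (trans (cong (ℕ._+ c) (+-comm a b)) (+-assoc b a c))

  edges-zipWith-merge : ∀ {n s} (B : Subset s) (P : BipartiteGraph n (card B)) Q →
    edges (zipWith (merge B) P Q) ≡ edges P ℕ.+ edges Q
  edges-zipWith-merge B []      []      = refl
  edges-zipWith-merge B (p ∷ P) (q ∷ Q) = trans (cong₂ ℕ._+_ (card-merge B p q) (edges-zipWith-merge B P Q))
    (interchange (card p) (card q) (edges P) (edges Q))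

  edges-∅ : ∀ {r s} → edges (∅ {r} {s}) ≡ 0
  edges-∅ {zero}  {s} = refl
  edges-∅ {suc r} {s} = cong₂ ℕ._+_ (empty s) (edges-∅ {r} {s})
    where
    empty : ∀ s → card (replicate s outside) ≡ 0
    empty zero    = refl
    empty (suc s) = empty s

  module _ {s} (B : Subset s) where

    select-zipWith-merge : ∀ {n} (P : BipartiteGraph n (card B)) Q → Vec.map (select B) (zipWith (merge B) P Q) ≡ P
    select-zipWith-merge []      []      = refl
    select-zipWith-merge (p ∷ P) (q ∷ Q) = cong₂ _∷_ (select-merge B p q) (select-zipWith-merge P Q)

    select-∁-zipWith-merge : ∀ {n} (P : BipartiteGraph n (card B)) Q → Vec.map (select (∁ B)) (zipWith (merge B) P Q) ≡ Q
    select-∁-zipWith-merge []      []      = refl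
    select-∁-zipWith-merge (p ∷ P) (q ∷ Q) = cong₂ _∷_ (select-∁-merge B p q) (select-∁-zipWith-merge P Q)

open Components

-- Sums over graphs

module Sums (K : Ring₀) where
  open CommutativeRing K
  open SetoidReasoning setoid
  private module S = NatSolver commutativeSemiring
  open S using (_:+_; _:=_)

  -- A finite sum is represented by its linear functional. Sums over vectors, hence over subsets and
  -- graphs, are then iterated functionals.
  Functional : Set → Set
  Functional A = (A → Carrier) → Carrier

  record IsAdditive {A : Set} (S : Functional A) : Set where
    field
      S-cong : ∀ {f g} → (∀ x → f x ≈ g x) → S f ≈ S g
      S-+    : ∀ f g → S (λ x → f x + g x) ≈ S f + S g
      S-*ˡ   : ∀ c f → S (λ x → c * f x) ≈ c * S f

    S-0 : S (λ _ → 0#) ≈ 0#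
    S-0 = trans (S-cong (λ _ → sym (zeroˡ 0#))) (trans (S-*ˡ 0# _) (zeroˡ _))

    S-*ʳ : ∀ c f → S (λ x → f x * c) ≈ S f * c
    S-*ʳ c f = trans (S-cong (λ _ → *-comm _ _)) (trans (S-*ˡ c f) (*-comm _ _))

  -- `S-swap` is the exchange of sums, against any linear functional; `S-point` evaluates sums with
  -- only one nonzero term, such as sums of indicators.
  record IsSum {A : Set} (S : Functional A) : Set₁ where
    field
      isAdditive : IsAdditive S
      S-swap     : ∀ {B : Set} {T : Functional B} → IsAdditive T → ∀ (φ : A → B → Carrier) →
                   S (λ x → T (λ y → φ x y)) ≈ T (λ y → S (λ x → φ x y))
      S-point    : ∀ x₀ f → (∀ x → x ≢ x₀ → f x ≈ 0#) → S f ≈ f x₀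
    open IsAdditive isAdditive public

  sumBool : Functional Bool
  sumBool f = f true + f false

  sumVec : ∀ {A} → Functional A → ∀ n → Functional (Vec A n)
  sumVec S zero    f = f []
  sumVec S (suc n) f = S (λ x → sumVec S n (λ v → f (x ∷ v)))

  sumBool-isSum : IsSum sumBool
  sumBool-isSum = record
    { isAdditive = record
      { S-cong = λ p → +-cong (p true) (p false)
      ; S-+    = λ f g → S.solve 4 (λ a b c d → a :+ b :+ (c :+ d) := a :+ c :+ (b :+ d)) refl _ _ _ _
      ; S-*ˡ   = λ c f → sym (distribˡ _ _ _)
      }
    ; S-swap  = λ T φ → sym (IsAdditive.S-+ T _ _)
    ; S-point = λ { true  f h → trans (+-congˡ (h false (λ ()))) (+-identityʳ _)
                  ; false f h → trans (+-congʳ (h true (λ ()))) (+-identityˡ _) }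
    }

  sumVec-isSum : ∀ {A} {S : Functional A} → IsSum S → ∀ n → IsSum (sumVec S n)
  sumVec-isSum {A} {S} Σ n = record
    { isAdditive = additive n
    ; S-swap     = λ T → swap n T
    ; S-point    = point n
    }
    where
    open IsSum Σ
    open IsAdditive using () renaming (S-cong to V-cong; S-+ to V-+; S-*ˡ to V-*ˡ; S-0 to V-0)
    additive : ∀ n → IsAdditive (sumVec S n)
    additive zero    = record { S-cong = λ p → p [] ; S-+ = λ f g → refl ; S-*ˡ = λ c f → refl }
    additive (suc n) = record
      { S-cong = λ p → S-cong (λ x → V-cong (additive n) (λ v → p (x ∷ v)))
      ; S-+    = λ f g → trans (S-cong (λ x → V-+ (additive n) _ _)) (S-+ _ _)
      ; S-*ˡ   = λ c f → trans (S-cong (λ x → V-*ˡ (additive n) c _)) (S-*ˡ c _)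
      }
    swap : ∀ n {B : Set} {T : Functional B} → IsAdditive T → ∀ (φ : Vec A n → B → Carrier) →
           sumVec S n (λ x → T (λ y → φ x y)) ≈ T (λ y → sumVec S n (λ x → φ x y))
    swap zero    T φ = refl
    swap (suc n) T φ = trans (S-cong (λ x → swap n T _)) (S-swap T _)
    point : ∀ n x₀ f → (∀ x → x ≢ x₀ → f x ≈ 0#) → sumVec S n f ≈ f x₀
    point zero    []       f h = refl
    point (suc n) (x ∷ x₀) f h = trans
      (S-point x _ (λ y y≢x → trans (V-cong (additive n) (λ v → h (y ∷ v) (λ { ≡.refl → y≢x ≡.refl }))) (V-0 (additive n))))
      (point n x₀ _ (λ v v≢ → h (x ∷ v) (λ { ≡.refl → v≢ ≡.refl })))

  sumSubset : ∀ n → Functional (Subset n)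
  sumSubset = sumVec sumBool

  sumGraph : ∀ r s → Functional (BipartiteGraph r s)
  sumGraph r s = sumVec (sumSubset s) r

  sumSubset-isSum : ∀ n → IsSum (sumSubset n)
  sumSubset-isSum = sumVec-isSum sumBool-isSum

  sumGraph-isSum : ∀ r s → IsSum (sumGraph r s)
  sumGraph-isSum r s = sumVec-isSum (sumSubset-isSum s) r

  sumVec-merge : ∀ {A} {S : Functional A} → IsSum S → ∀ {n} (B : Subset n) f →
    sumVec S n f ≈ sumVec S (card B) (λ v → sumVec S (card (∁ B)) (λ w → f (merge B v w)))
  sumVec-merge Σ []            f = refl
  sumVec-merge Σ (inside  ∷ B) f = IsSum.S-cong Σ (λ x → sumVec-merge Σ B _)
  sumVec-merge Σ (outside ∷ B) f = trans (IsSum.S-cong Σ (λ x → sumVec-merge Σ B _))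
    (IsSum.S-swap Σ (IsSum.isAdditive (sumVec-isSum Σ (card B))) _)

  -- B splits each row separately; exchanging sums collects the two halves of all the rows.
  sumGraph-zipWith-merge : ∀ n {s} (B : Subset s) f →
    sumGraph n s f ≈ sumGraph n (card B) (λ P → sumGraph n (card (∁ B)) (λ Q → f (zipWith (merge B) P Q)))
  sumGraph-zipWith-merge zero    B f = refl
  sumGraph-zipWith-merge (suc n) {s} B f = begin
    sumSubset s (λ x → sumGraph n s (λ G → f (x ∷ G)))
      ≈⟨ sumVec-merge sumBool-isSum B _ ⟩
    sumSubset (card B) (λ p → sumSubset (card (∁ B)) (λ q → sumGraph n s (λ G → f (merge B p q ∷ G))))
      ≈⟨ Σ₁.S-cong (λ p → Σ₂.S-cong (λ q → sumGraph-zipWith-merge n B _)) ⟩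
    sumSubset (card B) (λ p → sumSubset (card (∁ B)) (λ q → sumGraph n (card B) (λ P → sumGraph n (card (∁ B)) (λ Q →
      f (merge B p q ∷ zipWith (merge B) P Q)))))
      ≈⟨ Σ₁.S-cong (λ p → Σ₂.S-swap (IsSum.isAdditive (sumGraph-isSum n (card B))) _) ⟩
    sumGraph (suc n) (card B) (λ P → sumGraph (suc n) (card (∁ B)) (λ Q → f (zipWith (merge B) P Q))) ∎
    where
    module Σ₁ = IsSum (sumSubset-isSum (card B))
    module Σ₂ = IsSum (sumSubset-isSum (card (∁ B)))

  ind : ∀ {P : Set} → Dec P → Carrier
  ind (yes _) = 1#
  ind (no _)  = 0#

  ind-yes : ∀ {P : Set} (P? : Dec P) → P → ind P? ≈ 1#
  ind-yes (yes _) p = refl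
  ind-yes (no ¬p) p = contradiction p ¬p

  ind-no : ∀ {P : Set} (P? : Dec P) → ¬ P → ind P? ≈ 0#
  ind-no (yes p) ¬p = contradiction p ¬p
  ind-no (no _)  ¬p = refl

  ind-× : ∀ {P Q : Set} (P? : Dec P) (Q? : Dec Q) → ind (P? ×-dec Q?) ≈ ind P? * ind Q?
  ind-× (yes _) (yes _) = sym (*-identityˡ _)
  ind-× (yes _) (no _)  = sym (*-identityˡ _)
  ind-× (no _)  Q?      = sym (zeroˡ _)

-- Splitting off the component of a root

module Decomposition (K : Ring₀) (u : CommutativeRing.Carrier K) where
  open CommutativeRing K
  open Sums K public
  open SetoidReasoning setoid
  open Exp commutativeSemiring using (_^_; ^-homo-*)
  private module S = NatSolver commutativeSemiring
  open S using (_:+_; _:*_; _:=_)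

  weight : ∀ {r s} → BipartiteGraph r s → Carrier
  weight G = u ^ edges G

  graphs : ℕ → ℕ → Carrier
  graphs r s = sumGraph r s weight

  connectedGraphs : ℕ → ℕ → Carrier
  connectedGraphs r s = sumGraph r s (λ G → ind (connected? G) * weight G)

  _≟ᴳ_ : ∀ {r s} (G H : BipartiteGraph r s) → Dec (G ≡ H)
  _≟ᴳ_ = ≡-dec (≡-dec _≟ᵇ_)

  isComponent? : ∀ {r s} (G : BipartiteGraph r s) A B → Dec (IsComponent G A B)
  isComponent? G A B = ((block A (∁ B) G ≟ᴳ ∅) ×-dec (block (∁ A) B G ≟ᴳ ∅)) ×-dec connected? (block A B G)

  ind-component : ∀ {r s} (G : BipartiteGraph r s) A B →
    ind (isComponent? G A B) ≈
      ind (block A (∁ B) G ≟ᴳ ∅) * ind (block (∁ A) B G ≟ᴳ ∅) * ind (connected? (block A B G))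
  ind-component G A B = trans
    (ind-× ((block A (∁ B) G ≟ᴳ ∅) ×-dec (block (∁ A) B G ≟ᴳ ∅)) (connected? (block A B G)))
    (*-congʳ (ind-× (block A (∁ B) G ≟ᴳ ∅) (block (∁ A) B G ≟ᴳ ∅)))

  weight-homo : ∀ {r s r′ s′} {r″ s″} (G : BipartiteGraph r s) (H : BipartiteGraph r′ s′) (L : BipartiteGraph r″ s″) →
    edges L ≡ edges G ℕ.+ edges H → weight L ≈ weight G * weight H
  weight-homo G H L p = trans (reflexive (≡.cong (u ^_) p)) (^-homo-* u (edges G) (edges H))

  only-∅ : ∀ r s → sumGraph r s (λ Q → ind (Q ≟ᴳ ∅) * weight Q) ≈ 1#
  only-∅ r s = begin
    sumGraph r s (λ Q → ind (Q ≟ᴳ ∅) * weight Q)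
      ≈⟨ IsSum.S-point (sumGraph-isSum r s) ∅ _ (λ Q Q≢∅ → trans (*-congʳ (ind-no (Q ≟ᴳ ∅) Q≢∅)) (zeroˡ _)) ⟩
    ind (∅ {r} {s} ≟ᴳ ∅) * weight (∅ {r} {s})
      ≈⟨ *-cong (ind-yes (∅ {r} {s} ≟ᴳ ∅) ≡.refl) (reflexive (≡.cong (u ^_) (edges-∅ {r} {s}))) ⟩
    1# * 1# ≈⟨ *-identityˡ _ ⟩
    1# ∎

  -- A and B cut the matrix of a graph into four blocks P, Q, P′, Q′, chosen independently. The
  -- component condition asks that P be connected and that the mixed blocks Q and P′ be empty, while
  -- Q′ is arbitrary; the weight is multiplicative over the blocks.
  withComponent : ∀ {r s} (A : Subset r) (B : Subset s) →
    sumGraph r s (λ G → ind (isComponent? G A B) * weight G) ≈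
      connectedGraphs (card A) (card B) * graphs (card (∁ A)) (card (∁ B))
  withComponent {r} {s} A B = begin
    sumGraph r s f
      ≈⟨ sumVec-merge (sumSubset-isSum s) A f ⟩
    sumGraph (card A) s (λ X → sumGraph (card (∁ A)) s (λ Y → f (merge A X Y)))
      ≈⟨ sumGraph-zipWith-merge (card A) B _ ⟩
    sumGraph (card A) (card B) (λ P → sumGraph (card A) (card (∁ B)) (λ Q → sumGraph (card (∁ A)) s (λ Y →
      f (merge A (zipWith (merge B) P Q) Y))))
      ≈⟨ Σ₁.S-cong (λ P → Σ₂.S-cong (λ Q → sumGraph-zipWith-merge (card (∁ A)) B _)) ⟩
    sumGraph (card A) (card B) (λ P → sumGraph (card A) (card (∁ B)) (λ Q → sumGraph (card (∁ A)) (card B) (λ P′ → sumGraph (card (∁ A)) (card (∁ B)) (λ Q′ →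
      f (glue P Q P′ Q′)))))
      ≈⟨ Σ₁.S-cong (λ P → Σ₂.S-cong (λ Q → Σ₃.S-cong (λ P′ → Σ₄.S-cong (λ Q′ → factor P Q P′ Q′)))) ⟩
    sumGraph (card A) (card B) (λ P → sumGraph (card A) (card (∁ B)) (λ Q → sumGraph (card (∁ A)) (card B) (λ P′ → sumGraph (card (∁ A)) (card (∁ B)) (λ Q′ →
      conn P * (empty Q * (empty P′ * weight Q′))))))
      ≈⟨ Σ₁.S-cong (λ P → Σ₂.S-cong (λ Q → Σ₃.S-cong (λ P′ →
           trans (Σ₄.S-*ˡ _ _) (*-congˡ (trans (Σ₄.S-*ˡ _ _) (*-congˡ (Σ₄.S-*ˡ _ _))))))) ⟩
    sumGraph (card A) (card B) (λ P → sumGraph (card A) (card (∁ B)) (λ Q → sumGraph (card (∁ A)) (card B) (λ P′ →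
      conn P * (empty Q * (empty P′ * graphs (card (∁ A)) (card (∁ B)))))))
      ≈⟨ Σ₁.S-cong (λ P → Σ₂.S-cong (λ Q → trans (Σ₃.S-*ˡ _ _) (*-congˡ (trans (Σ₃.S-*ˡ _ _) (*-congˡ
           (trans (Σ₃.S-*ʳ _ _) (trans (*-congʳ (only-∅ (card (∁ A)) (card B))) (*-identityˡ _)))))))) ⟩
    sumGraph (card A) (card B) (λ P → sumGraph (card A) (card (∁ B)) (λ Q → conn P * (empty Q * graphs (card (∁ A)) (card (∁ B)))))
      ≈⟨ Σ₁.S-cong (λ P → trans (Σ₂.S-*ˡ _ _) (*-congˡ
           (trans (Σ₂.S-*ʳ _ _) (trans (*-congʳ (only-∅ (card A) (card (∁ B)))) (*-identityˡ _))))) ⟩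
    sumGraph (card A) (card B) (λ P → conn P * graphs (card (∁ A)) (card (∁ B)))
      ≈⟨ Σ₁.S-*ʳ _ _ ⟩
    connectedGraphs (card A) (card B) * graphs (card (∁ A)) (card (∁ B)) ∎
    where
    module Σ₁ = IsSum (sumGraph-isSum (card A) (card B))
    module Σ₂ = IsSum (sumGraph-isSum (card A) (card (∁ B)))
    module Σ₃ = IsSum (sumGraph-isSum (card (∁ A)) (card B))
    module Σ₄ = IsSum (sumGraph-isSum (card (∁ A)) (card (∁ B)))
    f : BipartiteGraph r s → Carrier
    f G = ind (isComponent? G A B) * weight G
    conn : ∀ {r s} → BipartiteGraph r s → Carrier
    conn P = ind (connected? P) * weight P
    empty : ∀ {r s} → BipartiteGraph r s → Carrier
    empty Q = ind (Q ≟ᴳ ∅) * weight Q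
    glue : ∀ P Q P′ Q′ → BipartiteGraph r s
    glue P Q P′ Q′ = merge A (zipWith (merge B) P Q) (zipWith (merge B) P′ Q′)
    factor : ∀ P Q P′ Q′ → f (glue P Q P′ Q′) ≈ conn P * (empty Q * (empty P′ * weight Q′))
    factor P Q P′ Q′ = begin
      ind (isComponent? G A B) * weight G
        ≈⟨ *-cong (ind-component G A B) (trans (weight-homo X Y G (edges-merge A X Y))
             (*-cong (weight-homo P Q X (edges-zipWith-merge B P Q)) (weight-homo P′ Q′ Y (edges-zipWith-merge B P′ Q′)))) ⟩
      ind (block A (∁ B) G ≟ᴳ ∅) * ind (block (∁ A) B G ≟ᴳ ∅) * ind (connected? (block A B G))
        * (weight P * weight Q * (weight P′ * weight Q′))
        ≈⟨ *-congʳ (*-cong (*-cong (reflexive (≡.cong (λ H → ind (H ≟ᴳ ∅)) blockQ)) (reflexive (≡.cong (λ H → ind (H ≟ᴳ ∅)) blockP′)))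
             (reflexive (≡.cong (λ H → ind (connected? H)) blockP))) ⟩
      ind (Q ≟ᴳ ∅) * ind (P′ ≟ᴳ ∅) * ind (connected? P) * (weight P * weight Q * (weight P′ * weight Q′))
        ≈⟨ S.solve 7 (λ a b c p q r s → a :* b :* c :* (p :* q :* (r :* s)) := c :* p :* (a :* q :* (b :* r :* s))) refl _ _ _ _ _ _ _ ⟩
      conn P * (empty Q * (empty P′ * weight Q′)) ∎
      where
      G = glue P Q P′ Q′
      X = zipWith (merge B) P Q
      Y = zipWith (merge B) P′ Q′
      blockP : block A B G ≡ P
      blockP = ≡.trans (≡.cong (Vec.map (select B)) (select-merge A X Y)) (select-zipWith-merge B P Q)
      blockQ : block A (∁ B) G ≡ Q
      blockQ = ≡.trans (≡.cong (Vec.map (select (∁ B))) (select-merge A X Y)) (select-∁-zipWith-merge B P Q)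
      blockP′ : block (∁ A) B G ≡ P′
      blockP′ = ≡.trans (≡.cong (Vec.map (select B)) (select-∁-merge A X Y)) (select-zipWith-merge B P′ Q′)

  -- The component of vertex 0 of V₁ exists and is unique; `inside ∷ A` expresses that this vertex
  -- belongs to it.
  one-component : ∀ {r s} (G : BipartiteGraph (suc r) s) →
    sumSubset r (λ A → sumSubset s (λ B → ind (isComponent? G (inside ∷ A) B))) ≈ 1#
  one-component {r} {s} G = inner (reachable₁ G root) (reachable₂ G root)
    (component-exists G root) (In-reachable⁺ G root {root} ε)
    where
    root = inj₁ Fin.zero
    module Σ₁ = IsSum (sumSubset-isSum r)
    module Σ₂ = IsSum (sumSubset-isSum s)
    -- With the reachable sets generalised, membership of the root forces the first entry of A₀ to
    -- be `inside`.
    inner : ∀ A₀ B₀ → IsComponent G A₀ B₀ → In A₀ B₀ root →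
      sumSubset r (λ A → sumSubset s (λ B → ind (isComponent? G (inside ∷ A) B))) ≈ 1#
    inner (inside ∷ A₀) B₀ C here = begin
      sumSubset r (λ A → sumSubset s (λ B → ind (isComponent? G (inside ∷ A) B)))
        ≈⟨ Σ₁.S-point A₀ _ (λ A A≢A₀ → trans
             (Σ₂.S-cong (λ B → ind-no (isComponent? G (inside ∷ A) B)
               (λ C′ → A≢A₀ (≡.cong Vec.tail (proj₁ (component-unique G {inside ∷ A} {inside ∷ A₀} {B} {B₀} {root} C′ C here here))))))
             Σ₂.S-0) ⟩
      sumSubset s (λ B → ind (isComponent? G (inside ∷ A₀) B))
        ≈⟨ Σ₂.S-point B₀ _ (λ B B≢B₀ → ind-no (isComponent? G (inside ∷ A₀) B)
             (λ C′ → B≢B₀ (proj₂ (component-unique G {inside ∷ A₀} {inside ∷ A₀} {B} {B₀} {root} C′ C here here)))) ⟩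
      ind (isComponent? G (inside ∷ A₀) B₀)
        ≈⟨ ind-yes (isComponent? G (inside ∷ A₀) B₀) C ⟩
      1# ∎

  -- The weight of every graph is multiplied by the sum of indicators from `one-component`, which is
  -- 1, and the sums are exchanged.
  rooted : ∀ r s → graphs (suc r) s ≈
    sumSubset r (λ A → sumSubset s (λ B → connectedGraphs (suc (card A)) (card B) * graphs (card (∁ A)) (card (∁ B))))
  rooted r s = begin
    sumGraph (suc r) s weight
      ≈⟨ Σ.S-cong {weight} (λ G → trans (sym (*-identityˡ (weight G))) (*-congʳ (sym (one-component G)))) ⟩
    sumGraph (suc r) s (λ G → sumSubset r (λ A → sumSubset s (λ B → here? G A B)) * weight G)
      ≈⟨ Σ.S-cong (λ G → trans (sym (Σ₁.S-*ʳ (weight G) (λ A → sumSubset s (λ B → here? G A B))))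
           (Σ₁.S-cong (λ A → sym (Σ₂.S-*ʳ (weight G) (λ B → here? G A B))))) ⟩
    sumGraph (suc r) s (λ G → sumSubset r (λ A → sumSubset s (λ B → here? G A B * weight G)))
      ≈⟨ Σ.S-swap Σ₁.isAdditive (λ G A → sumSubset s (λ B → here? G A B * weight G)) ⟩
    sumSubset r (λ A → sumGraph (suc r) s (λ G → sumSubset s (λ B → here? G A B * weight G)))
      ≈⟨ Σ₁.S-cong (λ A → trans (Σ.S-swap Σ₂.isAdditive (λ G B → here? G A B * weight G))
           (Σ₂.S-cong (λ B → withComponent (inside ∷ A) B))) ⟩
    sumSubset r (λ A → sumSubset s (λ B → connectedGraphs (suc (card A)) (card B) * graphs (card (∁ A)) (card (∁ B)))) ∎
    where
    module Σ = IsSum (sumGraph-isSum (suc r) s)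
    module Σ₁ = IsSum (sumSubset-isSum r)
    module Σ₂ = IsSum (sumSubset-isSum s)
    here? : BipartiteGraph (suc r) s → Subset r → Subset s → Carrier
    here? G A B = ind (isComponent? G (inside ∷ A) B)

  sumSubset-weight : ∀ s → sumSubset s (λ p → u ^ (card p)) ≈ (1# + u) ^ s
  sumSubset-weight zero    = refl
  sumSubset-weight (suc s) = begin
    sumSubset s (λ p → u * u ^ (card p)) + sumSubset s (λ p → u ^ (card p))
      ≈⟨ +-congʳ (IsSum.S-*ˡ (sumSubset-isSum s) _ _) ⟩
    u * sumSubset s (λ p → u ^ (card p)) + sumSubset s (λ p → u ^ (card p))
      ≈⟨ S.solve 2 (λ u x → u :* x :+ x := (S.con 1 :+ u) :* x) refl u _ ⟩
    (1# + u) * sumSubset s (λ p → u ^ (card p))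
      ≈⟨ *-congˡ (sumSubset-weight s) ⟩
    (1# + u) ^ suc s ∎

  graphs-power : ∀ r s → graphs r s ≈ ((1# + u) ^ s) ^ r
  graphs-power zero    s = refl
  graphs-power (suc r) s = begin
    sumSubset s (λ x → sumGraph r s (λ G → u ^ ((card x) ℕ.+ edges G)))
      ≈⟨ Σ₂.S-cong (λ x → trans (Σ.S-cong (λ G → ^-homo-* u (card x) (edges G))) (Σ.S-*ˡ _ _)) ⟩
    sumSubset s (λ x → u ^ (card x) * graphs r s)
      ≈⟨ Σ₂.S-*ʳ _ _ ⟩
    sumSubset s (λ x → u ^ (card x)) * graphs r s
      ≈⟨ *-cong (sumSubset-weight s) (graphs-power r s) ⟩
    ((1# + u) ^ s) ^ suc r ∎
    where
    module Σ = IsSum (sumGraph-isSum r s)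
    module Σ₂ = IsSum (sumSubset-isSum s)

-- Exponential generating functions

module EGF (R : Ring₀) where
  open CommutativeRing R
  open Convolution R
  open Euler R
  open Sums R
  open SetoidReasoning setoid
  open SemiringMult semiring using (_×_; ×-congʳ; ×-congˡ; ×-assocˡ)
  open CMult +-commutativeMonoid using (×-distrib-+)
  open Notions.IsDerivation euler-isDerivation using (d-*)

  ∂ : (ℕ → Carrier) → ℕ → Carrier
  ∂ f = tail (euler f)

  ∂-⊛ : ∀ f g n → suc n × (f ⊛ g) (suc n) ≈ (∂ f ⊛ g) n + (f ⊛ ∂ g) n
  ∂-⊛ f g n = begin
    suc n × (f ⊛ g) (suc n) ≈⟨ d-* f g (suc n) ⟩
    (euler f ⊛ g) (suc n) + (f ⊛ euler g) (suc n)
      ≈⟨ +-cong (trans (+-congʳ (zeroˡ _)) (+-identityˡ _))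
                (trans (⊛-step f (euler g) n) (trans (+-congʳ (zeroʳ _)) (+-identityˡ _))) ⟩
    (∂ f ⊛ g) n + (f ⊛ ∂ g) n ∎

  -- Multiplying by n! avoids division, so the notion applies over every commutative ring, in
  -- particular over series in another variable.
  Egf : (f F : ℕ → Carrier) → Set
  Egf f F = ∀ n → (n !) × F n ≈ f n

  factorial-step : ∀ n x → (suc n !) × x ≈ (n !) × (suc n × x)
  factorial-step n x = trans (×-congˡ (ℕP.*-comm (suc n) (n !))) (sym (×-assocˡ x (n !) (suc n)))

  Egf-∂ : ∀ {f F} → Egf f F → Egf (tail f) (∂ F)
  Egf-∂ {f} {F} p n = trans (sym (factorial-step n (F (suc n)))) (p (suc n))

  -- The Leibniz rule for `∂` matches the recursion over subsets: the first element lies either in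
  -- A, which shifts f, or in the complement, which shifts g.
  Egf-⊛ : ∀ {f F g G} → Egf f F → Egf g G →
    Egf (λ n → sumSubset n (λ A → f (card A) * g (card (∁ A)))) (F ⊛ G)
  Egf-⊛ {f} {F} {g} {G} p q zero    = trans (+-identityʳ _)
    (*-cong (trans (sym (+-identityʳ _)) (p 0)) (trans (sym (+-identityʳ _)) (q 0)))
  Egf-⊛ {f} {F} {g} {G} p q (suc n) = begin
    (suc n !) × (F ⊛ G) (suc n) ≈⟨ factorial-step n _ ⟩
    (n !) × (suc n × (F ⊛ G) (suc n)) ≈⟨ ×-congʳ (n !) (∂-⊛ F G n) ⟩
    (n !) × ((∂ F ⊛ G) n + (F ⊛ ∂ G) n) ≈⟨ ×-distrib-+ _ _ (n !) ⟩
    (n !) × (∂ F ⊛ G) n + (n !) × (F ⊛ ∂ G) n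
      ≈⟨ +-cong (Egf-⊛ {tail f} {∂ F} (Egf-∂ {f} {F} p) q n) (Egf-⊛ {f} {F} {tail g} {∂ G} p (Egf-∂ {g} {G} q) n) ⟩
    sumSubset (suc n) (λ A → f (card A) * g (card (∁ A))) ∎

-- Differential equations for the logarithm C

module Constants (K : Ring₀) where
  private
    module K = CommutativeRing K
    module PK = CommutativeRing (PS K)
  open CommutativeRing (PS (PS K))

  constant₂ : K.Carrier → Carrier
  constant₂ c zero    zero    = c
  constant₂ c zero    (suc _) = K.0#
  constant₂ c (suc _) _       = K.0#

  constant₂-* : ∀ c f r s → (constant₂ c * f) r s K.≈ c K.* f r s
  constant₂-* c f zero    s = row (f 0) s
    where
    row : ∀ g s → (constant₂ c 0 PK.* g) s K.≈ c K.* g s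
    row g zero    = K.refl
    row g (suc s) = K.trans (K.+-congˡ (Convolution.⊛-zeroˡ K (λ _ → K.refl) g s)) (K.+-identityʳ _)
  -- Only row 0 of the constant contributes. Its product with the row `f (suc r)` is the case of
  -- outer index 0, for a family all of whose rows are this one.
  constant₂-* c f (suc r) s = K.trans
    (K.+-cong (constant₂-* c (λ _ → f (suc r)) 0 s) (Convolution.⊛-zeroˡ (PS K) (λ _ _ → K.refl) f r s)) (K.+-identityʳ _)

  constant₂-+ : ∀ a b → constant₂ (a K.+ b) ≈ constant₂ a + constant₂ b
  constant₂-+ a b zero    zero    = K.refl
  constant₂-+ a b zero    (suc s) = K.sym (K.+-identityˡ K.0#)
  constant₂-+ a b (suc r) s       = K.sym (K.+-identityˡ K.0#)

  constant₂-1 : constant₂ K.1# ≈ 1#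
  constant₂-1 zero    zero    = K.refl
  constant₂-1 zero    (suc s) = K.refl
  constant₂-1 (suc r) s       = K.refl

-- The case of interest is K = ℚ[[u]] and d = u d/du.
module Exponential
  (K : Ring₀) (torsionFree : Notions.TorsionFree K)
  (u : CommutativeRing.Carrier K)
  (d : CommutativeRing.Carrier K → CommutativeRing.Carrier K) (d-isDerivation : Notions.IsDerivation K d)
  (du : CommutativeRing._≈_ K (d u) u)
  where
  module K = CommutativeRing K
  module Γ = Decomposition K u
  module PK = CommutativeRing (PS K)
  open CommutativeRing (PS (PS K))
  module KM = SemiringMult K.semiring
  module PM = SemiringMult PK.semiring
  module EK = Euler K
  module EP = Euler (PS K)
  open Convolution using () renaming (_⊛_ to conv)
  open Constants K public

  -- The outer index is the exponent of x, the inner one that of y. `dilate` substitutes (1 + u) y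
  -- for y.
  Dx Dy Du dilate : Carrier → Carrier
  Dx = EP.euler
  Dy = EP.lift EK.euler
  Du = EP.lift (EK.lift d)
  dilate = EP.lift (EK.scale (K._+_ K.1# u))

  private
    module N = Notions (PS (PS K))
    module NP = Notions (PS K)

  Dx-isDerivation : N.IsDerivation Dx
  Dx-isDerivation = EP.euler-isDerivation

  Dy-isDerivation : N.IsDerivation Dy
  Dy-isDerivation = EP.lift-isDerivation EK.euler-isDerivation

  Du-isDerivation : N.IsDerivation Du
  Du-isDerivation = EP.lift-isDerivation (EK.lift-isDerivation d-isDerivation)

  dilate-isEndo : N.IsEndo dilate
  dilate-isEndo = EP.lift-isEndo (EK.scale-isEndo _)

  private
    module Dx = N.IsDerivation Dx-isDerivation
    module Dy = N.IsDerivation Dy-isDerivation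
    module Du = N.IsDerivation Du-isDerivation
    module dilate = N.IsEndo dilate-isEndo

  Dx-apply : ∀ f r s → Dx f r s ≡ r KM.× f r s
  Dx-apply f r s = EK.×-pointwise r (f r) s

  -- `Dx` is repeated addition on each coefficient of x, so it commutes with every additive
  -- operation on these coefficients.
  lift-additive-comm : ∀ {h} → (∀ {f g} → f PK.≈ g → h f PK.≈ h g) → (∀ f g → h (f PK.+ g) PK.≈ h f PK.+ h g) →
    h PK.0# PK.≈ PK.0# → ∀ f → Dx (EP.lift h f) ≈ EP.lift h (Dx f)
  lift-additive-comm {h} h-cong h-+ h-0 f n = go n
    where
    go : ∀ m → m PM.× h (f n) PK.≈ h (m PM.× f n)
    go zero    = PK.sym h-0
    go (suc m) = PK.trans (PK.+-congˡ {h (f n)} (go m)) (PK.sym (h-+ (f n) (m PM.× f n)))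

  DxDy : ∀ f → Dx (Dy f) ≈ Dy (Dx f)
  DxDy = lift-additive-comm E.d-cong E.d-+ E.d-0
    where module E = NP.IsDerivation EK.euler-isDerivation

  DxDu : ∀ f → Dx (Du f) ≈ Du (Dx f)
  DxDu = lift-additive-comm E.d-cong E.d-+ E.d-0
    where module E = NP.IsDerivation (EK.lift-isDerivation d-isDerivation)

  Dx-dilate : ∀ f → Dx (dilate f) ≈ dilate (Dx f)
  Dx-dilate = lift-additive-comm E.h-cong E.h-+ (λ n → K.zeroʳ _)
    where module E = NP.IsEndo (EK.scale-isEndo (K._+_ K.1# u))

  Dy-dilate : ∀ f → Dy (dilate f) ≈ dilate (Dy f)
  Dy-dilate f r = EK.euler-scale _ (f r)

  -- D H = H D L says that D log H = D L.
  _logarithm-under_of_ : Carrier → (Carrier → Carrier) → Carrier → Set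
  L logarithm-under D of H = D H ≈ H * D L

  -- D H and H D L both solve Dx Y = Y Dx L + H D (Dx L), so they agree once they agree at x = 0.
  transfer : ∀ {D H L} → N.IsDerivation D → (∀ f → Dx (D f) ≈ D (Dx f)) →
    L logarithm-under Dx of H → D H 0 PK.≈ (H * D L) 0 → L logarithm-under D of H
  transfer {D} {H} {L} isD comm p at0 =
    EP.euler-unique (EK.PS-torsionFree torsionFree) {D H} {H * D L} {Dx L} {H * D (Dx L)} (λ _ → K.refl) at0
      (begin
        Dx (D H) ≈⟨ comm H ⟩
        D (Dx H) ≈⟨ D.d-cong p ⟩
        D (H * Dx L) ≈⟨ D.d-* H (Dx L) ⟩
        D H * Dx L + H * D (Dx L) ∎)
      (begin
        Dx (H * D L) ≈⟨ Dx.d-* H (D L) ⟩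
        Dx H * D L + H * Dx (D L) ≈⟨ +-cong (*-congʳ {D L} p) (*-congˡ {H} (comm L)) ⟩
        H * Dx L * D L + H * D (Dx L) ≈⟨ +-congʳ {H * D (Dx L)} (trans (*-assoc H (Dx L) (D L))
                                               (trans (*-congˡ {H} (*-comm (Dx L) (D L))) (sym (*-assoc H (D L) (Dx L))))) ⟩
        H * D L * Dx L + H * D (Dx L) ∎)
    where
    open SetoidReasoning setoid
    module D = N.IsDerivation isD

  -- The argument of `transfer` on a single row, with y in the role of x. It supplies the value at x
  -- = 0 that `transfer` asks for when D is `Du`. At y = 0 both sides vanish, as H is 1 and L is 0
  -- there.
  transfer₀ : ∀ {H L : PK.Carrier} → EK.euler H PK.≈ H PK.* EK.euler L → H 0 K.≈ K.1# → L 0 K.≈ K.0# →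
    EK.lift d H PK.≈ H PK.* EK.lift d L
  transfer₀ {H} {L} p H0 L0 =
    EK.euler-unique torsionFree {EK.lift d H} {H PK.* EK.lift d L} {EK.euler L} {H PK.* EK.lift d (EK.euler L)} K.refl
      (K.trans (E.d-cong H0) (K.trans E.d-1 (K.sym (K.trans (K.*-congˡ (K.trans (E.d-cong L0) E.d-0)) (K.zeroʳ _)))))
      (begin
        EK.euler (EK.lift d H) ≈⟨ comm H ⟩
        EK.lift d (EK.euler H) ≈⟨ D.d-cong p ⟩
        EK.lift d (H PK.* EK.euler L) ≈⟨ D.d-* H (EK.euler L) ⟩
        EK.lift d H PK.* EK.euler L PK.+ H PK.* EK.lift d (EK.euler L) ∎)
      (begin
        EK.euler (H PK.* EK.lift d L) ≈⟨ Y.d-* H (EK.lift d L) ⟩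
        EK.euler H PK.* EK.lift d L PK.+ H PK.* EK.euler (EK.lift d L)
          ≈⟨ PK.+-cong (PK.*-congʳ {EK.lift d L} p) (PK.*-congˡ {H} (comm L)) ⟩
        H PK.* EK.euler L PK.* EK.lift d L PK.+ H PK.* EK.lift d (EK.euler L)
          ≈⟨ PK.+-congʳ {H PK.* EK.lift d (EK.euler L)} (PK.trans (PK.*-assoc H (EK.euler L) (EK.lift d L))
               (PK.trans (PK.*-congˡ {H} (PK.*-comm (EK.euler L) (EK.lift d L))) (PK.sym (PK.*-assoc H (EK.lift d L) (EK.euler L))))) ⟩
        H PK.* EK.lift d L PK.* EK.euler L PK.+ H PK.* EK.lift d (EK.euler L) ∎)
    where
    open SetoidReasoning PK.setoid
    module E = Notions.IsDerivation d-isDerivation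
    module D = NP.IsDerivation (EK.lift-isDerivation d-isDerivation)
    module Y = NP.IsDerivation EK.euler-isDerivation
    comm : ∀ f → EK.euler (EK.lift d f) PK.≈ EK.lift d (EK.euler f)
    comm f n = K.sym (E.d-× n (f n))

  X : Carrier
  X zero    = PK.0#
  X (suc n) = Convolution.one (PS K) n

  X-* : ∀ f n → (X * f) (suc n) PK.≈ f n
  X-* f n = PK.trans (PK.+-congʳ {conv (PS K) (tail X) f n} (PK.zeroˡ (f (suc n))))
    (PK.trans (PK.+-identityˡ (conv (PS K) (tail X) f n)) (Convolution.⊛-identityˡ (PS K) f n))

  Dx-X : Dx X ≈ X
  Dx-X zero          = PK.refl {PK.0#}
  Dx-X (suc zero)    = PK.+-identityʳ PK.1#
  Dx-X (suc (suc n)) = EP.×-zeroʳ (suc (suc n))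

  lift-X : ∀ {h} → NP.IsDerivation h → EP.lift h X ≈ 0#
  lift-X D zero          = NP.IsDerivation.d-0 D
  lift-X D (suc zero)    = NP.IsDerivation.d-1 D
  lift-X D (suc (suc n)) = NP.IsDerivation.d-0 D

  U : Carrier
  U = constant₂ u

  v : K.Carrier
  v = K._+_ K.1# u

  V : Carrier
  V = 1# + U

  -- A root in V₁ only reaches r ≥ 1, so the row x = 0 of C is prescribed: it is y, for the single
  -- vertex of V₂.
  module Functions (G C : Carrier)
    (G-egf : ∀ r s → K._≈_ ((r !) KM.× ((s !) KM.× G r s)) (Γ.graphs r s))
    (C-egf : ∀ r s → K._≈_ ((suc r !) KM.× ((s !) KM.× C (suc r) s)) (Γ.connectedGraphs (suc r) s))
    (C₀-0 : K._≈_ (C 0 0) K.0#) (C₀-1 : K._≈_ (C 0 1) K.1#) (C₀-2 : ∀ s → K._≈_ (C 0 (suc (suc s))) K.0#)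
    where

    ×-cancel : ∀ n .{{_ : ℕ.NonZero n}} {x y} → n KM.× x K.≈ n KM.× y → x K.≈ y
    ×-cancel (suc n) = torsionFree n

    !-cancel : ∀ n {x y} → (n !) KM.× x K.≈ (n !) KM.× y → x K.≈ y
    !-cancel n = ×-cancel (n !) {{ℕP._!≢0 n}}

    !!-cancel : ∀ r s {x y} → (r !) KM.× ((s !) KM.× x) K.≈ (r !) KM.× ((s !) KM.× y) → x K.≈ y
    !!-cancel r s p = !-cancel s (!-cancel r p)

    ×-swap : ∀ m n x → m KM.× (n KM.× x) K.≈ n KM.× (m KM.× x)
    ×-swap m n x = K.trans (KM.×-assocˡ x m n) (K.trans (KM.×-congˡ (ℕP.*-comm m n)) (K.sym (KM.×-assocˡ x n m)))

    G₀ : G 0 0 K.≈ K.1#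
    G₀ = K.trans (K.sym (K.trans (K.+-identityʳ _) (K.+-identityʳ _))) (G-egf 0 0)

    G-regular : N.Regular G
    G-regular = EP.PS-regular G (EK.PS-regular (G 0) (λ {x} {y} p →
      K.trans (K.sym (K.trans (K.*-congˡ G₀) (K.*-identityʳ x))) (K.trans p (K.trans (K.*-congˡ G₀) (K.*-identityʳ y)))))

    sum-pointwise : ∀ n (f : Subset n → PK.Carrier) s → Sums.sumSubset (PS K) n f s ≡ Γ.sumSubset n (λ A → f A s)
    sum-pointwise zero    f s = ≡.refl
    sum-pointwise (suc n) f s = ≡.cong₂ K._+_ (sum-pointwise n (f ∘ (inside ∷_)) s) (sum-pointwise n (f ∘ (outside ∷_)) s)

    -- `rooted` is a double sum over subsets, so the product formula for exponential generating
    -- functions is applied twice, inside in y and outside in x.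
    DxC*G : Dx G ≈ Dx C * G
    DxC*G zero    = PK.sym (PK.zeroˡ (G 0))
    DxC*G (suc r) s = !!-cancel r s (begin
      (r !) KM.× ((s !) KM.× Dx G (suc r) s)
        ≡⟨ ≡.cong (λ z → (r !) KM.× ((s !) KM.× z)) (Dx-apply G (suc r) s) ⟩
      (r !) KM.× ((s !) KM.× (suc r KM.× G (suc r) s))
        ≈⟨ K.trans (KM.×-congʳ (r !) (×-swap (s !) (suc r) _)) (K.sym (EGF.factorial-step K r _)) ⟩
      (suc r !) KM.× ((s !) KM.× G (suc r) s)
        ≈⟨ G-egf (suc r) s ⟩
      Γ.graphs (suc r) s
        ≈⟨ Γ.rooted r s ⟩
      Γ.sumSubset r (λ A → Γ.sumSubset s (λ B → Γ.connectedGraphs (suc (card A)) (card B) K.* Γ.graphs (card (∁ A)) (card (∁ B))))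
        ≈⟨ Γ.IsSum.S-cong (Γ.sumSubset-isSum r) (λ A → K.sym (EGF.Egf-⊛ K (C-egf′ (card A)) (G-egf′ (card (∁ A))) s)) ⟩
      Γ.sumSubset r (λ A → (s !) KM.× (∂C! (card A) PK.* G! (card (∁ A))) s)
        ≈⟨ ×-sum (s !) {r} (λ A → (∂C! (card A) PK.* G! (card (∁ A))) s) ⟨
      (s !) KM.× Γ.sumSubset r (λ A → (∂C! (card A) PK.* G! (card (∁ A))) s)
        ≡⟨ ≡.cong ((s !) KM.×_) (sum-pointwise r (λ A → ∂C! (card A) PK.* G! (card (∁ A))) s) ⟨
      (s !) KM.× Sums.sumSubset (PS K) r (λ A → ∂C! (card A) PK.* G! (card (∁ A))) s
        ≈⟨ KM.×-congʳ (s !) (EGF.Egf-⊛ (PS K) {∂C!} {tail (Dx C)} {G!} {G} (λ n → PK.refl {∂C! n}) (λ n → PK.refl {G! n}) r s) ⟨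
      (s !) KM.× ((r !) PM.× conv (PS K) (tail (Dx C)) G r) s
        ≡⟨ ≡.cong ((s !) KM.×_) (EK.×-pointwise (r !) _ s) ⟩
      (s !) KM.× ((r !) KM.× conv (PS K) (tail (Dx C)) G r s)
        ≈⟨ ×-swap (s !) (r !) _ ⟩
      (r !) KM.× ((s !) KM.× conv (PS K) (tail (Dx C)) G r s)
        ≈⟨ KM.×-congʳ (r !) (KM.×-congʳ (s !) (K.trans (K.+-congʳ (PK.zeroˡ (G (suc r)) s)) (K.+-identityˡ _))) ⟨
      (r !) KM.× ((s !) KM.× (Dx C * G) (suc r) s) ∎)
      where
      open SetoidReasoning K.setoid
      ×-sum : ∀ m {n} (f : Subset n → K.Carrier) → m KM.× Γ.sumSubset n f K.≈ Γ.sumSubset n (λ A → m KM.× f A)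
      ×-sum zero {n} f = K.sym (Γ.IsSum.S-0 (Γ.sumSubset-isSum n))
      ×-sum (suc m) {n} f = K.trans (K.+-congˡ (×-sum m f)) (K.sym (Γ.IsSum.S-+ (Γ.sumSubset-isSum n) f _))
      -- The coefficients in x, multiplied by factorials, are themselves exponential generating
      -- functions in y; with this choice the outer `Egf` hypotheses hold by reflexivity.
      ∂C! G! : ℕ → PK.Carrier
      ∂C! n = (n !) PM.× tail (Dx C) n
      G! n = (n !) PM.× G n
      C-egf′ : ∀ a → EGF.Egf K (Γ.connectedGraphs (suc a)) (∂C! a)
      C-egf′ a b = begin
        (b !) KM.× ((a !) PM.× tail (Dx C) a) b ≡⟨ ≡.cong ((b !) KM.×_) (EK.×-pointwise (a !) (tail (Dx C) a) b) ⟩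
        (b !) KM.× ((a !) KM.× Dx C (suc a) b) ≡⟨ ≡.cong (λ z → (b !) KM.× ((a !) KM.× z)) (Dx-apply C (suc a) b) ⟩
        (b !) KM.× ((a !) KM.× (suc a KM.× C (suc a) b)) ≈⟨ KM.×-congʳ (b !) (EGF.factorial-step K a _) ⟨
        (b !) KM.× ((suc a !) KM.× C (suc a) b) ≈⟨ ×-swap (b !) (suc a !) _ ⟩
        (suc a !) KM.× ((b !) KM.× C (suc a) b) ≈⟨ C-egf a b ⟩
        Γ.connectedGraphs (suc a) b ∎
      G-egf′ : ∀ a → EGF.Egf K (Γ.graphs a) (G! a)
      G-egf′ a b = begin
        (b !) KM.× ((a !) PM.× G a) b ≡⟨ ≡.cong ((b !) KM.×_) (EK.×-pointwise (a !) (G a) b) ⟩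
        (b !) KM.× ((a !) KM.× G a b) ≈⟨ ×-swap (b !) (a !) _ ⟩
        (a !) KM.× ((b !) KM.× G a b) ≈⟨ G-egf a b ⟩
        Γ.graphs a b ∎

    module KE = Exp K.commutativeSemiring

    private module dK = Notions.IsDerivation d-isDerivation

    dv : d v K.≈ u
    dv = K.trans (dK.d-+ K.1# u) (K.trans (K.+-cong dK.d-1 du) (K.+-identityˡ u))

    -- a behaves like the power vⁿ under v d/du.
    PowerLike : K.Carrier → ℕ → Set
    PowerLike a n = v K.* d a K.≈ n KM.× (u K.* a)

    PowerLike-1 : PowerLike K.1# 0
    PowerLike-1 = K.trans (K.*-congˡ dK.d-1) (K.zeroʳ v)

    PowerLike-v : PowerLike v 1
    PowerLike-v = K.trans (K.*-congˡ dv) (K.trans (K.*-comm v u) (K.sym (K.+-identityʳ (u K.* v))))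

    PowerLike-* : ∀ {a b n m} → PowerLike a n → PowerLike b m → PowerLike (a K.* b) (n ℕ.+ m)
    PowerLike-* {a} {b} {n} {m} p q = begin
      v K.* d (a K.* b) ≈⟨ K.*-congˡ (dK.d-* a b) ⟩
      v K.* (d a K.* b K.+ a K.* d b) ≈⟨ solve 5 (λ v a b x y → v :* (x :* b :+ a :* y) := (v :* x) :* b :+ (v :* y) :* a) K.refl v a b (d a) (d b) ⟩
      v K.* d a K.* b K.+ v K.* d b K.* a ≈⟨ K.+-cong (K.*-congʳ p) (K.*-congʳ q) ⟩
      (n KM.× (u K.* a)) K.* b K.+ (m KM.× (u K.* b)) K.* a
        ≈⟨ K.+-cong (KM.×-assoc-* n (u K.* a) b) (KM.×-assoc-* m (u K.* b) a) ⟩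
      n KM.× (u K.* a K.* b) K.+ m KM.× (u K.* b K.* a)
        ≈⟨ K.+-cong (KM.×-congʳ n (K.*-assoc u a b)) (KM.×-congʳ m (solve 3 (λ u a b → u :* b :* a := u :* (a :* b)) K.refl u a b)) ⟩
      n KM.× (u K.* (a K.* b)) K.+ m KM.× (u K.* (a K.* b))
        ≈⟨ KM.×-homo-+ (u K.* (a K.* b)) n m ⟨
      (n ℕ.+ m) KM.× (u K.* (a K.* b)) ∎
      where
      open SetoidReasoning K.setoid
      open NatSolver K.commutativeSemiring

    PowerLike-^ : ∀ {a n} m → PowerLike a n → PowerLike (a KE.^ m) (m ℕ.* n)
    PowerLike-^ zero    p = PowerLike-1
    PowerLike-^ {a} {n} (suc m) p = PowerLike-* {a} {a KE.^ m} {n} {m ℕ.* n} p (PowerLike-^ m p)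

    graphs-PowerLike : ∀ r s → PowerLike (Γ.graphs r s) (r ℕ.* s)
    graphs-PowerLike r s = K.trans (K.*-congˡ (dK.d-cong (Γ.graphs-power r s))) (K.trans
      (≡.subst (λ n → PowerLike ((v KE.^ s) KE.^ r) (r ℕ.* n)) (ℕP.*-identityʳ s) (PowerLike-^ r (PowerLike-^ s PowerLike-v)))
      (KM.×-congʳ (r ℕ.* s) (K.*-congˡ (K.sym (Γ.graphs-power r s)))))

    V-* : ∀ f r s → (V * f) r s K.≈ v K.* f r s
    V-* f r s = K.trans (*-congʳ {f} (trans (+-congʳ {U} (sym constant₂-1)) (sym (constant₂-+ K.1# u))) r s)
      (constant₂-* v f r s)

    scaled-cong : ∀ m n {x y} → x K.≈ y → m KM.× (n KM.× x) K.≈ m KM.× (n KM.× y)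
    scaled-cong m n p = KM.×-congʳ m (KM.×-congʳ n p)

    -- Up to factorials the coefficients of G are v^(rs), on which v d acts as multiplication by rs
    -- u, and rs is the eigenvalue of Dx Dy.
    VDuG : V * Du G ≈ U * Dx (Dy G)
    VDuG r s = !!-cancel r s (begin
      N (V * Du G) r s ≈⟨ scaled-cong (r !) (s !) (V-* (Du G) r s) ⟩
      (r !) KM.× ((s !) KM.× (v K.* d (G r s))) ≈⟨ scaled-out v (d (G r s)) ⟩
      v K.* ((r !) KM.× ((s !) KM.× d (G r s))) ≈⟨ K.*-congˡ (K.trans (KM.×-congʳ (r !) (K.sym (dK.d-× (s !) _))) (K.sym (dK.d-× (r !) _))) ⟩
      v K.* d ((r !) KM.× ((s !) KM.× G r s)) ≈⟨ K.*-congˡ (dK.d-cong (G-egf r s)) ⟩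
      v K.* d (Γ.graphs r s) ≈⟨ graphs-PowerLike r s ⟩
      (r ℕ.* s) KM.× (u K.* Γ.graphs r s) ≈⟨ KM.×-congʳ (r ℕ.* s) (K.*-congˡ (G-egf r s)) ⟨
      (r ℕ.* s) KM.× (u K.* ((r !) KM.× ((s !) KM.× G r s))) ≈⟨ KM.×-congʳ (r ℕ.* s) (scaled-out u (G r s)) ⟨
      (r ℕ.* s) KM.× ((r !) KM.× ((s !) KM.× (u K.* G r s))) ≈⟨ K.trans (×-swap (r ℕ.* s) (r !) _) (KM.×-congʳ (r !) (×-swap (r ℕ.* s) (s !) _)) ⟩
      (r !) KM.× ((s !) KM.× ((r ℕ.* s) KM.× (u K.* G r s))) ≈⟨ scaled-cong (r !) (s !) (K.trans (K.sym (KM.×-comm-* (r ℕ.* s) u (G r s))) (K.*-congˡ (K.sym (KM.×-assocˡ (G r s) r s)))) ⟩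
      (r !) KM.× ((s !) KM.× (u K.* (r KM.× (s KM.× G r s)))) ≡⟨ ≡.cong (λ z → (r !) KM.× ((s !) KM.× (u K.* z))) (Dx-apply (Dy G) r s) ⟨
      (r !) KM.× ((s !) KM.× (u K.* Dx (Dy G) r s)) ≈⟨ scaled-cong (r !) (s !) (constant₂-* u (Dx (Dy G)) r s) ⟨
      N (U * Dx (Dy G)) r s ∎)
      where
      open SetoidReasoning K.setoid
      N : Carrier → ℕ → ℕ → K.Carrier
      N f r s = (r !) KM.× ((s !) KM.× f r s)
      scaled-out : ∀ a x → (r !) KM.× ((s !) KM.× (a K.* x)) K.≈ a K.* ((r !) KM.× ((s !) KM.× x))
      scaled-out a x = K.trans (KM.×-congʳ (r !) (K.sym (KM.×-comm-* (s !) a x))) (K.sym (KM.×-comm-* (r !) a _))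

    -- A new vertex of V₁ chooses its neighbours freely, v^((r+1)s) = v^s v^(rs), and the factor v^s
    -- is the effect of `dilate`.
    DxG : Dx G ≈ X * dilate G
    DxG zero    = PK.sym (PK.zeroˡ (dilate G 0))
    DxG (suc r) s = !!-cancel r s (begin
      (r !) KM.× ((s !) KM.× Dx G (suc r) s)
        ≡⟨ ≡.cong (λ z → (r !) KM.× ((s !) KM.× z)) (Dx-apply G (suc r) s) ⟩
      (r !) KM.× ((s !) KM.× (suc r KM.× G (suc r) s))
        ≈⟨ K.trans (KM.×-congʳ (r !) (×-swap (s !) (suc r) _)) (K.sym (EGF.factorial-step K r _)) ⟩
      (suc r !) KM.× ((s !) KM.× G (suc r) s)
        ≈⟨ G-egf (suc r) s ⟩
      Γ.graphs (suc r) s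
        ≈⟨ Γ.graphs-power (suc r) s ⟩
      v KE.^ s K.* (v KE.^ s) KE.^ r
        ≈⟨ K.*-congˡ (Γ.graphs-power r s) ⟨
      v KE.^ s K.* Γ.graphs r s
        ≈⟨ K.*-congˡ (G-egf r s) ⟨
      v KE.^ s K.* ((r !) KM.× ((s !) KM.× G r s))
        ≈⟨ K.trans (KM.×-comm-* (r !) (v KE.^ s) _) (KM.×-congʳ (r !) (KM.×-comm-* (s !) (v KE.^ s) _)) ⟩
      (r !) KM.× ((s !) KM.× dilate G r s)
        ≈⟨ scaled-cong (r !) (s !) (X-* (dilate G) r s) ⟨
      (r !) KM.× ((s !) KM.× (X * dilate G) (suc r) s) ∎)
      where
      open SetoidReasoning K.setoid

    logDx : C logarithm-under Dx of G
    logDx = trans DxC*G (*-comm (Dx C) G)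

    -- At x = 0 there are no edges: G is exp(y) and C is y.
    logDy₀ : EK.euler (G 0) PK.≈ G 0 PK.* EK.euler (C 0)
    logDy₀ s = K.trans (lemma s) (PK.*-comm (EK.euler (C 0)) (G 0) s)
      where
      open SetoidReasoning K.setoid
      e = EK.euler (C 0)
      e-tail : ∀ n → tail e n K.≈ Convolution.one K n
      e-tail zero    = K.trans (K.+-identityʳ _) C₀-1
      e-tail (suc n) = K.trans (KM.×-congʳ (suc (suc n)) (C₀-2 n)) (EK.×-zeroʳ (suc (suc n)))
      G₀-egf : ∀ n → (n !) KM.× G 0 n K.≈ K.1#
      G₀-egf n = K.trans (K.sym (K.+-identityʳ _)) (K.trans (G-egf 0 n) (Γ.graphs-power 0 n))
      lemma : EK.euler (G 0) PK.≈ e PK.* G 0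
      lemma zero    = K.sym (K.zeroˡ _)
      lemma (suc n) = !-cancel n (begin
        (n !) KM.× (suc n KM.× G 0 (suc n)) ≈⟨ EGF.factorial-step K n _ ⟨
        (suc n !) KM.× G 0 (suc n) ≈⟨ G₀-egf (suc n) ⟩
        K.1# ≈⟨ G₀-egf n ⟨
        (n !) KM.× G 0 n ≈⟨ KM.×-congʳ (n !) (Convolution.⊛-identityˡ K (G 0) n) ⟨
        (n !) KM.× conv K (Convolution.one K) (G 0) n
          ≈⟨ KM.×-congʳ (n !) (Convolution.⊛-cong K e-tail (λ _ → K.refl) n) ⟨
        (n !) KM.× conv K (tail e) (G 0) n
          ≈⟨ KM.×-congʳ (n !) (K.trans (K.+-congʳ (K.zeroˡ _)) (K.+-identityˡ _)) ⟨
        (n !) KM.× (e PK.* G 0) (suc n) ∎)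

    logDy : C logarithm-under Dy of G
    logDy = transfer Dy-isDerivation DxDy logDx logDy₀

    logDu : C logarithm-under Du of G
    logDu = transfer Du-isDerivation DxDu logDx (transfer₀ logDy₀ G₀ C₀-0)

    private
      G′ C′ : Carrier
      G′ = dilate G
      C′ = dilate C

    logDx′ : C′ logarithm-under Dx of G′
    logDx′ = trans (Dx-dilate G) (trans (dilate.h-cong logDx) (trans (dilate.h-* G (Dx C))
      (*-congˡ {G′} (sym (Dx-dilate C)))))

    logDy′ : C′ logarithm-under Dy of G′
    logDy′ = trans (Dy-dilate G) (trans (dilate.h-cong logDy) (trans (dilate.h-* G (Dy C))
      (*-congˡ {G′} (sym (Dy-dilate C)))))

    -- `dilate` involves u and does not commute with `Du`, so `logDu` cannot be transported like the
    -- equations for Dx and Dy; `transfer` is applied to the dilated series instead.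
    logDu′ : C′ logarithm-under Du of G′
    logDu′ = transfer Du-isDerivation DxDu logDx′ (transfer₀ (logDy′ 0)
      (K.trans (K.*-identityˡ _) G₀) (K.trans (K.*-identityˡ _) C₀-0))

    -- `VDuG` divided by G, where Dx Dy G turns into Dx Dy C + Dx C · Dy C.
    edge-equation : V * Du C ≈ U * (Dx (Dy C) + Dx C * Dy C)
    edge-equation = G-regular (begin
      V * Du C * G ≈⟨ solve 3 (λ v c g → v :* c :* g := v :* (g :* c)) refl V (Du C) G ⟩
      V * (G * Du C) ≈⟨ *-congˡ {V} logDu ⟨
      V * Du G ≈⟨ VDuG ⟩
      U * Dx (Dy G) ≈⟨ *-congˡ {U} (Dx.d-cong logDy) ⟩
      U * Dx (G * Dy C) ≈⟨ *-congˡ {U} (Dx.d-* G (Dy C)) ⟩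
      U * (Dx G * Dy C + G * Dx (Dy C)) ≈⟨ *-congˡ {U} (+-congʳ {G * Dx (Dy C)} (*-congʳ {Dy C} logDx)) ⟩
      U * (G * Dx C * Dy C + G * Dx (Dy C))
        ≈⟨ solve 5 (λ u g x y z → u :* (g :* x :* y :+ g :* z) := u :* (z :+ x :* y) :* g) refl U G (Dx C) (Dy C) (Dx (Dy C)) ⟩
      U * (Dx (Dy C) + Dx C * Dy C) * G ∎)
      where
      open SetoidReasoning setoid
      open NatSolver commutativeSemiring

    -- Dx C = X G′/G, differentiated logarithmically.
    root-equation : ∀ {D κ} → N.IsDerivation D → C logarithm-under D of G → C′ logarithm-under D of G′ → D X ≈ κ * X →
      D (Dx C) + Dx C * D C ≈ κ * Dx C + Dx C * D C′
    root-equation {D} {κ} isD log log′ DX = G-regular (begin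
      (D Y + Y * D C) * G ≈⟨ solve 4 (λ a y c g → (a :+ y :* c) :* g := a :* g :+ y :* (g :* c)) refl (D Y) Y (D C) G ⟩
      D Y * G + Y * (G * D C) ≈⟨ +-congˡ {D Y * G} (*-congˡ {Y} log) ⟨
      D Y * G + Y * D G ≈⟨ D.d-* Y G ⟨
      D (Y * G) ≈⟨ D.d-cong YG ⟩
      D (X * G′) ≈⟨ D.d-* X G′ ⟩
      D X * G′ + X * D G′ ≈⟨ +-cong (*-congʳ {G′} DX) (*-congˡ {X} log′) ⟩
      κ * X * G′ + X * (G′ * D C′) ≈⟨ solve 4 (λ e x g c → e :* x :* g :+ x :* (g :* c) := e :* (x :* g) :+ (x :* g) :* c) refl κ X G′ (D C′) ⟩
      κ * (X * G′) + X * G′ * D C′ ≈⟨ +-cong (*-congˡ {κ} YG) (*-congʳ {D C′} YG) ⟨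
      κ * (Y * G) + Y * G * D C′ ≈⟨ solve 4 (λ e y g c → e :* (y :* g) :+ y :* g :* c := (e :* y :+ y :* c) :* g) refl κ Y G (D C′) ⟩
      (κ * Y + Y * D C′) * G ∎)
      where
      open SetoidReasoning setoid
      open NatSolver commutativeSemiring
      module D = N.IsDerivation isD
      Y = Dx C
      YG : Y * G ≈ X * G′
      YG = trans (sym DxC*G) DxG

    Dx-equation : Dx (Dx C) + Dx C * Dx C ≈ Dx C + Dx C * Dx C′
    Dx-equation = trans (root-equation {Dx} {1#} Dx-isDerivation logDx logDx′ (trans Dx-X (sym (*-identityˡ X))))
      (+-congʳ {Dx C * Dx C′} (*-identityˡ (Dx C)))

    private
      vanish : ∀ f → f ≈ 0# → f ≈ 0# * X
      vanish f p = trans {f} p (sym (zeroˡ X))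
      vanish′ : ∀ f → 0# * Dx C + f ≈ f
      vanish′ f = trans (+-congʳ {f} (zeroˡ (Dx C))) (+-identityˡ f)

    Dy-equation : Dy (Dx C) + Dx C * Dy C ≈ Dx C * Dy C′
    Dy-equation = trans (root-equation {Dy} {0#} Dy-isDerivation logDy logDy′ (vanish (Dy X) (lift-X EK.euler-isDerivation)))
      (vanish′ (Dx C * Dy C′))

    Du-equation : Du (Dx C) + Dx C * Du C ≈ Dx C * Du C′
    Du-equation = trans (root-equation {Du} {0#} Du-isDerivation logDu logDu′ (vanish (Du X) (lift-X (EK.lift-isDerivation d-isDerivation))))
      (vanish′ (Dx C * Du C′))

    open Swap K using (swap; swap-*)

    -- G is symmetric, being built from v^(rs). Exchanging the variables in Dy C = Dy G / G
    -- therefore shows that C and its mirror image have the same Dx, which settles r ≥ 1; the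
    -- remaining row then follows from the column y = 0.
    C-symmetric : ∀ r s → C r s K.≈ C s r
    C-symmetric zero    zero    = K.refl
    C-symmetric (suc r) s       = K.sym (swapped r s)
      where
      open SetoidReasoning setoid
      swap-Dx : ∀ f → Dx (swap f) ≈ swap (Dy f)
      swap-Dx f r s = K.reflexive (Dx-apply (swap f) r s)
      G-symmetric : swap G ≈ G
      G-symmetric r s = !!-cancel r s (K.trans (K.trans (×-swap (r !) (s !) _) (G-egf s r))
        (K.trans (K.trans (Γ.graphs-power s r) (K.trans (exchange r s) (K.sym (Γ.graphs-power r s)))) (K.sym (G-egf r s))))
        where
        exchange : ∀ r s → (v KE.^ r) KE.^ s K.≈ (v KE.^ s) KE.^ r
        exchange r s = K.trans (KE.^-assocʳ v r s) (K.trans (K.reflexive (≡.cong (v KE.^_) (ℕP.*-comm r s))) (K.sym (KE.^-assocʳ v s r)))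
      Dx-swapped : Dx (swap C) ≈ Dx C
      Dx-swapped = G-regular (begin
        Dx (swap C) * G ≈⟨ *-cong (swap-Dx C) (sym G-symmetric) ⟩
        swap (Dy C) * swap G ≈⟨ swap-* (Dy C) G ⟨
        swap (Dy C * G) ≈⟨ (λ m n → trans (*-comm (Dy C) G) (sym logDy) n m) ⟩
        swap (Dy G) ≈⟨ swap-Dx G ⟨
        Dx (swap G) ≈⟨ Dx.d-cong G-symmetric ⟩
        Dx G ≈⟨ DxC*G ⟩
        Dx C * G ∎)
      swapped : ∀ r s → C s (suc r) K.≈ C (suc r) s
      swapped r s = torsionFree r (K.trans (K.reflexive (≡.sym (Dx-apply (swap C) (suc r) s)))
        (K.trans (Dx-swapped (suc r) s) (K.reflexive (Dx-apply C (suc r) s))))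
    C-symmetric zero    (suc s) = K.sym (C-symmetric (suc s) 0)

-- Passing from edge numbers to Betti numbers

module Rescaling
  (K : Ring₀) (torsionFree : Notions.TorsionFree K)
  (u : CommutativeRing.Carrier K) (u-regular : Notions.Regular K u)
  (d : CommutativeRing.Carrier K → CommutativeRing.Carrier K) (d-isDerivation : Notions.IsDerivation K d)
  (du : CommutativeRing._≈_ K (d u) u)
  where
  open Exponential K torsionFree u d d-isDerivation du
  open CommutativeRing (PS (PS K)) hiding (zero)
  open Exp K.commutativeSemiring using (_^_)
  open Swap K using (swap; swap-isEndo)
  open GroupProperties +-group using (∙-cancelʳ)
  private
    module N = Notions (PS (PS K))
    module NP = Notions (PS K)
    module dK = Notions.IsDerivation d-isDerivation
    module SK = NatSolver K.commutativeSemiring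

  -- f(ux, uy)
  rescale : Carrier → Carrier
  rescale f r s = u ^ r K.* (u ^ s K.* f r s)

  rescale-isEndo : N.IsEndo rescale
  rescale-isEndo = record
    { h-cong = λ p r s → K.*-congˡ (K.*-congˡ (p r s))
    ; h-+    = λ f g r s → K.trans (K.*-congˡ (K.distribˡ _ _ _)) (K.distribˡ _ _ _)
    -- `rescale` is scaling in y, exchange, scaling in y and exchange back, each of which is
    -- multiplicative.
    ; h-*    = λ f g r s → K.trans (L.h-cong (Sw.h-cong (L.h-* f g)) s r)
                 (K.trans (L.h-cong (Sw.h-* (lifted f) (lifted g)) s r)
                 (K.trans (L.h-* (swap (lifted f)) (swap (lifted g)) s r)
                 (Sw.h-* (lifted (swap (lifted f))) (lifted (swap (lifted g))) r s)))
    }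
    where
    lifted : Carrier → Carrier
    lifted = EP.lift (EK.scale u)
    module L = N.IsEndo (EP.lift-isEndo (EK.scale-isEndo u))
    module Sw = N.IsEndo swap-isEndo

  open N.IsEndo rescale-isEndo using () renaming (h-cong to rescale-cong; h-+ to rescale-+; h-* to rescale-*)

  u-cancel : ∀ {x y} → u K.* x K.≈ u K.* y → x K.≈ y
  u-cancel p = u-regular (K.trans (K.*-comm _ _) (K.trans p (K.*-comm _ _)))

  u^-cancel : ∀ n {x y} → u ^ n K.* x K.≈ u ^ n K.* y → x K.≈ y
  u^-cancel zero    p = K.trans (K.sym (K.*-identityˡ _)) (K.trans p (K.*-identityˡ _))
  u^-cancel (suc n) p = u^-cancel n (u-cancel (K.trans (K.sym (K.*-assoc u _ _)) (K.trans p (K.*-assoc u _ _))))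

  rescale-injective : ∀ {f g} → rescale f ≈ rescale g → f ≈ g
  rescale-injective p r s = u^-cancel s (u^-cancel r (p r s))

  U-apply : ∀ f r s → (U * f) r s K.≈ u K.* f r s
  U-apply = constant₂-* u

  U-cancel : ∀ {f g} → U * f ≈ U * g → f ≈ g
  U-cancel {f} {g} p r s = u-cancel (K.trans (K.sym (U-apply f r s)) (K.trans (p r s) (U-apply g r s)))

  U-rescale : ∀ f → U * rescale f ≈ rescale (U * f)
  U-rescale f r s = K.trans (U-apply (rescale f) r s) (K.trans
    (SK.solve 4 (λ u a b x → u :* (a :* (b :* x)) := a :* (b :* (u :* x))) K.refl u (u ^ r) (u ^ s) (f r s))
    (K.*-congˡ (K.*-congˡ (K.sym (U-apply f r s)))))
    where open SK using (_:*_; _:=_)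

  V-rescale : ∀ f → V * rescale f ≈ rescale (V * f)
  V-rescale f = begin
    (1# + U) * rescale f ≈⟨ distribʳ (rescale f) 1# U ⟩
    1# * rescale f + U * rescale f ≈⟨ +-cong (*-identityˡ (rescale f)) (U-rescale f) ⟩
    rescale f + rescale (U * f) ≈⟨ rescale-+ f (U * f) ⟨
    rescale (f + U * f) ≈⟨ rescale-cong (+-congʳ {U * f} (*-identityˡ f)) ⟨
    rescale (1# * f + U * f) ≈⟨ rescale-cong (distribʳ f 1# U) ⟨
    rescale (V * f) ∎
    where open SetoidReasoning setoid

  Dx-rescale : ∀ f → Dx (rescale f) ≈ rescale (Dx f)
  Dx-rescale f r s = K.trans (K.reflexive (Dx-apply (rescale f) r s)) (K.trans
    (K.sym (KM.×-comm-* r (u ^ r) _)) (K.*-congˡ (K.trans (K.sym (KM.×-comm-* r (u ^ s) (f r s)))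
      (K.*-congˡ (K.reflexive (≡.sym (Dx-apply f r s)))))))

  Dy-rescale : ∀ f → Dy (rescale f) ≈ rescale (Dy f)
  Dy-rescale f r s = K.trans (K.sym (KM.×-comm-* s (u ^ r) _)) (K.*-congˡ (K.sym (KM.×-comm-* s (u ^ s) (f r s))))

  Du-rescale : ∀ f → Du (rescale f) ≈ rescale (Du f + Dx f + Dy f)
  Du-rescale f r s = begin
    d (u ^ r K.* (u ^ s K.* z))
      ≈⟨ EK.derivation-scale d-isDerivation du (λ _ → u ^ s K.* z) r ⟩
    u ^ r K.* (d (u ^ s K.* z) K.+ r KM.× (u ^ s K.* z))
      ≈⟨ K.*-congˡ (K.+-cong (EK.derivation-scale d-isDerivation du (λ _ → z) s) (K.sym (KM.×-comm-* r (u ^ s) z))) ⟩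
    u ^ r K.* (u ^ s K.* (d z K.+ s KM.× z) K.+ u ^ s K.* (r KM.× z))
      ≈⟨ K.*-congˡ (SK.solve 4 (λ a x y z → a :* (x :+ y) :+ a :* z := a :* (x :+ z :+ y)) K.refl (u ^ s) (d z) (s KM.× z) (r KM.× z)) ⟩
    u ^ r K.* (u ^ s K.* (d z K.+ r KM.× z K.+ s KM.× z))
      ≡⟨ ≡.cong (λ y → u ^ r K.* (u ^ s K.* (d z K.+ y K.+ s KM.× z))) (Dx-apply f r s) ⟨
    rescale (Du f + Dx f + Dy f) r s ∎
    where
    open SetoidReasoning K.setoid
    open SK using (_:+_; _:*_; _:=_)
    z = f r s

  dilate-rescale : ∀ f → dilate (rescale f) ≈ rescale (dilate f)
  dilate-rescale f r s = SK.solve 4 (λ v a b x → v :* (a :* (b :* x)) := a :* (b :* (v :* x))) K.refl (v ^ s) (u ^ r) (u ^ s) (f r s)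
    where open SK using (_:*_; _:=_)

  dilate-U : ∀ f → dilate (U * f) ≈ U * dilate f
  dilate-U f r s = K.trans (K.*-congˡ (U-apply f r s)) (K.trans
    (SK.solve 3 (λ v u x → v :* (u :* x) := u :* (v :* x)) K.refl (v ^ s) u (f r s))
    (K.sym (U-apply (dilate f) r s)))
    where open SK using (_:*_; _:=_)

  Dx-U : ∀ f → Dx (U * f) ≈ U * Dx f
  Dx-U f r s = K.trans (K.reflexive (Dx-apply (U * f) r s)) (K.trans (KM.×-congʳ r (U-apply f r s)) (K.trans
    (K.sym (KM.×-comm-* r u (f r s))) (K.trans (K.*-congˡ (K.reflexive (≡.sym (Dx-apply f r s)))) (K.sym (U-apply (Dx f) r s)))))

  Dy-U : ∀ f → Dy (U * f) ≈ U * Dy f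
  Dy-U f r s = K.trans (KM.×-congʳ s (U-apply f r s)) (K.trans
    (K.sym (KM.×-comm-* s u (f r s))) (K.sym (U-apply (Dy f) r s)))

  Du-U : ∀ f → Du (U * f) ≈ U * f + U * Du f
  Du-U f r s = K.trans (dK.d-cong (U-apply f r s)) (K.trans (dK.d-* u (f r s))
    (K.+-cong (K.trans (K.*-congʳ du) (K.sym (U-apply f r s))) (K.sym (U-apply (Du f) r s))))

  -- The polynomial ((1 + u)^s - 1)/u, with coefficient binom(s, i + 1) at u^i, written as a sum of
  -- powers to avoid the division.
  gap : ℕ → K.Carrier
  gap zero    = K.0#
  gap (suc s) = v ^ s K.+ gap s

  v^-gap : ∀ s → v ^ s K.≈ K.1# K.+ u K.* gap s
  v^-gap zero    = K.sym (K.trans (K.+-congˡ (K.zeroʳ u)) (K.+-identityʳ K.1#))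
  v^-gap (suc s) = K.trans
    (SK.solve 2 (λ u p → (SK.con 1 :+ u) :* p := p :+ u :* p) K.refl u (v ^ s))
    (K.trans (K.+-congʳ (v^-gap s))
      (SK.solve 3 (λ u w p → SK.con 1 :+ u :* w :+ u :* p := SK.con 1 :+ u :* (p :+ w)) K.refl u (gap s) (v ^ s)))
    where open SK using (_:+_; _:*_; _:=_)

  -- Ĉ is to be the sum of the u^k Fₖ, since e edges and Betti number k are related by e + 1 = r + s
  -- + k. The factor U clears the exponent -1 of u that the trees would contribute.
  module Rescaled (C Ĉ : Carrier)
    (UC : U * C ≈ rescale Ĉ)
    (edge-equation : V * Du C ≈ U * (Dx (Dy C) + Dx C * Dy C))
    (Dx-equation : Dx (Dx C) + Dx C * Dx C ≈ Dx C + Dx C * Dx (dilate C))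
    (Dy-equation : Dy (Dx C) + Dx C * Dy C ≈ Dx C * Dy (dilate C))
    (Du-equation : Du (Dx C) + Dx C * Du C ≈ Dx C * Du (dilate C))
    where
    private
      module Dx = N.IsDerivation Dx-isDerivation
      module Dy = N.IsDerivation Dy-isDerivation
      module Du = N.IsDerivation Du-isDerivation
      module dil = N.IsEndo dilate-isEndo
      module S = NatSolver commutativeSemiring
    open S using (_:+_; _:*_; _:=_)
    open SetoidReasoning setoid

    X̂ Y Ŝ : Carrier
    X̂ = Dx Ĉ
    Y = Dx C
    Ŝ r s = gap s K.* Ĉ r s

    dilate-Ĉ : dilate Ĉ ≈ Ĉ + U * Ŝ
    dilate-Ĉ r s = K.trans (K.*-congʳ (v^-gap s)) (K.trans
      (SK.solve 3 (λ u w c → (SK.con 1 SK.:+ u SK.:* w) SK.:* c SK.:= c SK.:+ u SK.:* (w SK.:* c)) K.refl u (gap s) (Ĉ r s))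
      (K.+-congˡ (K.sym (U-apply Ŝ r s))))

    dilate-C : dilate C ≈ C + rescale Ŝ
    dilate-C = U-cancel (begin
      U * dilate C ≈⟨ dilate-U C ⟨
      dilate (U * C) ≈⟨ dil.h-cong UC ⟩
      dilate (rescale Ĉ) ≈⟨ dilate-rescale Ĉ ⟩
      rescale (dilate Ĉ) ≈⟨ rescale-cong dilate-Ĉ ⟩
      rescale (Ĉ + U * Ŝ) ≈⟨ rescale-+ Ĉ (U * Ŝ) ⟩
      rescale Ĉ + rescale (U * Ŝ) ≈⟨ +-cong UC (U-rescale Ŝ) ⟨
      U * C + U * rescale Ŝ ≈⟨ distribˡ U C (rescale Ŝ) ⟨
      U * (C + rescale Ŝ) ∎)

    hat-edge-equation : V * (Du Ĉ + Dx Ĉ + Dy Ĉ) ≈ V * Ĉ + (U * Dx (Dy Ĉ) + Dx Ĉ * Dy Ĉ)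
    hat-edge-equation = rescale-injective (begin
      rescale (V * (Du Ĉ + Dx Ĉ + Dy Ĉ)) ≈⟨ V-rescale (Du Ĉ + Dx Ĉ + Dy Ĉ) ⟨
      V * rescale (Du Ĉ + Dx Ĉ + Dy Ĉ) ≈⟨ *-congˡ {V} (Du-rescale Ĉ) ⟨
      V * Du (rescale Ĉ) ≈⟨ *-congˡ {V} (Du.d-cong UC) ⟨
      V * Du (U * C) ≈⟨ *-congˡ {V} (Du-U C) ⟩
      V * (U * C + U * Du C) ≈⟨ S.solve 4 (λ v u c e → v :* (u :* c :+ u :* e) := v :* (u :* c) :+ u :* (v :* e)) refl V U C (Du C) ⟩
      V * (U * C) + U * (V * Du C) ≈⟨ +-congˡ {V * (U * C)} (*-congˡ {U} edge-equation) ⟩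
      V * (U * C) + U * (U * (Dx (Dy C) + Dx C * Dy C))
        -- One U stems from U * C and one from the edge equation; the quadratic term uses one for
        -- each of its factors.
        ≈⟨ S.solve 6 (λ v u c e x y → v :* (u :* c) :+ u :* (u :* (e :+ x :* y)) := v :* (u :* c) :+ (u :* (u :* e) :+ (u :* x) :* (u :* y))) refl V U C (Dx (Dy C)) (Dx C) (Dy C) ⟩
      V * (U * C) + (U * (U * Dx (Dy C)) + (U * Dx C) * (U * Dy C))
        ≈⟨ +-cong (*-congˡ {V} UC) (+-cong (*-congˡ {U} UDxDy) (*-cong UDx UDy)) ⟩
      V * rescale Ĉ + (U * rescale (Dx (Dy Ĉ)) + rescale (Dx Ĉ) * rescale (Dy Ĉ))
        ≈⟨ +-cong (V-rescale Ĉ) (+-cong (U-rescale (Dx (Dy Ĉ))) (sym (rescale-* (Dx Ĉ) (Dy Ĉ)))) ⟩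
      rescale (V * Ĉ) + (rescale (U * Dx (Dy Ĉ)) + rescale (Dx Ĉ * Dy Ĉ))
        ≈⟨ +-congˡ {rescale (V * Ĉ)} (rescale-+ (U * Dx (Dy Ĉ)) (Dx Ĉ * Dy Ĉ)) ⟨
      rescale (V * Ĉ) + rescale (U * Dx (Dy Ĉ) + Dx Ĉ * Dy Ĉ)
        ≈⟨ rescale-+ (V * Ĉ) (U * Dx (Dy Ĉ) + Dx Ĉ * Dy Ĉ) ⟨
      rescale (V * Ĉ + (U * Dx (Dy Ĉ) + Dx Ĉ * Dy Ĉ)) ∎)
      where
      UDy : U * Dy C ≈ rescale (Dy Ĉ)
      UDy = trans (sym (Dy-U C)) (trans (Dy.d-cong UC) (Dy-rescale Ĉ))
      UDx : U * Dx C ≈ rescale (Dx Ĉ)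
      UDx = trans (sym (Dx-U C)) (trans (Dx.d-cong UC) (Dx-rescale Ĉ))
      UDxDy : U * Dx (Dy C) ≈ rescale (Dx (Dy Ĉ))
      UDxDy = trans (sym (Dx-U (Dy C))) (trans (Dx.d-cong UDy) (Dx-rescale (Dy Ĉ)))

    UY : U * Y ≈ rescale X̂
    UY = trans (sym (Dx-U C)) (trans (Dx.d-cong UC) (Dx-rescale Ĉ))

    -- `dilate C` is C + `rescale Ŝ`, so Y * D C occurs on both sides and cancels.
    difference : ∀ {D e} → N.IsDerivation D → D Y + Y * D C ≈ e + Y * D (dilate C) → D Y ≈ e + Y * D (rescale Ŝ)
    difference {D} {e} isD p = ∙-cancelʳ (Y * D C) (D Y) (e + Y * D (rescale Ŝ)) (begin
      D Y + Y * D C ≈⟨ p ⟩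
      e + Y * D (dilate C) ≈⟨ +-congˡ {e} (*-congˡ {Y} (trans (D.d-cong dilate-C) (D.d-+ C (rescale Ŝ)))) ⟩
      e + Y * (D C + D (rescale Ŝ)) ≈⟨ S.solve 4 (λ e y c s → e :+ y :* (c :+ s) := e :+ y :* s :+ y :* c) refl e Y (D C) (D (rescale Ŝ)) ⟩
      e + Y * D (rescale Ŝ) + Y * D C ∎)
      where module D = N.IsDerivation isD

    module Step {D : Carrier → Carrier} {e : Carrier} (isD : N.IsDerivation D) (p : D Y + Y * D C ≈ e + Y * D (dilate C)) where

      scaled : U * D Y ≈ U * e + rescale X̂ * D (rescale Ŝ)
      scaled = begin
        U * D Y ≈⟨ *-congˡ {U} (difference {D} {e} isD p) ⟩
        U * (e + Y * D (rescale Ŝ)) ≈⟨ S.solve 4 (λ u e y s → u :* (e :+ y :* s) := u :* e :+ u :* y :* s) refl U e Y (D (rescale Ŝ)) ⟩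
        U * e + U * Y * D (rescale Ŝ) ≈⟨ +-congˡ {U * e} (*-congʳ {D (rescale Ŝ)} UY) ⟩
        U * e + rescale X̂ * D (rescale Ŝ) ∎

    hat-Dx-equation : Dx X̂ ≈ X̂ + X̂ * Dx Ŝ
    hat-Dx-equation = rescale-injective (begin
      rescale (Dx X̂) ≈⟨ Dx-rescale X̂ ⟨
      Dx (rescale X̂) ≈⟨ Dx.d-cong UY ⟨
      Dx (U * Y) ≈⟨ Dx-U Y ⟩
      U * Dx Y ≈⟨ Step.scaled {Dx} {Y} Dx-isDerivation Dx-equation ⟩
      U * Y + rescale X̂ * Dx (rescale Ŝ) ≈⟨ +-cong UY (trans (*-congˡ {rescale X̂} (Dx-rescale Ŝ)) (sym (rescale-* X̂ (Dx Ŝ)))) ⟩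
      rescale X̂ + rescale (X̂ * Dx Ŝ) ≈⟨ rescale-+ X̂ (X̂ * Dx Ŝ) ⟨
      rescale (X̂ + X̂ * Dx Ŝ) ∎)

    U0+ : ∀ f → U * 0# + f ≈ f
    U0+ f = trans (+-congʳ {f} (zeroʳ U)) (+-identityˡ f)

    hat-Dy-equation : Dy X̂ ≈ X̂ * Dy Ŝ
    hat-Dy-equation = rescale-injective (begin
      rescale (Dy X̂) ≈⟨ Dy-rescale X̂ ⟨
      Dy (rescale X̂) ≈⟨ Dy.d-cong UY ⟨
      Dy (U * Y) ≈⟨ Dy-U Y ⟩
      U * Dy Y ≈⟨ Step.scaled {Dy} {0#} Dy-isDerivation (trans Dy-equation (sym (+-identityˡ _))) ⟩
      U * 0# + rescale X̂ * Dy (rescale Ŝ) ≈⟨ U0+ (rescale X̂ * Dy (rescale Ŝ)) ⟩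
      rescale X̂ * Dy (rescale Ŝ) ≈⟨ *-congˡ {rescale X̂} (Dy-rescale Ŝ) ⟩
      rescale X̂ * rescale (Dy Ŝ) ≈⟨ rescale-* X̂ (Dy Ŝ) ⟨
      rescale (X̂ * Dy Ŝ) ∎)

    -- Since the rescaling involves u, `Du` picks up Dx + Dy (`Du-rescale`). The surplus terms are
    -- those of `hat-Dx-equation` and `hat-Dy-equation` and are cancelled.
    hat-Du-equation : Du X̂ ≈ X̂ * Du Ŝ
    hat-Du-equation = ∙-cancelʳ (X̂ + X̂ * Dx Ŝ + X̂ * Dy Ŝ) (Du X̂) (X̂ * Du Ŝ) (begin
      Du X̂ + (X̂ + X̂ * Dx Ŝ + X̂ * Dy Ŝ) ≈⟨ +-congˡ {Du X̂} (+-cong hat-Dx-equation hat-Dy-equation) ⟨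
      Du X̂ + (Dx X̂ + Dy X̂) ≈⟨ +-assoc (Du X̂) (Dx X̂) (Dy X̂) ⟨
      Du X̂ + Dx X̂ + Dy X̂ ≈⟨ total ⟩
      X̂ + X̂ * (Du Ŝ + Dx Ŝ + Dy Ŝ) ≈⟨ S.solve 4 (λ x a b c → x :+ x :* (a :+ b :+ c) := x :* a :+ (x :+ x :* b :+ x :* c)) refl X̂ (Du Ŝ) (Dx Ŝ) (Dy Ŝ) ⟩
      X̂ * Du Ŝ + (X̂ + X̂ * Dx Ŝ + X̂ * Dy Ŝ) ∎)
      where
      total : Du X̂ + Dx X̂ + Dy X̂ ≈ X̂ + X̂ * (Du Ŝ + Dx Ŝ + Dy Ŝ)
      total = rescale-injective (begin
        rescale (Du X̂ + Dx X̂ + Dy X̂) ≈⟨ Du-rescale X̂ ⟨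
        Du (rescale X̂) ≈⟨ Du.d-cong UY ⟨
        Du (U * Y) ≈⟨ Du-U Y ⟩
        U * Y + U * Du Y ≈⟨ +-congˡ {U * Y} (Step.scaled {Du} {0#} Du-isDerivation (trans Du-equation (sym (+-identityˡ _)))) ⟩
        U * Y + (U * 0# + rescale X̂ * Du (rescale Ŝ)) ≈⟨ +-cong UY (U0+ (rescale X̂ * Du (rescale Ŝ))) ⟩
        rescale X̂ + rescale X̂ * Du (rescale Ŝ) ≈⟨ +-congˡ {rescale X̂} (*-congˡ {rescale X̂} (Du-rescale Ŝ)) ⟩
        rescale X̂ + rescale X̂ * rescale (Du Ŝ + Dx Ŝ + Dy Ŝ) ≈⟨ +-congˡ {rescale X̂} (rescale-* X̂ (Du Ŝ + Dx Ŝ + Dy Ŝ)) ⟨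
        rescale X̂ + rescale (X̂ * (Du Ŝ + Dx Ŝ + Dy Ŝ)) ≈⟨ rescale-+ X̂ _ ⟨
        rescale (X̂ + X̂ * (Du Ŝ + Dx Ŝ + Dy Ŝ)) ∎)

-- Rational expressions in Tx and Ty

-- 1/n, with the junk value 1 at n = 0
reciprocal : ℕ → ℚ
reciprocal zero    = 1ℚ
reciprocal (suc n) = ℤ.+ 1 / suc n

module _ (R : Ring₀) where
  open CommutativeRing R
  open Convolution R using (_⊛_)
  open SemiringMult semiring using (_×_)
  open Notions R

  -- A convolution of a sequence of operators with a sequence of series, peeled like `_⊛_`.
  S-sum : (ℕ → Carrier → Carrier) → (ℕ → Carrier) → ℕ → Carrier
  S-sum γ f zero    = γ 0 (f 0)
  S-sum γ f (suc m) = γ 0 (f (suc m)) + S-sum (tail γ) f m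

  -- κ embeds the constants, σ exchanges x and y, I = 1/(1 - W), and β i is the operator binom(DY, i + 1).
  record Setting : Set where
    field
      κ         : ℚ → Carrier
      κ-1       : κ 1ℚ ≈ 1#
      κ-+       : ∀ a b → κ (a ℚ.+ b) ≈ κ a + κ b
      κ-*       : ∀ a b → κ a * κ b ≈ κ (a ℚ.* b)
      κ-neg     : ∀ a → κ (ℚ.- a) ≈ - κ a
      κ-cancel  : ∀ n x → κ (reciprocal (suc n)) * (suc n × x) ≈ x
      DX DY σ   : Carrier → Carrier
      DX-isDerivation : IsDerivation DX
      DY-isDerivation : IsDerivation DY
      σ-isEndo  : IsEndo σ
      DX-κ      : ∀ c → DX (κ c) ≈ 0#
      DY-κ      : ∀ c → DY (κ c) ≈ 0#
      σ-κ       : ∀ c → σ (κ c) ≈ κ c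
      σ-σ       : ∀ f → σ (σ f) ≈ f
      σ-DX      : ∀ f → σ (DX f) ≈ DY (σ f)
      F S       : ℕ → Carrier
      β         : ℕ → Carrier → Carrier
      F-symmetric : ∀ k → σ (F k) ≈ F k
      I         : Carrier
      I-inverse : I ≈ 1# + DX (F 0) * DY (F 0) * I
      DX-equation : DX (DX (F 0)) ≈ DX (F 0) + DX (F 0) * DX (S 0)
      DY-equation : DY (DX (F 0)) ≈ DX (F 0) * DY (S 0)
      betti-equation : ∀ k →
        suc k × F (suc k) + DX (F (suc k)) + DY (F (suc k)) + (k × F k + DX (F k) + DY (F k)) ≈
        F (suc k) + F k + (DX (DY (F k)) + ((λ i → DX (F i)) ⊛ (λ j → DY (F j))) (suc k))
      root-recursion : ∀ k → k × DX (F k) ≈ ((λ i → DX (F i)) ⊛ (λ j → j × S j)) k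
      S-expansion : ∀ m → S m ≈ S-sum β F m
      β-zero    : ∀ f → β 0 f ≈ DY f
      β-suc     : ∀ i f → suc (suc i) × β (suc i) f + suc i × β i f ≈ DY (β i f)

module Spans (R : Ring₀) (setting : Setting R) where
  open CommutativeRing R hiding (zero)
  open Convolution R using (_⊛_; ⊛-step)
  open SemiringMult semiring using (_×_; ×-congʳ; ×-congˡ; ×-homo-+; ×-comm-*; ×-assoc-*)
  open Exp commutativeSemiring using (_^_; ^-homo-*)
  open GroupProperties +-group using (∙-cancelˡ; ∙-cancelʳ)
  open RingProperties ring using (-‿distribˡ-*)
  open Setting setting
  open SetoidReasoning setoid
  open NatSolver commutativeSemiring using (solve; _:+_; _:*_; _:=_; con)
  module DX = Notions.IsDerivation DX-isDerivation
  module DY = Notions.IsDerivation DY-isDerivation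
  module σ = Notions.IsEndo σ-isEndo

  Tx Ty W : Carrier
  Tx = DX (F 0)
  Ty = DY (F 0)
  W  = Tx * Ty

  σ-DY : ∀ f → σ (DY f) ≈ DX (σ f)
  σ-DY f = trans (σ.h-cong (trans (DY.d-cong (sym (σ-σ f))) (sym (σ-DX (σ f))))) (σ-σ (DX (σ f)))

  σ-Tx : σ Tx ≈ Ty
  σ-Tx = trans (σ-DX (F 0)) (DY.d-cong (F-symmetric 0))

  σ-Ty : σ Ty ≈ Tx
  σ-Ty = trans (σ.h-cong (sym σ-Tx)) (σ-σ Tx)

  σ-1 : σ 1# ≈ 1#
  σ-1 = trans (σ.h-cong (sym κ-1)) (trans (σ-κ 1ℚ) κ-1)

  σ-W : σ W ≈ W
  σ-W = trans (σ.h-* Tx Ty) (trans (*-cong σ-Tx σ-Ty) (*-comm Ty Tx))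

  -- Multiplying by I and cancelling W * x * I replaces division by 1 - W; the linear equations for
  -- derivatives below are solved in this way.
  I-unique : ∀ {a x} → x ≈ a + W * x → x ≈ a * I
  I-unique {a} {x} p = ∙-cancelʳ (W * x * I) x (a * I) (begin
    x + W * x * I ≈⟨ solve 3 (λ w x i → x :+ w :* x :* i := x :* (con 1 :+ w :* i)) refl W x I ⟩
    x * (1# + W * I) ≈⟨ *-congˡ I-inverse ⟨
    x * I ≈⟨ *-congʳ p ⟩
    (a + W * x) * I ≈⟨ distribʳ I a (W * x) ⟩
    a * I + W * x * I ∎)

  σ-I : σ I ≈ I
  σ-I = trans (I-unique {1#} (trans (σ.h-cong I-inverse) (trans (σ.h-+ 1# (W * I))
    (+-cong σ-1 (trans (σ.h-* W I) (*-congʳ σ-W)))))) (*-identityˡ I)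

  S₀ : S 0 ≈ Ty
  S₀ = trans (S-expansion 0) (β-zero (F 0))

  -- This and the next two lemmas are the logarithmic derivatives of Tx = x exp(Ty) and of its
  -- mirror image.
  DX-Tx′ : DX Tx ≈ Tx + Tx * DX Ty
  DX-Tx′ = trans DX-equation (+-congˡ (*-congˡ (DX.d-cong S₀)))

  DY-Tx′ : DY Tx ≈ Tx * DY Ty
  DY-Tx′ = trans DY-equation (*-congˡ (DY.d-cong S₀))

  DY-Ty′ : DY Ty ≈ Ty + Ty * DY Tx
  DY-Ty′ = begin
    DY Ty ≈⟨ DY.d-cong σ-Tx ⟨
    DY (σ Tx) ≈⟨ σ-DX Tx ⟨
    σ (DX Tx) ≈⟨ σ.h-cong DX-Tx′ ⟩
    σ (Tx + Tx * DX Ty) ≈⟨ σ.h-+ Tx (Tx * DX Ty) ⟩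
    σ Tx + σ (Tx * DX Ty) ≈⟨ +-congˡ (σ.h-* Tx (DX Ty)) ⟩
    σ Tx + σ Tx * σ (DX Ty) ≈⟨ +-cong σ-Tx (*-cong σ-Tx (trans (σ-DX Ty) (DY.d-cong σ-Ty))) ⟩
    Ty + Ty * DY Tx ∎

  -- Eliminating DY Ty from `DY-Tx′` and `DY-Ty′` leaves an equation of the form t = W + W t.
  DY-Tx : DY Tx ≈ Tx * Ty * I
  DY-Tx = I-unique (trans DY-Tx′ (trans (*-congˡ DY-Ty′)
    (solve 3 (λ x y v → x :* (y :+ y :* v) := x :* y :+ x :* y :* v) refl Tx Ty (DY Tx))))

  DY-Ty : DY Ty ≈ Ty * I
  DY-Ty = trans DY-Ty′ (trans (+-congˡ (*-congˡ DY-Tx))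
    (trans (solve 3 (λ x y i → y :+ y :* (x :* y :* i) := y :* (con 1 :+ x :* y :* i)) refl Tx Ty I) (*-congˡ (sym I-inverse))))

  DY-W : DY W ≈ W * (1# + Ty) * I
  DY-W = trans (DY.d-* Tx Ty) (trans (+-cong (*-congʳ DY-Tx) (*-congˡ DY-Ty))
    (solve 3 (λ x y i → x :* y :* i :* y :+ x :* (y :* i) := x :* y :* (con 1 :+ y) :* i) refl Tx Ty I))

  DY-I : DY I ≈ W * (1# + Ty) * (I * I) * I
  DY-I = I-unique (trans (DY.d-cong I-inverse) (trans (DY.d-+ 1# (W * I)) (trans (+-cong DY.d-1 (DY.d-* W I))
    (trans (+-identityˡ _) (+-congʳ (trans (*-congʳ DY-W) (*-assoc _ I I)))))))

  monomial : ℚ → ℕ → ℕ → ℕ → Carrier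
  monomial c i j q = κ c * (Tx ^ i * Ty ^ j * I ^ q)

  -- p bounds the order of the pole at W = 1; α and γ bound i - j and j - i, hence the degree in Z after symmetrising.
  data Span (a b α γ p : ℕ) : Carrier → Set where
    mono : ∀ c i j q → a ≤ i → b ≤ j → i ≤ j ℕ.+ α → j ≤ i ℕ.+ γ → q ≤ p → Span a b α γ p (monomial c i j q)
    none : Span a b α γ p 0#
    add  : ∀ {x y} → Span a b α γ p x → Span a b α γ p y → Span a b α γ p (x + y)
    resp : ∀ {x y} → x ≈ y → Span a b α γ p x → Span a b α γ p y

  weaken : ∀ {a b α γ p a′ b′ α′ γ′ p′} → a′ ≤ a → b′ ≤ b → α ≤ α′ → γ ≤ γ′ → p ≤ p′ →
    ∀ {x} → Span a b α γ p x → Span a′ b′ α′ γ′ p′ x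
  weaken A B C D E (mono c i j q a b α γ p) = mono c i j q (ℕP.≤-trans A a) (ℕP.≤-trans B b)
    (ℕP.≤-trans α (ℕP.+-monoʳ-≤ j C)) (ℕP.≤-trans γ (ℕP.+-monoʳ-≤ i D)) (ℕP.≤-trans p E)
  weaken A B C D E none        = none
  weaken A B C D E (add x y)   = add (weaken A B C D E x) (weaken A B C D E y)
  weaken A B C D E (resp e x)  = resp e (weaken A B C D E x)

  monomial-* : ∀ c i j q c′ i′ j′ q′ →
    monomial (c ℚ.* c′) (i ℕ.+ i′) (j ℕ.+ j′) (q ℕ.+ q′) ≈ monomial c i j q * monomial c′ i′ j′ q′
  monomial-* c i j q c′ i′ j′ q′ = trans
    (*-cong (sym (κ-* c c′)) (*-cong (*-cong (^-homo-* Tx i i′) (^-homo-* Ty j j′)) (^-homo-* I q q′)))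
    (solve 8 (λ k k′ a a′ b b′ c c′ → k :* k′ :* (a :* a′ :* (b :* b′) :* (c :* c′)) := k :* (a :* b :* c) :* (k′ :* (a′ :* b′ :* c′)))
      refl (κ c) (κ c′) (Tx ^ i) (Tx ^ i′) (Ty ^ j) (Ty ^ j′) (I ^ q) (I ^ q′))

  private
    +-≤ : ∀ {a b c d e f} → a ≤ b ℕ.+ c → d ≤ e ℕ.+ f → a ℕ.+ d ≤ b ℕ.+ e ℕ.+ (c ℕ.+ f)
    +-≤ {a} {b} {c} {d} {e} {f} p q = ℕP.≤-trans (ℕP.+-mono-≤ p q) (ℕP.≤-reflexive (interchange b c e f))
      where open import Algebra.Properties.CommutativeSemigroup ℕP.+-commutativeSemigroup using (interchange)

  Span-* : ∀ {a b α γ p a′ b′ α′ γ′ p′ x y} → Span a b α γ p x → Span a′ b′ α′ γ′ p′ y →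
    Span (a ℕ.+ a′) (b ℕ.+ b′) (α ℕ.+ α′) (γ ℕ.+ γ′) (p ℕ.+ p′) (x * y)
  Span-* (mono c i j q a b α γ p) (mono c′ i′ j′ q′ a′ b′ α′ γ′ p′) = resp (monomial-* c i j q c′ i′ j′ q′)
    (mono (c ℚ.* c′) (i ℕ.+ i′) (j ℕ.+ j′) (q ℕ.+ q′) (ℕP.+-mono-≤ a a′) (ℕP.+-mono-≤ b b′)
      (+-≤ {i} {j} {_} {i′} {j′} α α′) (+-≤ {j} {i} {_} {j′} {i′} γ γ′) (ℕP.+-mono-≤ p p′))
  Span-* x@(mono _ _ _ _ _ _ _ _ _) none       = resp (sym (zeroʳ _)) none
  Span-* x@(mono _ _ _ _ _ _ _ _ _) (add y z)  = resp (sym (distribˡ _ _ _)) (add (Span-* x y) (Span-* x z))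
  Span-* x@(mono _ _ _ _ _ _ _ _ _) (resp e y) = resp (*-congˡ e) (Span-* x y)
  Span-* none       y = resp (sym (zeroˡ _)) none
  Span-* (add x z)  y = resp (sym (distribʳ _ _ _)) (add (Span-* x y) (Span-* z y))
  Span-* (resp e x) y = resp (*-congʳ e) (Span-* x y)

  κ*monomial : ∀ c c′ i j q → monomial (c ℚ.* c′) i j q ≈ κ c * monomial c′ i j q
  κ*monomial c c′ i j q = trans (*-congʳ (sym (κ-* c c′))) (*-assoc _ _ _)

  Span-κ : ∀ {a b α γ p} c {x} → Span a b α γ p x → Span a b α γ p (κ c * x)
  Span-κ c (mono c′ i j q a b α γ p) = resp (κ*monomial c c′ i j q) (mono (c ℚ.* c′) i j q a b α γ p)
  Span-κ c none       = resp (sym (zeroʳ _)) none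
  Span-κ c (add x y)  = resp (sym (distribˡ _ _ _)) (add (Span-κ c x) (Span-κ c y))
  Span-κ c (resp e x) = resp (*-congˡ e) (Span-κ c x)

  -1*-κ : ∀ x → κ (ℚ.- 1ℚ) * x ≈ - x
  -1*-κ x = trans (*-congʳ (trans (κ-neg 1ℚ) (-‿cong κ-1))) (trans (sym (-‿distribˡ-* 1# x)) (-‿cong (*-identityˡ x)))

  Span-neg : ∀ {a b α γ p x} → Span a b α γ p x → Span a b α γ p (- x)
  Span-neg {x = x} s = resp (-1*-κ x) (Span-κ (ℚ.- 1ℚ) s)

  Span-× : ∀ {a b α γ p} n {x} → Span a b α γ p x → Span a b α γ p (n × x)
  Span-× zero    s = none
  Span-× (suc n) s = add s (Span-× n s)

  Span-÷ : ∀ {a b α γ p} n {x} → Span a b α γ p (suc n × x) → Span a b α γ p x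
  Span-÷ n {x} s = resp (κ-cancel n x) (Span-κ (reciprocal (suc n)) s)

  Span-minus : ∀ {a b α γ p x y z} → x + y ≈ z → Span a b α γ p z → Span a b α γ p y → Span a b α γ p x
  Span-minus {x = x} {y} {z} e s t = resp (begin
    z + - y ≈⟨ +-congʳ e ⟨
    x + y + - y ≈⟨ +-assoc x y (- y) ⟩
    x + (y + - y) ≈⟨ +-congˡ (-‿inverseʳ y) ⟩
    x + 0# ≈⟨ +-identityʳ x ⟩
    x ∎) (add s (Span-neg t))

  Span-mono : ∀ {a b α γ p} i j q → a ≤ i → b ≤ j → i ≤ j ℕ.+ α → j ≤ i ℕ.+ γ → q ≤ p → Span a b α γ p (Tx ^ i * Ty ^ j * I ^ q)
  Span-mono i j q a b α γ p = resp (trans (*-congʳ κ-1) (*-identityˡ _)) (mono 1ℚ i j q a b α γ p)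

  Span-Ty : Span 0 1 0 1 0 Ty
  Span-Ty = resp (solve 1 (λ x → con 1 :* (x :* con 1) :* con 1 := x) refl Ty) (Span-mono 0 1 0 z≤n (s≤s z≤n) z≤n (s≤s z≤n) z≤n)

  Span-I : Span 0 0 0 0 1 I
  Span-I = resp (solve 1 (λ x → con 1 :* con 1 :* (x :* con 1) := x) refl I) (Span-mono 0 0 1 z≤n z≤n z≤n z≤n (s≤s z≤n))

  Span-1 : Span 0 0 0 0 0 1#
  Span-1 = resp (trans (*-congʳ (*-identityˡ _)) (*-identityˡ _)) (Span-mono 0 0 0 z≤n z≤n z≤n z≤n z≤n)

  Span-W : Span 1 1 0 0 0 W
  Span-W = resp (solve 2 (λ x y → x :* con 1 :* (y :* con 1) :* con 1 := x :* y) refl Tx Ty)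
    (Span-mono 1 1 0 (s≤s z≤n) (s≤s z≤n) (s≤s z≤n) (s≤s z≤n) z≤n)

  Span-I* : ∀ {a b α γ p x} → Span a b α γ p x → Span a b α γ (suc p) (I * x)
  Span-I* = Span-* Span-I

  -- A factor Tx raises i - j and so lowers the bound γ on j - i, which the general product rule
  -- `Span-*` does not record.
  Span-Tx* : ∀ {a b α γ p x} → Span a b α (suc γ) p x → Span (suc a) b (suc α) γ p (Tx * x)
  Span-Tx* {γ = γ} (mono c i j q a b α g p) = resp
    (solve 5 (λ k x a b c → k :* (x :* a :* b :* c) := x :* (k :* (a :* b :* c))) refl (κ c) Tx (Tx ^ i) (Ty ^ j) (I ^ q))
    (mono c (suc i) j q (s≤s a) b (ℕP.≤-trans (s≤s α) (ℕP.≤-reflexive (≡.sym (ℕP.+-suc j _))))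
      (ℕP.≤-trans g (ℕP.≤-reflexive (ℕP.+-suc i γ))) p)
  Span-Tx* none       = resp (sym (zeroʳ _)) none
  Span-Tx* (add x y)  = resp (sym (distribˡ _ _ _)) (add (Span-Tx* x) (Span-Tx* y))
  Span-Tx* (resp e x) = resp (*-congˡ e) (Span-Tx* x)

  σ-^ : ∀ {x y} n → σ x ≈ y → σ (x ^ n) ≈ y ^ n
  σ-^ zero    e = σ-1
  σ-^ (suc n) e = trans (σ.h-* _ _) (*-cong e (σ-^ n e))

  σ-monomial : ∀ c i j q → σ (monomial c i j q) ≈ monomial c j i q
  σ-monomial c i j q = begin
    σ (κ c * (Tx ^ i * Ty ^ j * I ^ q)) ≈⟨ σ.h-* _ _ ⟩
    σ (κ c) * σ (Tx ^ i * Ty ^ j * I ^ q) ≈⟨ *-cong (σ-κ c) (σ.h-* _ _) ⟩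
    κ c * (σ (Tx ^ i * Ty ^ j) * σ (I ^ q)) ≈⟨ *-congˡ (*-cong (σ.h-* _ _) (σ-^ q σ-I)) ⟩
    κ c * (σ (Tx ^ i) * σ (Ty ^ j) * I ^ q) ≈⟨ *-congˡ (*-congʳ (*-cong (σ-^ i σ-Tx) (σ-^ j σ-Ty))) ⟩
    κ c * (Ty ^ i * Tx ^ j * I ^ q) ≈⟨ *-congˡ (*-congʳ (*-comm _ _)) ⟩
    κ c * (Tx ^ j * Ty ^ i * I ^ q) ∎

  σ-0 : σ 0# ≈ 0#
  σ-0 = ∙-cancelˡ (σ 0#) _ _ (trans (sym (σ.h-+ 0# 0#)) (trans (σ.h-cong (+-identityˡ 0#)) (sym (+-identityʳ _))))

  Span-σ : ∀ {a b α γ p x} → Span a b α γ p x → Span b a γ α p (σ x)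
  Span-σ (mono c i j q a b α γ p) = resp (sym (σ-monomial c i j q)) (mono c j i q b a γ α p)
  Span-σ none       = resp (sym σ-0) none
  Span-σ (add x y)  = resp (sym (σ.h-+ _ _)) (add (Span-σ x) (Span-σ y))
  Span-σ (resp e x) = resp (σ.h-cong e) (Span-σ x)

  derivation-^ : ∀ {D} → Notions.IsDerivation R D → ∀ {x l} → D x ≈ l * x → ∀ n → D (x ^ n) ≈ n × (l * x ^ n)
  derivation-^ {D} isD {x} {l} e zero    = Notions.IsDerivation.d-1 isD
  derivation-^ {D} isD {x} {l} e (suc n) = begin
    D (x * x ^ n) ≈⟨ Notions.IsDerivation.d-* isD x (x ^ n) ⟩
    D x * x ^ n + x * D (x ^ n) ≈⟨ +-cong (*-congʳ e) (*-congˡ (derivation-^ isD e n)) ⟩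
    l * x * x ^ n + x * (n × (l * x ^ n)) ≈⟨ +-cong (*-assoc _ _ _) (×-comm-* n x (l * x ^ n)) ⟩
    l * (x * x ^ n) + n × (x * (l * x ^ n)) ≈⟨ +-congˡ (×-congʳ n (solve 3 (λ x l y → x :* (l :* y) := l :* (x :* y)) refl x l (x ^ n))) ⟩
    suc n × (l * x ^ suc n) ∎

  -- D multiplies each of Tx, Ty and I by a factor, so it multiplies a monomial by the combination
  -- of these factors with its exponents.
  derivation-monomial : ∀ {D} → Notions.IsDerivation R D → (∀ c → D (κ c) ≈ 0#) →
    ∀ {l m n} → D Tx ≈ l * Tx → D Ty ≈ m * Ty → D I ≈ n * I → ∀ c i j q →
    D (monomial c i j q) ≈ i × (l * monomial c i j q) + j × (m * monomial c i j q) + q × (n * monomial c i j q)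
  derivation-monomial {D} isD D-κ {l} {m} {n} ex ey eI c i j q = begin
    D (κ c * (X * Y * J))
      ≈⟨ D.d-* _ _ ⟩
    D (κ c) * (X * Y * J) + κ c * D (X * Y * J)
      ≈⟨ trans (+-congʳ (trans (*-congʳ (D-κ c)) (zeroˡ _))) (+-identityˡ _) ⟩
    κ c * D (X * Y * J)
      ≈⟨ *-congˡ (trans (D.d-* _ _) (+-congʳ (*-congʳ (D.d-* _ _)))) ⟩
    κ c * ((D X * Y + X * D Y) * J + X * Y * D J)
      ≈⟨ *-congˡ (+-cong (*-congʳ (+-cong (*-congʳ (derivation-^ isD ex i)) (*-congˡ (derivation-^ isD ey j)))) (*-congˡ (derivation-^ isD eI q))) ⟩
    κ c * ((i × (l * X) * Y + X * (j × (m * Y))) * J + X * Y * (q × (n * J)))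
      ≈⟨ solve 7 (λ k x y z a b e → k :* ((a :* y :+ x :* b) :* z :+ x :* y :* e) := (k :* y :* z) :* a :+ (k :* x :* z) :* b :+ (k :* x :* y) :* e) refl
           (κ c) X Y J (i × (l * X)) (j × (m * Y)) (q × (n * J)) ⟩
    κ c * Y * J * (i × (l * X)) + κ c * X * J * (j × (m * Y)) + κ c * X * Y * (q × (n * J))
      ≈⟨ +-cong (+-cong (×-comm-* i _ _) (×-comm-* j _ _)) (×-comm-* q _ _) ⟩
    i × (κ c * Y * J * (l * X)) + j × (κ c * X * J * (m * Y)) + q × (κ c * X * Y * (n * J))
      ≈⟨ +-cong (+-cong
           (×-congʳ i (solve 5 (λ k x y z l → k :* y :* z :* (l :* x) := l :* (k :* (x :* y :* z))) refl (κ c) X Y J l))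
           (×-congʳ j (solve 5 (λ k x y z l → k :* x :* z :* (l :* y) := l :* (k :* (x :* y :* z))) refl (κ c) X Y J m)))
           (×-congʳ q (solve 5 (λ k x y z l → k :* x :* y :* (l :* z) := l :* (k :* (x :* y :* z))) refl (κ c) X Y J n)) ⟩
    i × (l * monomial c i j q) + j × (m * monomial c i j q) + q × (n * monomial c i j q) ∎
    where
    module D = Notions.IsDerivation isD
    X = Tx ^ i
    Y = Ty ^ j
    J = I ^ q

  DY-Tx-log : DY Tx ≈ Ty * I * Tx
  DY-Tx-log = trans DY-Tx (solve 3 (λ x y i → x :* y :* i := y :* i :* x) refl Tx Ty I)

  DY-Ty-log : DY Ty ≈ I * Ty
  DY-Ty-log = trans DY-Ty (*-comm Ty I)

  -- Under DY the logarithmic derivatives of Tx, Ty and I are Ty I, I and W (1 + Ty) I². They add at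
  -- most two poles and one to j - i, and never lower an exponent of Tx or Ty.
  Span-DY : ∀ {a b α γ p x} → Span a b α γ p x → Span a b α (suc γ) (2 ℕ.+ p) (DY x)
  Span-DY {a} {b} {α} {γ} {p} s@(mono c i j q _ _ _ _ _) =
    resp (sym (derivation-monomial DY-isDerivation DY-κ DY-Tx-log DY-Ty-log DY-I c i j q))
      (add (add (Span-× i (widen (ℕP.n≤1+n (suc p)) (Span-* Span-TyI s)))
                (Span-× j (weaken ℕP.≤-refl ℕP.≤-refl ℕP.≤-refl (ℕP.n≤1+n γ) (ℕP.n≤1+n (suc p)) (Span-I* s))))
           (Span-× q (weaken (ℕP.n≤1+n a) (ℕP.n≤1+n b) ℕP.≤-refl ℕP.≤-refl ℕP.≤-refl (Span-* Span-log s))))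
    where
    widen : ∀ {p′ y} → p′ ≤ 2 ℕ.+ p → Span a (suc b) α (suc γ) p′ y → Span a b α (suc γ) (2 ℕ.+ p) y
    widen e = weaken ℕP.≤-refl (ℕP.n≤1+n b) ℕP.≤-refl ℕP.≤-refl e
    Span-TyI : Span 0 1 0 1 1 (Ty * I)
    Span-TyI = Span-* Span-Ty Span-I
    Span-log : Span 1 1 0 1 2 (W * (1# + Ty) * (I * I))
    Span-log = Span-* (Span-* Span-W Span-1+Ty) (Span-* Span-I Span-I)
      where
      Span-1+Ty : Span 0 0 0 1 0 (1# + Ty)
      Span-1+Ty = add (weaken z≤n z≤n z≤n z≤n z≤n Span-1) (weaken z≤n z≤n z≤n ℕP.≤-refl z≤n Span-Ty)
  Span-DY none       = resp (sym DY.d-0) none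
  Span-DY (add x y)  = resp (sym (DY.d-+ _ _)) (add (Span-DY x) (Span-DY y))
  Span-DY (resp e x) = resp (DY.d-cong e) (Span-DY x)

  Span-DX : ∀ {a b α γ p x} → Span a b α γ p x → Span a b (suc α) γ (2 ℕ.+ p) (DX x)
  Span-DX {x = x} s = resp (trans (σ-DY (σ x)) (DX.d-cong (σ-σ x))) (Span-σ (Span-DY (Span-σ s)))

  -- binom(D, i + 2) is (D - i - 1) binom(D, i + 1) / (i + 2), so each step costs one DY. The
  -- hypothesis is on DY f because F 1 itself is not rational in Tx and Ty.
  Span-β : ∀ {a b α γ p f} → Span a b α γ p (DY f) → ∀ i → Span a b α (i ℕ.+ γ) (i ℕ.+ i ℕ.+ p) (β i f)
  Span-β {f = f} s zero    = resp (sym (β-zero f)) s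
  Span-β {γ = γ} {p} {f} s (suc i) = Span-÷ (suc i) (Span-minus (β-suc i f)
    (weaken ℕP.≤-refl ℕP.≤-refl ℕP.≤-refl ℕP.≤-refl
      (ℕP.≤-reflexive (≡.cong (λ n → suc n ℕ.+ p) (≡.sym (ℕP.+-suc i i)))) (Span-DY (Span-β s i)))
    (Span-× (suc i) (weaken ℕP.≤-refl ℕP.≤-refl ℕP.≤-refl (ℕP.n≤1+n _)
      (ℕP.+-monoˡ-≤ p (ℕP.+-mono-≤ (ℕP.n≤1+n i) (ℕP.n≤1+n i))) (Span-β s i))))

  β₁-F₀ : 2 × β 1 (F 0) + 1 × Ty ≈ Ty * I
  β₁-F₀ = trans (+-congˡ (×-congʳ 1 (sym (β-zero (F 0))))) (trans (β-suc 0 (F 0)) (trans (DY.d-cong (β-zero (F 0))) DY-Ty))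

  -- DY Ty = Ty I gains only one pole and no further factor Ty, so both γ and the pole order are one
  -- better than `Span-β` would give.
  Span-β-F₀ : ∀ i → Span 0 0 0 (suc i) (suc (i ℕ.+ i)) (β (suc i) (F 0))
  Span-β-F₀ zero    = Span-÷ 1 (Span-minus β₁-F₀
    (weaken z≤n z≤n ℕP.≤-refl ℕP.≤-refl ℕP.≤-refl (Span-* Span-Ty Span-I))
    (Span-× 1 (weaken z≤n z≤n ℕP.≤-refl ℕP.≤-refl z≤n Span-Ty)))
  Span-β-F₀ (suc i) = Span-÷ (suc (suc i)) (Span-minus (β-suc (suc i) (F 0))
    (weaken ℕP.≤-refl ℕP.≤-refl ℕP.≤-refl ℕP.≤-refl
      (ℕP.≤-reflexive (≡.cong (λ n → suc (suc n)) (≡.sym (ℕP.+-suc i i)))) (Span-DY (Span-β-F₀ i)))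
    (Span-× (suc (suc i)) (weaken ℕP.≤-refl ℕP.≤-refl ℕP.≤-refl (ℕP.n≤1+n _)
      (s≤s (ℕP.+-mono-≤ (ℕP.n≤1+n i) (ℕP.n≤1+n i))) (Span-β-F₀ i))))

  -- The factor Tx is needed: Tx β₁ F₀ = ½ W² I, while β₁ F₀ itself is not divisible by W².
  Span-Tx-β-F₀ : ∀ i → Span 2 2 0 i (suc (i ℕ.+ i)) (Tx * β (suc i) (F 0))
  Span-Tx-β-F₀ zero = Span-÷ 1 (resp base (Span-* (Span-* Span-W Span-W) Span-I))
    where
    base : W * W * I ≈ 2 × (Tx * β 1 (F 0))
    base = ∙-cancelʳ (W * 1#) (W * W * I) (2 × (Tx * β 1 (F 0))) (begin
      W * W * I + W * 1# ≈⟨ solve 3 (λ x y i → x :* y :* (x :* y) :* i :+ x :* y :* con 1 := x :* (y :* (con 1 :+ x :* y :* i))) refl Tx Ty I ⟩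
      Tx * (Ty * (1# + W * I)) ≈⟨ *-congˡ (*-congˡ I-inverse) ⟨
      Tx * (Ty * I) ≈⟨ *-congˡ β₁-F₀ ⟨
      Tx * (2 × β 1 (F 0) + 1 × Ty) ≈⟨ solve 3 (λ x b y → x :* (b :+ (y :+ con 0)) := x :* b :+ x :* y :* con 1) refl Tx (2 × β 1 (F 0)) Ty ⟩
      Tx * (2 × β 1 (F 0)) + W * 1# ≈⟨ +-congʳ (×-comm-* 2 Tx (β 1 (F 0))) ⟩
      2 × (Tx * β 1 (F 0)) + W * 1# ∎)
  Span-Tx-β-F₀ (suc i) = Span-÷ (suc (suc i)) (Span-minus step
    (weaken ℕP.≤-refl ℕP.≤-refl ℕP.≤-refl ℕP.≤-refl
      (ℕP.≤-reflexive (≡.cong (λ n → suc (suc n)) (≡.sym (ℕP.+-suc i i)))) (Span-DY (Span-Tx-β-F₀ i)))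
    (add (Span-× (suc (suc i)) (weaken ℕP.≤-refl ℕP.≤-refl ℕP.≤-refl (ℕP.n≤1+n _)
           (s≤s (ℕP.+-mono-≤ (ℕP.n≤1+n i) (ℕP.n≤1+n i))) (Span-Tx-β-F₀ i)))
         (weaken ℕP.≤-refl (ℕP.n≤1+n 2) ℕP.≤-refl ℕP.≤-refl
           (ℕP.≤-trans (ℕP.n≤1+n _) (ℕP.≤-reflexive (≡.cong (λ n → suc (suc n)) (≡.sym (ℕP.+-suc i i)))))
           (Span-* (Span-* Span-Ty Span-I) (Span-Tx-β-F₀ i)))))
    where
    b = β (suc i) (F 0)
    b′ = β (suc (suc i)) (F 0)
    step : suc (suc (suc i)) × (Tx * b′) + (suc (suc i) × (Tx * b) + Ty * I * (Tx * b)) ≈ DY (Tx * b)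
    step = begin
      suc (suc (suc i)) × (Tx * b′) + (suc (suc i) × (Tx * b) + Ty * I * (Tx * b))
        ≈⟨ +-cong (×-comm-* (suc (suc (suc i))) Tx b′) (+-congʳ (×-comm-* (suc (suc i)) Tx b)) ⟨
      Tx * (suc (suc (suc i)) × b′) + (Tx * (suc (suc i) × b) + Ty * I * (Tx * b))
        ≈⟨ solve 6 (λ x y i b m n → x :* m :+ (x :* n :+ y :* i :* (x :* b)) := x :* y :* i :* b :+ x :* (m :+ n)) refl Tx Ty I b (suc (suc (suc i)) × b′) (suc (suc i) × b) ⟩
      Tx * Ty * I * b + Tx * (suc (suc (suc i)) × b′ + suc (suc i) × b)
        ≈⟨ +-cong (*-congʳ (sym DY-Tx)) (*-congˡ (β-suc (suc i) (F 0))) ⟩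
      DY Tx * b + Tx * DY b
        ≈⟨ DY.d-* Tx b ⟨
      DY (Tx * b) ∎

  -- The known part Kₖ for k = n + 1. In the second sum the factor j removes the term with F (n +
  -- 1), and `tail β` starts with binom(DY, 2), so only F 0, ..., F n occur.
  kernel : ℕ → Carrier
  kernel n = Tx * S-sum R (tail β) F n + κ (reciprocal (suc n)) * ((λ i → DX (F (suc i))) ⊛ (λ j → j × S j)) n

  DX-F : ∀ n → DX (F (suc n)) ≈ Tx * DY (F (suc n)) + kernel n
  DX-F n = begin
    DX (F (suc n)) ≈⟨ κ-cancel n _ ⟨
    r * (suc n × DX (F (suc n))) ≈⟨ *-congˡ (root-recursion (suc n)) ⟩
    r * (Tx * (suc n × S (suc n)) + E) ≈⟨ *-congˡ (+-congʳ (trans (×-comm-* (suc n) Tx _) refl)) ⟩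
    r * (suc n × (Tx * S (suc n)) + E) ≈⟨ distribˡ _ _ _ ⟩
    r * (suc n × (Tx * S (suc n))) + r * E ≈⟨ +-congʳ (κ-cancel n _) ⟩
    Tx * S (suc n) + r * E ≈⟨ +-congʳ (*-congˡ (trans (S-expansion (suc n)) (+-congʳ (β-zero (F (suc n)))))) ⟩
    Tx * (DY (F (suc n)) + S-sum R (tail β) F n) + r * E
      ≈⟨ trans (+-congʳ (distribˡ _ _ _)) (+-assoc _ _ _) ⟩
    Tx * DY (F (suc n)) + kernel n ∎
    where
    r = κ (reciprocal (suc n))
    E = ((λ i → DX (F (suc i))) ⊛ (λ j → j × S j)) n

  DY-F : ∀ n → DY (F (suc n)) ≈ Ty * DX (F (suc n)) + σ (kernel n)
  DY-F n = begin
    DY f ≈⟨ DY.d-cong (F-symmetric (suc n)) ⟨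
    DY (σ f) ≈⟨ σ-DX f ⟨
    σ (DX f) ≈⟨ σ.h-cong (DX-F n) ⟩
    σ (Tx * DY f + kernel n) ≈⟨ trans (σ.h-+ _ _) (+-congʳ (σ.h-* _ _)) ⟩
    σ Tx * σ (DY f) + σ (kernel n) ≈⟨ +-congʳ (*-cong σ-Tx (trans (σ-DY f) (DX.d-cong (F-symmetric (suc n))))) ⟩
    Ty * DX f + σ (kernel n) ∎
    where f = F (suc n)

  DY-F-solved : ∀ n → DY (F (suc n)) ≈ I * (Ty * kernel n + σ (kernel n))
  DY-F-solved n = trans (I-unique (trans (DY-F n) (trans (+-congʳ (*-congˡ (DX-F n)))
    (solve 5 (λ x y d k s → y :* (x :* d :+ k) :+ s := (y :* k :+ s) :+ x :* y :* d) refl Tx Ty (DY (F (suc n))) (kernel n) (σ (kernel n))))))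
    (*-comm _ I)

  S-sum-closed : ∀ {P : Carrier → Set} → (∀ {x y} → P x → P y → P (x + y)) → ∀ g f m →
    (∀ i j → i ℕ.+ j ≡ m → P (g i (f j))) → P (S-sum R g f m)
  S-sum-closed P-+ g f zero    h = h 0 0 ≡.refl
  S-sum-closed {P} P-+ g f (suc m) h = P-+ (h 0 (suc m) ≡.refl) (S-sum-closed {P} P-+ (tail g) f m (λ i j e → h (suc i) j (≡.cong suc e)))

  *S-sum-closed : ∀ {P : Carrier → Set} → (∀ {x y} → P x → P y → P (x + y)) → (∀ {x y} → x ≈ y → P x → P y) → ∀ t g f m →
    (∀ i j → i ℕ.+ j ≡ m → P (t * g i (f j))) → P (t * S-sum R g f m)
  *S-sum-closed P-+ P-≈ t g f zero    h = h 0 0 ≡.refl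
  *S-sum-closed {P} P-+ P-≈ t g f (suc m) h = P-≈ (sym (distribˡ _ _ _))
    (P-+ (h 0 (suc m) ≡.refl) (*S-sum-closed {P} P-+ P-≈ t (tail g) f m (λ i j e → h (suc i) j (≡.cong suc e))))

  -- Bounds for the derivatives and for the series F k

  open Closure R using (⊛-closed)

  triple : ℕ → ℕ
  triple n = n ℕ.+ (n ℕ.+ n)

  -- With k = n + 1, the pole order is 3k - 1 and i - j lies between -k and k - 1. The two lower
  -- bounds 2 yield the factor w² of the theorem.
  Bounded : ℕ → Set
  Bounded n = Span 2 2 n (suc n) (2 ℕ.+ triple n) (DY (F (suc n)))

  Bounded-DX : ∀ {n} → Bounded n → Span 2 2 (suc n) n (2 ℕ.+ triple n) (DX (F (suc n)))
  Bounded-DX {n} s = resp (trans (σ-DY (F (suc n))) (DX.d-cong (F-symmetric (suc n)))) (Span-σ s)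

  private
    right≤ : ∀ {i j n} → i ℕ.+ j ≡ n → j ≤ n
    right≤ {i} e = ℕP.m+n≤o⇒n≤o i (ℕP.≤-reflexive e)

  Span-S : ∀ n → (∀ j → j ≤ n → Bounded j) → Span 0 0 n (suc n) (2 ℕ.+ triple n) (S (suc n))
  Span-S n IH = resp (sym (S-expansion (suc n))) (S-sum-closed {Span 0 0 n (suc n) (2 ℕ.+ triple n)} add β F (suc n) term)
    where
    term : ∀ i j → i ℕ.+ j ≡ suc n → Span 0 0 n (suc n) (2 ℕ.+ triple n) (β i (F j))
    term zero    zero    ()
    term (suc i) zero    e with ≡.trans (≡.sym (ℕP.+-identityʳ i)) (ℕP.suc-injective e)
    ... | ≡.refl = weaken z≤n z≤n z≤n ℕP.≤-refl (s≤s (ℕP.≤-trans (ℕP.m≤n+m (i ℕ.+ i) i) (ℕP.n≤1+n _))) (Span-β-F₀ i)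
    term i       (suc j) e = weaken z≤n z≤n (right≤ {i} e′) (ℕP.≤-reflexive e)
      (bound i j n e′) (Span-β (IH j (right≤ {i} e′)) i)
      where
      e′ : i ℕ.+ j ≡ n
      e′ = ℕP.suc-injective (≡.trans (≡.sym (ℕP.+-suc i j)) e)
      bound : ∀ i j n → i ℕ.+ j ≡ n → i ℕ.+ i ℕ.+ (2 ℕ.+ triple j) ≤ 2 ℕ.+ triple n
      bound i j _ ≡.refl = ℕP.≤-trans (ℕP.m≤m+n _ i) (ℕP.≤-reflexive (arith i j))
        where
        arith : ∀ i j → i ℕ.+ i ℕ.+ (2 ℕ.+ (j ℕ.+ (j ℕ.+ j))) ℕ.+ i ≡ 2 ℕ.+ (i ℕ.+ j ℕ.+ (i ℕ.+ j ℕ.+ (i ℕ.+ j)))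
        arith = solve-∀

  -- The factor Tx in front of β (i + 1) brings γ down from n + 1 to n, so that the kernel and its
  -- mirror image have the same bounds. For the products the orders fit exactly: (2 + 3i) + (2 + 3j)
  -- = 1 + 3(i + j + 1).
  Span-kernel : ∀ n → (∀ j → j ℕ.< n → Bounded j) → Span 2 2 n n (1 ℕ.+ triple n) (kernel n)
  Span-kernel n IH = add
    (*S-sum-closed {Span 2 2 n n (1 ℕ.+ triple n)} add resp Tx (tail β) F n term)
    (Span-κ _ (⊛-closed {Span 2 2 n n (1 ℕ.+ triple n)} add (λ i → DX (F (suc i))) (λ j → j × S j) n term′))
    where
    term : ∀ i j → i ℕ.+ j ≡ n → Span 2 2 n n (1 ℕ.+ triple n) (Tx * β (suc i) (F j))
    term i zero    e with ≡.trans (≡.sym (ℕP.+-identityʳ i)) e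
    ... | ≡.refl = weaken ℕP.≤-refl ℕP.≤-refl z≤n ℕP.≤-refl (s≤s (ℕP.m≤n+m (i ℕ.+ i) i)) (Span-Tx-β-F₀ i)
    term i (suc j) ≡.refl = weaken (ℕP.n≤1+n 2) ℕP.≤-refl (ℕP.m≤n+m (suc j) i) ℕP.≤-refl (ℕP.≤-trans (ℕP.m≤m+n _ i) (ℕP.≤-reflexive (arith i j)))
      (Span-Tx* (Span-β (IH j (ℕP.m≤n+m (suc j) i)) (suc i)))
      where
      arith : ∀ i j → suc i ℕ.+ suc i ℕ.+ (2 ℕ.+ (j ℕ.+ (j ℕ.+ j))) ℕ.+ i ≡ 1 ℕ.+ (i ℕ.+ suc j ℕ.+ (i ℕ.+ suc j ℕ.+ (i ℕ.+ suc j)))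
      arith = solve-∀
    term′ : ∀ i j → i ℕ.+ j ≡ n → Span 2 2 n n (1 ℕ.+ triple n) (DX (F (suc i)) * (j × S j))
    term′ i zero    e = resp (sym (zeroʳ _)) none
    term′ i (suc j) ≡.refl = weaken ℕP.≤-refl ℕP.≤-refl (ℕP.≤-reflexive (≡.sym (ℕP.+-suc i j))) ℕP.≤-refl (ℕP.≤-reflexive (arith i j))
      (Span-* (Bounded-DX {i} (IH i (ℕP.m<m+n i (s≤s z≤n))))
        (Span-× (suc j) (Span-S j (λ l l≤j → IH l (ℕP.≤-trans (s≤s l≤j) (ℕP.m≤n+m (suc j) i))))))
      where
      arith : ∀ i j → 2 ℕ.+ (i ℕ.+ (i ℕ.+ i)) ℕ.+ (2 ℕ.+ (j ℕ.+ (j ℕ.+ j))) ≡ 1 ℕ.+ (i ℕ.+ suc j ℕ.+ (i ℕ.+ suc j ℕ.+ (i ℕ.+ suc j)))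
      arith = solve-∀

  bounded-step : ∀ n → Span 2 2 n n (1 ℕ.+ triple n) (kernel n) → Bounded n
  bounded-step n s = resp (sym (DY-F-solved n)) (Span-I* (add
    (weaken ℕP.≤-refl (ℕP.n≤1+n 2) ℕP.≤-refl ℕP.≤-refl ℕP.≤-refl (Span-* Span-Ty s))
    (weaken ℕP.≤-refl ℕP.≤-refl ℕP.≤-refl (ℕP.n≤1+n n) ℕP.≤-refl (Span-σ s))))

  bounded-below : ∀ n j → j ℕ.< n → Bounded j
  bounded-below (suc n) j (s≤s j≤n) = bounded-step j (Span-kernel j (λ l l<j → bounded-below n l (ℕP.≤-trans l<j j≤n)))

  bounded : ∀ n → Bounded n
  bounded n = bounded-below (suc n) n ℕP.≤-refl

  kernel-bounded : ∀ n → Span 2 2 n n (1 ℕ.+ triple n) (kernel n)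
  kernel-bounded n = Span-kernel n (λ j _ → bounded j)

  -- The end terms of the sum of DX Fᵢ · DY Fⱼ are Tx DY F₂ and Ty DX F₂, and by `DX-F` and `DY-F`
  -- they add up to DX F₂ + DY F₂ minus the kernel and its mirror image. So the derivatives of F₂
  -- cancel.
  betti-solved : ∀ n → let F₁ = F (suc n); F₂ = F (suc (suc n)) in
    suc n × F₂ + (kernel (suc n) + σ (kernel (suc n)) + (n × F₁ + DX F₁ + DY F₁)) ≈
    DX (DY F₁) + ((λ i → DX (F (suc i))) ⊛ (λ j → DY (F (suc j)))) n
  betti-solved n = ∙-cancelʳ (F₂ + F₁ + Tx * DY F₂ + Ty * DX F₂) _ _ (begin
    suc n × F₂ + (k + s + (n × F₁ + DX F₁ + DY F₁)) + (F₂ + F₁ + Tx * DY F₂ + Ty * DX F₂)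
      ≈⟨ solve 10 (λ nf₂ k s nf₁ x₁ y₁ f₂ f₁ tp tq → nf₂ :+ (k :+ s :+ (nf₁ :+ x₁ :+ y₁)) :+ (f₂ :+ f₁ :+ tp :+ tq) := f₂ :+ nf₂ :+ (tp :+ k) :+ (tq :+ s) :+ (f₁ :+ nf₁ :+ x₁ :+ y₁))
           refl (suc n × F₂) k s (n × F₁) (DX F₁) (DY F₁) F₂ F₁ (Tx * DY F₂) (Ty * DX F₂) ⟩
    suc (suc n) × F₂ + (Tx * DY F₂ + k) + (Ty * DX F₂ + s) + (suc n × F₁ + DX F₁ + DY F₁)
      ≈⟨ +-congʳ (+-cong (+-congˡ (DX-F (suc n))) (DY-F (suc n))) ⟨
    suc (suc n) × F₂ + DX F₂ + DY F₂ + (suc n × F₁ + DX F₁ + DY F₁)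
      ≈⟨ betti-equation (suc n) ⟩
    F₂ + F₁ + (DX (DY F₁) + (Tx * DY F₂ + ((λ i → DX (F (suc i))) ⊛ (λ j → DY (F j))) (suc n)))
      ≈⟨ +-congˡ (+-congˡ (+-congˡ (⊛-step (λ i → DX (F (suc i))) (λ j → DY (F j)) n))) ⟩
    F₂ + F₁ + (DX (DY F₁) + (Tx * DY F₂ + (DX F₂ * Ty + E)))
      ≈⟨ solve 7 (λ f₂ f₁ d tp q y e → f₂ :+ f₁ :+ (d :+ (tp :+ (q :* y :+ e))) := d :+ e :+ (f₂ :+ f₁ :+ tp :+ y :* q))
           refl F₂ F₁ (DX (DY F₁)) (Tx * DY F₂) (DX F₂) Ty E ⟩
    DX (DY F₁) + E + (F₂ + F₁ + Tx * DY F₂ + Ty * DX F₂) ∎)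
    where
    F₁ = F (suc n)
    F₂ = F (suc (suc n))
    k = kernel (suc n)
    s = σ k
    E = ((λ i → DX (F (suc i))) ⊛ (λ j → DY (F (suc j)))) n

  -- The order 1 + 3(n + 1) is that of the second derivative DX (DY F₁), namely 2 + (2 + 3n); the
  -- kernel and the products of first derivatives have the same bound.
  F-bounded : ∀ n → Span 2 2 (suc n) (suc n) (1 ℕ.+ triple (suc n)) (F (suc (suc n)))
  F-bounded n = Span-÷ n (Span-minus (betti-solved n)
    (add (weaken ℕP.≤-refl ℕP.≤-refl ℕP.≤-refl ℕP.≤-refl (ℕP.≤-reflexive (four n)) (Span-DX (bounded n)))
         (⊛-closed {Span 2 2 (suc n) (suc n) (1 ℕ.+ triple (suc n))} add (λ i → DX (F (suc i))) (λ j → DY (F (suc j))) n term))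
    (add (add (kernel-bounded (suc n)) (Span-σ (kernel-bounded (suc n))))
         (add (add (previous n)
           (weaken ℕP.≤-refl ℕP.≤-refl ℕP.≤-refl (ℕP.n≤1+n n) two (Bounded-DX {n} (bounded n))))
           (weaken ℕP.≤-refl ℕP.≤-refl (ℕP.n≤1+n n) ℕP.≤-refl two (bounded n)))))
    where
    four : ∀ n → 2 ℕ.+ (2 ℕ.+ (n ℕ.+ (n ℕ.+ n))) ≡ 1 ℕ.+ (suc n ℕ.+ (suc n ℕ.+ suc n))
    four = solve-∀
    two : 2 ℕ.+ triple n ≤ 1 ℕ.+ triple (suc n)
    two = ℕP.≤-trans (ℕP.m≤n+m (2 ℕ.+ triple n) 2) (ℕP.≤-reflexive (four n))
    term : ∀ i j → i ℕ.+ j ≡ n → Span 2 2 (suc n) (suc n) (1 ℕ.+ triple (suc n)) (DX (F (suc i)) * DY (F (suc j)))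
    term i j ≡.refl = weaken (ℕP.m≤n+m 2 2) (ℕP.m≤n+m 2 2) ℕP.≤-refl (ℕP.≤-reflexive (ℕP.+-suc i j)) (ℕP.≤-reflexive (arith i j))
      (Span-* (Bounded-DX {i} (bounded i)) (bounded j))
      where
      arith : ∀ i j → 2 ℕ.+ (i ℕ.+ (i ℕ.+ i)) ℕ.+ (2 ℕ.+ (j ℕ.+ (j ℕ.+ j))) ≡ 1 ℕ.+ (suc (i ℕ.+ j) ℕ.+ (suc (i ℕ.+ j) ℕ.+ suc (i ℕ.+ j)))
      arith = solve-∀
    -- the coefficient k - 2 of F (k - 1) in the recursion vanishes for k = 2, where F 1 is not in the span
    previous : ∀ n → Span 2 2 (suc n) (suc n) (1 ℕ.+ triple (suc n)) (n × F (suc n))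
    previous zero    = none
    previous (suc n) = Span-× (suc n) (weaken ℕP.≤-refl ℕP.≤-refl (ℕP.n≤1+n _) (ℕP.n≤1+n _)
      (ℕP.+-monoʳ-≤ 1 (ℕP.+-mono-≤ (ℕP.n≤1+n (suc n)) (ℕP.+-mono-≤ (ℕP.n≤1+n (suc n)) (ℕP.n≤1+n (suc n))))) (F-bounded n))

  -- X = L f for the derivation L = (1 - Ty) DX + (1 - Tx) DY, under which Tx and Ty are eigenvectors.
  _isL_ : Carrier → Carrier → Set
  X isL f = DX f + DY f ≈ Ty * DX f + Tx * DY f + X

  DX-Tx-log : DX Tx ≈ I * Tx
  DX-Tx-log = begin
    DX Tx ≈⟨ DX.d-cong σ-Ty ⟨
    DX (σ Ty) ≈⟨ σ-DY Ty ⟨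
    σ (DY Ty) ≈⟨ σ.h-cong DY-Ty-log ⟩
    σ (I * Ty) ≈⟨ σ.h-* I Ty ⟩
    σ I * σ Ty ≈⟨ *-cong σ-I σ-Ty ⟩
    I * Tx ∎

  DX-Ty-log : DX Ty ≈ Tx * I * Ty
  DX-Ty-log = begin
    DX Ty ≈⟨ DX.d-cong σ-Tx ⟨
    DX (σ Tx) ≈⟨ σ-DY Tx ⟨
    σ (DY Tx) ≈⟨ σ.h-cong DY-Tx-log ⟩
    σ (Ty * I * Tx) ≈⟨ trans (σ.h-* _ _) (*-congʳ (σ.h-* Ty I)) ⟩
    σ Ty * σ I * σ Tx ≈⟨ *-cong (*-cong σ-Ty σ-I) σ-Tx ⟩
    Tx * I * Ty ∎

  DX-I : DX I ≈ W * (1# + Tx) * (I * I) * I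
  DX-I = begin
    DX I ≈⟨ DX.d-cong σ-I ⟨
    DX (σ I) ≈⟨ σ-DY I ⟨
    σ (DY I) ≈⟨ σ.h-cong DY-I ⟩
    σ (W * (1# + Ty) * (I * I) * I) ≈⟨ trans (σ.h-* _ _) (*-cong (trans (σ.h-* _ _) (*-cong (σ.h-* _ _) (σ.h-* I I))) σ-I) ⟩
    σ W * σ (1# + Ty) * (σ I * σ I) * I ≈⟨ *-congʳ (*-cong (*-cong σ-W (trans (σ.h-+ 1# Ty) (+-cong σ-1 σ-Ty))) (*-cong σ-I σ-I)) ⟩
    W * (1# + Tx) * (I * I) * I ∎

  -- L Tx = Tx and L Ty = Ty, hence L W = 2 W and L I = 2 W I². Written without subtraction, this is
  -- an identity over semirings.
  monomial-isL : ∀ c i j q → let m = monomial c i j q in ((i ℕ.+ j) × m + q × (2 × (W * (I * m)))) isL m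
  monomial-isL c i j q = begin
    DX m + DY m
      ≈⟨ +-cong DXm DYm ⟩
    (i̲ * (I * m) + j̲ * (Tx * I * m) + q̲ * (W * (1# + Tx) * (I * I) * m))
      + (i̲ * (Ty * I * m) + j̲ * (I * m) + q̲ * (W * (1# + Ty) * (I * I) * m))
      ≈⟨ solve 7 (λ x y i m a b e → let w = x :* y in
           (a :* (i :* m) :+ b :* (x :* i :* m) :+ e :* (w :* (con 1 :+ x) :* (i :* i) :* m)) :+ (a :* (y :* i :* m) :+ b :* (i :* m) :+ e :* (w :* (con 1 :+ y) :* (i :* i) :* m))
           := i :* ((a :+ b :+ con 2 :* e :* w :* i) :* m) :+ (a :* y :+ b :* x :+ e :* w :* (x :+ y) :* i) :* i :* m) refl Tx Ty I m i̲ j̲ q̲ ⟩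
    I * ((i̲ + j̲ + (1# + 1#) * q̲ * W * I) * m) + (i̲ * Ty + j̲ * Tx + q̲ * W * (Tx + Ty) * I) * I * m
      -- Once this single I is expanded by I = 1 + W I, both sides agree as polynomials in Tx, Ty
      -- and I.
      ≈⟨ +-congʳ (*-congʳ I-inverse) ⟩
    (1# + W * I) * ((i̲ + j̲ + (1# + 1#) * q̲ * W * I) * m) + (i̲ * Ty + j̲ * Tx + q̲ * W * (Tx + Ty) * I) * I * m
      ≈⟨ solve 7 (λ x y i m a b e → let w = x :* y in
           (con 1 :+ w :* i) :* ((a :+ b :+ con 2 :* e :* w :* i) :* m) :+ (a :* y :+ b :* x :+ e :* w :* (x :+ y) :* i) :* i :* m
           := y :* (a :* (i :* m) :+ b :* (x :* i :* m) :+ e :* (w :* (con 1 :+ x) :* (i :* i) :* m)) :+ x :* (a :* (y :* i :* m) :+ b :* (i :* m) :+ e :* (w :* (con 1 :+ y) :* (i :* i) :* m))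
              :+ ((a :+ b) :* m :+ e :* (con 2 :* (w :* (i :* m))))) refl Tx Ty I m i̲ j̲ q̲ ⟩
    Ty * (i̲ * (I * m) + j̲ * (Tx * I * m) + q̲ * (W * (1# + Tx) * (I * I) * m))
      + Tx * (i̲ * (Ty * I * m) + j̲ * (I * m) + q̲ * (W * (1# + Ty) * (I * I) * m))
      + ((i̲ + j̲) * m + q̲ * ((1# + 1#) * (W * (I * m))))
      ≈⟨ +-cong (+-cong (*-congˡ DXm) (*-congˡ DYm)) (+-cong
           (trans (num (i ℕ.+ j) m) (*-congʳ (×-homo-+ 1# i j)))
           (trans (×-congʳ q (twice (W * (I * m)))) (num q ((1# + 1#) * (W * (I * m)))))) ⟨
    Ty * DX m + Tx * DY m + ((i ℕ.+ j) × m + q × (2 × (W * (I * m)))) ∎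
    where
    m = monomial c i j q
    i̲ = i × 1#
    j̲ = j × 1#
    q̲ = q × 1#
    num : ∀ n x → n × x ≈ (n × 1#) * x
    num n x = sym (trans (×-assoc-* n 1# x) (×-congʳ n (*-identityˡ x)))
    twice : ∀ x → 2 × x ≈ (1# + 1#) * x
    twice x = solve 1 (λ x → x :+ (x :+ con 0) := con 2 :* x) refl x
    DXm : DX m ≈ i̲ * (I * m) + j̲ * (Tx * I * m) + q̲ * (W * (1# + Tx) * (I * I) * m)
    DXm = trans (derivation-monomial DX-isDerivation DX-κ DX-Tx-log DX-Ty-log DX-I c i j q)
      (+-cong (+-cong (num i _) (num j _)) (num q _))
    DYm : DY m ≈ i̲ * (Ty * I * m) + j̲ * (I * m) + q̲ * (W * (1# + Ty) * (I * I) * m)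
    DYm = trans (derivation-monomial DY-isDerivation DY-κ DY-Tx-log DY-Ty-log DY-I c i j q)
      (+-cong (+-cong (num i _) (num j _)) (num q _))

  isL-cong : ∀ {f g X Y} → f ≈ g → X ≈ Y → X isL f → Y isL g
  isL-cong f≈g X≈Y l = trans (+-cong (DX.d-cong (sym f≈g)) (DY.d-cong (sym f≈g)))
    (trans l (+-cong (+-cong (*-congˡ (DX.d-cong f≈g)) (*-congˡ (DY.d-cong f≈g))) X≈Y))

  isL-unique : ∀ {f X Y} → X isL f → Y isL f → X ≈ Y
  isL-unique l l′ = ∙-cancelˡ _ _ _ (trans (sym l) l′)

  isL-0 : 0# isL 0#
  isL-0 = trans (+-cong DX.d-0 DY.d-0) (sym (trans (+-congʳ (+-cong (trans (*-congˡ DX.d-0) (zeroʳ _)) (trans (*-congˡ DY.d-0) (zeroʳ _))))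
    (+-congʳ (+-identityˡ 0#))))

  isL-+ : ∀ {f g X Y} → X isL f → Y isL g → (X + Y) isL (f + g)
  isL-+ {f} {g} {X} {Y} l l′ = begin
    DX (f + g) + DY (f + g) ≈⟨ +-cong (DX.d-+ f g) (DY.d-+ f g) ⟩
    DX f + DX g + (DY f + DY g) ≈⟨ solve 4 (λ a b c d → a :+ b :+ (c :+ d) := (a :+ c) :+ (b :+ d)) refl (DX f) (DX g) (DY f) (DY g) ⟩
    (DX f + DY f) + (DX g + DY g) ≈⟨ +-cong l l′ ⟩
    Ty * DX f + Tx * DY f + X + (Ty * DX g + Tx * DY g + Y)
      ≈⟨ solve 8 (λ x y a b c d e h → y :* a :+ x :* c :+ e :+ (y :* b :+ x :* d :+ h) := y :* (a :+ b) :+ x :* (c :+ d) :+ (e :+ h))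
           refl Tx Ty (DX f) (DX g) (DY f) (DY g) X Y ⟩
    Ty * (DX f + DX g) + Tx * (DY f + DY g) + (X + Y)
      ≈⟨ +-congʳ (+-cong (*-congˡ (DX.d-+ f g)) (*-congˡ (DY.d-+ f g))) ⟨
    Ty * DX (f + g) + Tx * DY (f + g) + (X + Y) ∎

  -- L raises the pole order of the leading part only: L (I^q m) = 2 q W I^(q+1) m + ...
  leading-part : ∀ {a b α γ p f} → Span a b α γ (suc p) f →
    ∃₂ λ X Y → X isL f ∧ Span a b α γ (suc p) Y ∧ X + Y ≈ suc p × (2 × (W * (I * f)))
  leading-part {a} {b} {α} {γ} {p} s@(mono c i j q A B C D q≤) =
    (i ℕ.+ j) × m + q × z , rest × z + - ((i ℕ.+ j) × m) , monomial-isL c i j q ,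
    add (span-rest rest ≡.refl) (Span-neg (Span-× (i ℕ.+ j) s)) , (begin
      (i ℕ.+ j) × m + q × z + (rest × z + - ((i ℕ.+ j) × m))
        ≈⟨ solve 4 (λ a b c d → a :+ b :+ (c :+ d) := (a :+ d) :+ (b :+ c)) refl ((i ℕ.+ j) × m) (q × z) (rest × z) (- ((i ℕ.+ j) × m)) ⟩
      ((i ℕ.+ j) × m + - ((i ℕ.+ j) × m)) + (q × z + rest × z)
        ≈⟨ +-cong (-‿inverseʳ _) (sym (×-homo-+ z q rest)) ⟩
      0# + (q ℕ.+ rest) × z
        ≈⟨ trans (+-identityˡ _) (×-congˡ (ℕP.m+[n∸m]≡n q≤)) ⟩
      suc p × z ∎)
    where
    m = monomial c i j q
    z = 2 × (W * (I * m))
    rest = suc p ∸ q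
    -- z has order q + 1, which exceeds the bound only for q = p + 1, and then its multiplier `rest`
    -- is 0.
    span-rest : ∀ t → t ≡ rest → Span a b α γ (suc p) (t × z)
    span-rest zero    e = none
    span-rest (suc t) e = Span-× (suc t) (Span-× 2 (weaken (ℕP.n≤1+n a) (ℕP.n≤1+n b) ℕP.≤-refl ℕP.≤-refl ℕP.≤-refl
      (Span-* Span-W (Span-I* (mono c i j q A B C D (ℕP.≤-pred q<))))))
      where
      q< : q ℕ.< suc p
      q< = ℕP.≰⇒> (λ le → ℕP.1+n≢0 (≡.trans e (ℕP.m≤n⇒m∸n≡0 le)))
  leading-part {p = p} none = 0# , 0# , isL-0 , none , (begin
    0# + 0# ≈⟨ trans (+-identityˡ 0#) (sym (×-zeroʳ (suc p))) ⟩
    suc p × 0# ≈⟨ ×-congʳ (suc p) (×-zeroʳ 2) ⟨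
    suc p × (2 × 0#) ≈⟨ ×-congʳ (suc p) (×-congʳ 2 (trans (*-congˡ (zeroʳ I)) (zeroʳ W))) ⟨
    suc p × (2 × (W * (I * 0#))) ∎)
    where open Euler R using (×-zeroʳ)
  leading-part {p = p} (add {f} {g} s t) with leading-part s | leading-part t
  ... | X , Y , l , y , e | X′ , Y′ , l′ , y′ , e′ = X + X′ , Y + Y′ , isL-+ l l′ , add y y′ , (begin
    X + X′ + (Y + Y′) ≈⟨ solve 4 (λ a b c d → a :+ b :+ (c :+ d) := (a :+ c) :+ (b :+ d)) refl X X′ Y Y′ ⟩
    X + Y + (X′ + Y′) ≈⟨ +-cong e e′ ⟩
    suc p × (2 × (W * (I * f))) + suc p × (2 × (W * (I * g)))
      ≈⟨ ×-distrib-+ (2 × (W * (I * f))) (2 × (W * (I * g))) (suc p) ⟨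
    suc p × (2 × (W * (I * f)) + 2 × (W * (I * g)))
      ≈⟨ ×-congʳ (suc p) (solve 4 (λ w i f g → (w :* (i :* f)) :+ (w :* (i :* f) :+ con 0) :+ (w :* (i :* g) :+ (w :* (i :* g) :+ con 0)) := (w :* (i :* (f :+ g)) :+ (w :* (i :* (f :+ g)) :+ con 0))) refl W I f g) ⟩
    suc p × (2 × (W * (I * (f + g)))) ∎)
    where open CMult +-commutativeMonoid using (×-distrib-+)
  leading-part {p = p} (resp e s) with leading-part s
  ... | X , Y , l , y , e′ = X , Y , isL-cong e refl l , y , trans e′ (×-congʳ (suc p) (×-congʳ 2 (*-congˡ (*-congˡ e))))

  -- (1 - W) I = 1 lowers the exponent of I by one. If that exponent is 0, multiplication by 1 - W
  -- creates no pole, which the bound p allows.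
  Span-1-W : ∀ {a b α γ p f} → Span a b α γ (suc p) f → Span a b α γ p (f + - (W * f))
  Span-1-W {a} {b} {p = p} (mono c i j zero A B C D _) = add m (Span-neg
    (weaken (ℕP.n≤1+n a) (ℕP.n≤1+n b) ℕP.≤-refl ℕP.≤-refl ℕP.≤-refl (Span-* Span-W m)))
    where m = mono c i j zero A B C D z≤n
  Span-1-W (mono c i j (suc q) A B C D (s≤s q≤p)) = resp (∙-cancelʳ (W * m′) _ _ (begin
      m + W * m′ ≈⟨ +-congˡ (*-congˡ power) ⟩
      m + W * (I * m) ≈⟨ solve 3 (λ w i m → m :+ w :* (i :* m) := (con 1 :+ w :* i) :* m) refl W I m ⟩
      (1# + W * I) * m ≈⟨ *-congʳ I-inverse ⟨
      I * m ≈⟨ power ⟨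
      m′ ≈⟨ +-identityʳ m′ ⟨
      m′ + 0# ≈⟨ +-congˡ (-‿inverseˡ (W * m′)) ⟨
      m′ + (- (W * m′) + W * m′) ≈⟨ +-assoc _ _ _ ⟨
      m′ + - (W * m′) + W * m′ ∎))
    (mono c i j q A B C D q≤p)
    where
    m = monomial c i j q
    m′ = monomial c i j (suc q)
    power : m′ ≈ I * m
    power = solve 5 (λ k x y i z → k :* (x :* y :* (i :* z)) := i :* (k :* (x :* y :* z))) refl (κ c) (Tx ^ i) (Ty ^ j) I (I ^ q)
  Span-1-W none = resp (trans (sym (-‿inverseʳ 0#)) (+-congˡ (-‿cong (sym (zeroʳ W))))) none
  Span-1-W (add {x} {y} s t) = resp (trans
      (solve 4 (λ a b c d → (a :+ b) :+ (c :+ d) := (a :+ c) :+ (b :+ d)) refl x (- (W * x)) y (- (W * y)))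
      (+-congˡ (trans (⁻¹-∙-comm (W * x) (W * y)) (-‿cong (sym (distribˡ W x y))))))
    (add (Span-1-W s) (Span-1-W t))
    where open AbelianGroupProperties +-abelianGroup using (⁻¹-∙-comm)
  Span-1-W (resp e s) = resp (+-cong e (-‿cong (*-congˡ e))) (Span-1-W s)

  -- By `leading-part`, L f + Y = 2 (p + 1) W I f with L f and Y of order at most p + 1. So W I f,
  -- and with it I f = f + W I f, has order at most p + 1, and f = (1 - W) I f has order at most p.
  pole-reduction : ∀ {a b α γ p f X} → Span a b α γ (suc p) f → X isL f → Span a b α γ (suc p) X → Span a b α γ p f
  pole-reduction {a} {b} {α} {γ} {p} {f} {X} s l x with leading-part s
  ... | X′ , Y , l′ , y , e = resp (begin
      I * f + - (W * (I * f)) ≈⟨ +-congʳ If ⟩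
      f + W * (I * f) + - (W * (I * f)) ≈⟨ +-assoc _ _ _ ⟩
      f + (W * (I * f) + - (W * (I * f))) ≈⟨ +-congˡ (-‿inverseʳ _) ⟩
      f + 0# ≈⟨ +-identityʳ f ⟩
      f ∎)
    (Span-1-W (resp (sym If) (add s WIf)))
    where
    If : I * f ≈ f + W * (I * f)
    If = trans (*-congʳ I-inverse) (solve 3 (λ w i f → (con 1 :+ w :* i) :* f := f :+ w :* (i :* f)) refl W I f)
    WIf : Span a b α γ (suc p) (W * (I * f))
    WIf = Span-÷ 1 (Span-÷ p (resp (trans (+-congʳ (isL-unique l l′)) e) (add x y)))

  F-pole : ∀ n → Span 2 2 (suc n) (suc n) (triple (suc n)) (F (suc (suc n)))
  F-pole n = pole-reduction (F-bounded n)
    (begin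
      DX f + DY f ≈⟨ +-cong (DX-F (suc n)) (DY-F (suc n)) ⟩
      Tx * DY f + k + (Ty * DX f + σ k) ≈⟨ solve 4 (λ a b c d → a :+ b :+ (c :+ d) := c :+ a :+ (b :+ d)) refl (Tx * DY f) k (Ty * DX f) (σ k) ⟩
      Ty * DX f + Tx * DY f + (k + σ k) ∎)
    (add (kernel-bounded (suc n)) (Span-σ (kernel-bounded (suc n))))
    where
    f = F (suc (suc n))
    k = kernel (suc n)

module Inverses (R : Ring₀) where
  open CommutativeRing R hiding (zero)
  open Exp commutativeSemiring using (_^_; ^-distrib-*; ^-congˡ)
  open SetoidReasoning setoid
  open NatSolver commutativeSemiring using (solve; _:+_; _:*_; _:=_; con)

  inverse-fixpoint : ∀ {w i} → (1# + - w) * i ≈ 1# → i ≈ 1# + w * i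
  inverse-fixpoint {w} {i} e = begin
    i ≈⟨ +-identityʳ i ⟨
    i + 0# ≈⟨ +-congˡ (trans (*-congʳ (-‿inverseˡ w)) (zeroˡ i)) ⟨
    i + (- w + w) * i ≈⟨ solve 3 (λ i n w → i :+ (n :+ w) :* i := (con 1 :+ n) :* i :+ w :* i) refl i (- w) w ⟩
    (1# + - w) * i + w * i ≈⟨ +-congʳ e ⟩
    1# + w * i ∎

  inverse-power : ∀ {m i h} → m * i ≈ 1# → ∀ p → m ^ p * h ≈ 1# → h ≈ i ^ p
  inverse-power {m} {i} {h} e p eh = begin
    h ≈⟨ *-identityˡ h ⟨
    1# * h ≈⟨ *-congʳ (trans (sym (^-distrib-* m i p)) (trans (^-congˡ p e) (ones p))) ⟨
    m ^ p * i ^ p * h ≈⟨ solve 3 (λ m i h → m :* i :* h := i :* (m :* h)) refl (m ^ p) (i ^ p) h ⟩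
    i ^ p * (m ^ p * h) ≈⟨ *-congˡ eh ⟩
    i ^ p * 1# ≈⟨ *-identityʳ (i ^ p) ⟩
    i ^ p ∎
    where
    ones : ∀ p → 1# ^ p ≈ 1#
    ones zero    = refl
    ones (suc p) = trans (*-identityˡ _) (ones p)

-- Symmetric expressions as polynomials in Z and W

module ZSpans (R : Ring₀) (setting : Setting R) where
  open CommutativeRing R hiding (zero)
  open SemiringMult semiring using (_×_)
  open Exp commutativeSemiring using (_^_; ^-homo-*)
  open Setting setting
  open SetoidReasoning setoid
  open NatSolver commutativeSemiring using (solve; _:+_; _:*_; _:=_; con)
  open Spans R setting
  open GroupProperties +-group using (∙-cancelˡ)

  Z : Carrier
  Z = Tx + Ty

  data ZSpan (n : ℕ) : Carrier → Set where
    mono : ∀ c i j → i ≤ n → ZSpan n (κ c * (W ^ j * Z ^ i))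
    none : ZSpan n 0#
    add  : ∀ {x y} → ZSpan n x → ZSpan n y → ZSpan n (x + y)
    resp : ∀ {x y} → x ≈ y → ZSpan n x → ZSpan n y

  ZSpan-weaken : ∀ {n m x} → n ≤ m → ZSpan n x → ZSpan m x
  ZSpan-weaken n≤m (mono c i j i≤n) = mono c i j (ℕP.≤-trans i≤n n≤m)
  ZSpan-weaken n≤m none       = none
  ZSpan-weaken n≤m (add x y)  = add (ZSpan-weaken n≤m x) (ZSpan-weaken n≤m y)
  ZSpan-weaken n≤m (resp e x) = resp e (ZSpan-weaken n≤m x)

  ZSpan-κ : ∀ {n x} c → ZSpan n x → ZSpan n (κ c * x)
  ZSpan-κ c (mono c′ i j i≤n) = resp (trans (*-congʳ (sym (κ-* c c′))) (*-assoc _ _ _)) (mono (c ℚ.* c′) i j i≤n)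
  ZSpan-κ c none       = resp (sym (zeroʳ _)) none
  ZSpan-κ c (add x y)  = resp (sym (distribˡ _ _ _)) (add (ZSpan-κ c x) (ZSpan-κ c y))
  ZSpan-κ c (resp e x) = resp (*-congˡ e) (ZSpan-κ c x)

  ZSpan-neg : ∀ {n x} → ZSpan n x → ZSpan n (- x)
  ZSpan-neg {x = x} s = resp (-1*-κ x) (ZSpan-κ (ℚ.- 1ℚ) s)

  ZSpan-W* : ∀ {n x} → ZSpan n x → ZSpan n (W * x)
  ZSpan-W* (mono c i j i≤n) = resp (solve 4 (λ k w x y → k :* (w :* x :* y) := w :* (k :* (x :* y))) refl (κ c) W (W ^ j) (Z ^ i)) (mono c i (suc j) i≤n)
  ZSpan-W* none       = resp (sym (zeroʳ _)) none
  ZSpan-W* (add x y)  = resp (sym (distribˡ _ _ _)) (add (ZSpan-W* x) (ZSpan-W* y))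
  ZSpan-W* (resp e x) = resp (*-congˡ e) (ZSpan-W* x)

  ZSpan-Z* : ∀ {n x} → ZSpan n x → ZSpan (suc n) (Z * x)
  ZSpan-Z* (mono c i j i≤n) = resp (solve 4 (λ k w x y → k :* (x :* (w :* y)) := w :* (k :* (x :* y))) refl (κ c) Z (W ^ j) (Z ^ i)) (mono c (suc i) j (s≤s i≤n))
  ZSpan-Z* none       = resp (sym (zeroʳ _)) none
  ZSpan-Z* (add x y)  = resp (sym (distribˡ _ _ _)) (add (ZSpan-Z* x) (ZSpan-Z* y))
  ZSpan-Z* (resp e x) = resp (*-congˡ e) (ZSpan-Z* x)

  ZSpan-1 : ZSpan 0 1#
  ZSpan-1 = resp (trans (*-cong κ-1 (*-identityˡ 1#)) (*-identityˡ 1#)) (mono 1ℚ 0 0 z≤n)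

  -- Newton's recursion for power sums
  power-sum : ∀ t → ZSpan t (Tx ^ t + Ty ^ t)
  power-sum zero          = add ZSpan-1 ZSpan-1
  power-sum (suc zero)    = resp (solve 2 (λ x y → (x :+ y) :* con 1 := x :* con 1 :+ y :* con 1) refl Tx Ty) (ZSpan-Z* ZSpan-1)
  power-sum (suc (suc t)) = resp (begin
      Z * h₁ + - (W * h₀) ≈⟨ +-congʳ (solve 4 (λ x y p q → (x :+ y) :* (x :* p :+ y :* q) := x :* (x :* p) :+ y :* (y :* q) :+ x :* y :* (p :+ q)) refl Tx Ty (Tx ^ t) (Ty ^ t)) ⟩
      h₂ + W * h₀ + - (W * h₀) ≈⟨ +-assoc _ _ _ ⟩
      h₂ + (W * h₀ + - (W * h₀)) ≈⟨ +-congˡ (-‿inverseʳ _) ⟩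
      h₂ + 0# ≈⟨ +-identityʳ _ ⟩
      h₂ ∎)
    (add (ZSpan-Z* (power-sum (suc t))) (ZSpan-neg (ZSpan-weaken (ℕP.m≤n+m t 2) (ZSpan-W* (power-sum t)))))
    where
    h₀ = Tx ^ t + Ty ^ t
    h₁ = Tx ^ suc t + Ty ^ suc t
    h₂ = Tx ^ suc (suc t) + Ty ^ suc (suc t)

  -- Dividing out the smaller exponent as a power of W leaves the power sum of index |i - j|. This
  -- is where the bounds α and γ turn into a degree in Z.
  symmetric-monomial : ∀ {n} i j → i ≤ j ℕ.+ n → j ≤ i ℕ.+ n → ZSpan n (Tx ^ i * Ty ^ j + Tx ^ j * Ty ^ i)
  symmetric-monomial zero    j       _       p = ZSpan-weaken p (resp (solve 2 (λ x y → x :+ y := con 1 :* y :+ x :* con 1) refl (Tx ^ j) (Ty ^ j)) (power-sum j))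
  symmetric-monomial (suc i) zero    p       _ = ZSpan-weaken p (resp (solve 2 (λ x y → x :+ y := x :* con 1 :+ con 1 :* y) refl (Tx ^ suc i) (Ty ^ suc i)) (power-sum (suc i)))
  symmetric-monomial (suc i) (suc j) (s≤s p) (s≤s q) = resp
    (solve 6 (λ x y a b c d → x :* y :* (a :* b :+ c :* d) := x :* a :* (y :* b) :+ x :* c :* (y :* d)) refl Tx Ty (Tx ^ i) (Ty ^ j) (Tx ^ j) (Ty ^ i))
    (ZSpan-W* (symmetric-monomial i j p q))

  -- Q is (1 - W)^t P: fractions are brought to a common denominator without raising the degree in
  -- Z.
  cleared : ∀ {n P} t → ZSpan n P → ∃ λ Q → ZSpan n Q ∧ P ≈ I ^ t * Q
  cleared {P = P} zero    s = P , s , sym (*-identityˡ P)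
  cleared {P = P} (suc t) s with cleared t (add s (ZSpan-neg (ZSpan-W* s)))
  ... | Q , s′ , e = Q , s′ , (begin
    P ≈⟨ unit ⟨
    I * (P + - (W * P)) ≈⟨ *-congˡ e ⟩
    I * (I ^ t * Q) ≈⟨ *-assoc I (I ^ t) Q ⟨
    I ^ suc t * Q ∎)
    where
    unit : I * (P + - (W * P)) ≈ P
    unit = trans (*-comm I _) (sym (I-unique (begin
      P ≈⟨ +-identityʳ P ⟨
      P + 0# ≈⟨ +-congˡ (-‿inverseˡ (W * P)) ⟨
      P + (- (W * P) + W * P) ≈⟨ +-assoc _ _ _ ⟨
      P + - (W * P) + W * P ∎)))

  -- A symmetric f is given as a combination of monomials that need not be symmetric; adding σ f
  -- makes every term so. Both exponents are at least 2, so W² splits off, and `cleared` raises the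
  -- power of I to p.
  symmetrised : ∀ {n p f} → Span 2 2 n n p f → ∃ λ P → ZSpan n P ∧ f + σ f ≈ W * W * (I ^ p * P)
  symmetrised {n} {p} (mono c (suc (suc i)) (suc (suc j)) q _ _ (s≤s (s≤s A)) (s≤s (s≤s B)) q≤p)
    with cleared (p ∸ q) (ZSpan-κ c (symmetric-monomial i j A B))
  ... | Q , s , e = Q , s , (begin
    m + σ m
      ≈⟨ +-congˡ (σ-monomial c (2 ℕ.+ i) (2 ℕ.+ j) q) ⟩
    m + monomial c (2 ℕ.+ j) (2 ℕ.+ i) q
      ≈⟨ solve 8 (λ k x y a b c d z → k :* (x :* (x :* a) :* (y :* (y :* b)) :* z) :+ k :* (x :* (x :* c) :* (y :* (y :* d)) :* z)
           := x :* y :* (x :* y) :* (z :* (k :* (a :* b :+ c :* d)))) refl (κ c) Tx Ty (Tx ^ i) (Ty ^ j) (Tx ^ j) (Ty ^ i) (I ^ q) ⟩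
    W * W * (I ^ q * (κ c * (Tx ^ i * Ty ^ j + Tx ^ j * Ty ^ i)))
      ≈⟨ *-congˡ (*-congˡ e) ⟩
    W * W * (I ^ q * (I ^ (p ∸ q) * Q))
      ≈⟨ *-congˡ (*-assoc _ _ _) ⟨
    W * W * (I ^ q * I ^ (p ∸ q) * Q)
      ≈⟨ *-congˡ (*-congʳ (^-homo-* I q (p ∸ q))) ⟨
    W * W * (I ^ (q ℕ.+ (p ∸ q)) * Q)
      ≈⟨ *-congˡ (*-congʳ (reflexive (≡.cong (I ^_) (ℕP.m+[n∸m]≡n q≤p)))) ⟩
    W * W * (I ^ p * Q) ∎)
    where m = monomial c (2 ℕ.+ i) (2 ℕ.+ j) q
  symmetrised (mono c zero j q () _ _ _ _)
  symmetrised (mono c (suc zero) j q (s≤s ()) _ _ _ _)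
  symmetrised (mono c (suc (suc i)) zero q _ () _ _ _)
  symmetrised (mono c (suc (suc i)) (suc zero) q _ (s≤s ()) _ _ _)
  symmetrised none = 0# , none , trans (+-identityˡ _) (trans σ-0 (sym (trans (*-congˡ (zeroʳ _)) (zeroʳ _))))
  symmetrised {p = p} (add {x} {y} s t) with symmetrised s | symmetrised t
  ... | P , s′ , e | Q , t′ , e′ = P + Q , add s′ t′ , (begin
    x + y + σ (x + y) ≈⟨ +-congˡ (σ.h-+ x y) ⟩
    x + y + (σ x + σ y) ≈⟨ solve 4 (λ a b c d → (a :+ b) :+ (c :+ d) := (a :+ c) :+ (b :+ d)) refl x y (σ x) (σ y) ⟩
    x + σ x + (y + σ y) ≈⟨ +-cong e e′ ⟩
    W * W * (I ^ p * P) + W * W * (I ^ p * Q) ≈⟨ solve 4 (λ w i p q → w :* (i :* p) :+ w :* (i :* q) := w :* (i :* (p :+ q))) refl (W * W) (I ^ p) P Q ⟩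
    W * W * (I ^ p * (P + Q)) ∎)
  symmetrised (resp e s) with symmetrised s
  ... | P , s′ , e′ = P , s′ , trans (+-cong (sym e) (σ.h-cong (sym e))) e′

  halve : ∀ {n p f} → σ f ≈ f → (∃ λ P → ZSpan n P ∧ f + σ f ≈ W * W * (I ^ p * P)) →
    ∃ λ P → ZSpan n P ∧ f ≈ W * W * (I ^ p * P)
  halve {n} {p} {f} sym-f (P , s , e) = h * P , ZSpan-κ (reciprocal 2) s , (begin
    f ≈⟨ κ-cancel 1 f ⟨
    h * (2 × f) ≈⟨ *-congˡ (+-congˡ (trans (+-identityʳ f) (sym sym-f))) ⟩
    h * (f + σ f) ≈⟨ *-congˡ e ⟩
    h * (W * W * (J * P)) ≈⟨ solve 4 (λ h w j p → h :* (w :* (j :* p)) := w :* (j :* (h :* p))) refl h (W * W) J P ⟩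
    W * W * (J * (h * P)) ∎)
    where
    h = κ (reciprocal 2)
    J = I ^ p

  F-form : ∀ n → ∃ λ P → ZSpan (suc n) P ∧ F (suc (suc n)) ≈ W * W * (I ^ triple (suc n) * P)
  F-form n = halve {p = triple (suc n)} (F-symmetric (suc (suc n))) (symmetrised (F-pole n))

  -- The coefficient polynomials q

  sumᴿ : ∀ {n} → (Fin n → Carrier) → Carrier
  sumᴿ = RawMonoidDefs.sum +-rawMonoid

  evalᴿ : Polynomial → Carrier → Carrier
  evalᴿ []      w = 0#
  evalᴿ (c ∷ p) w = κ c + w * evalᴿ p w

  addᴾ : Polynomial → Polynomial → Polynomial
  addᴾ []      q       = q
  addᴾ (c ∷ p) []      = c ∷ p
  addᴾ (c ∷ p) (d ∷ q) = (c ℚ.+ d) ∷ addᴾ p q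

  evalᴿ-add : ∀ p q w → evalᴿ (addᴾ p q) w ≈ evalᴿ p w + evalᴿ q w
  evalᴿ-add []      q       w = sym (+-identityˡ (evalᴿ q w))
  evalᴿ-add (c ∷ p) []      w = sym (+-identityʳ (evalᴿ (c ∷ p) w))
  evalᴿ-add (c ∷ p) (d ∷ q) w = begin
    κ (c ℚ.+ d) + w * evalᴿ (addᴾ p q) w
      ≈⟨ +-cong (κ-+ c d) (*-congˡ {w} (evalᴿ-add p q w)) ⟩
    κ c + κ d + w * (evalᴿ p w + evalᴿ q w)
      ≈⟨ solve 5 (λ c d w p q → c :+ d :+ w :* (p :+ q) := c :+ w :* p :+ (d :+ w :* q)) refl (κ c) (κ d) w (evalᴿ p w) (evalᴿ q w) ⟩
    evalᴿ (c ∷ p) w + evalᴿ (d ∷ q) w ∎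

  monomialᴾ : ℚ → ℕ → Polynomial
  monomialᴾ c zero    = c ∷ []
  monomialᴾ c (suc j) = 0ℚ ∷ monomialᴾ c j

  κ-0 : κ 0ℚ ≈ 0#
  κ-0 = ∙-cancelˡ (κ 0ℚ) _ _ (trans (sym (κ-+ 0ℚ 0ℚ)) (sym (+-identityʳ _)))

  evalᴿ-monomial : ∀ c j w → evalᴿ (monomialᴾ c j) w ≈ κ c * w ^ j
  evalᴿ-monomial c zero    w = begin
    κ c + w * 0# ≈⟨ +-congˡ {κ c} (zeroʳ w) ⟩
    κ c + 0# ≈⟨ +-identityʳ (κ c) ⟩
    κ c ≈⟨ *-identityʳ (κ c) ⟨
    κ c * 1# ∎
  evalᴿ-monomial c (suc j) w = begin
    κ 0ℚ + w * evalᴿ (monomialᴾ c j) w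
      ≈⟨ +-cong κ-0 (*-congˡ {w} (evalᴿ-monomial c j w)) ⟩
    0# + w * (κ c * w ^ j)
      ≈⟨ solve 3 (λ c w p → con 0 :+ w :* (c :* p) := c :* (w :* p)) refl (κ c) w (w ^ j) ⟩
    κ c * w ^ suc j ∎

  -- The offset a of the exponents allows the first coefficient to be split off in inductions; the
  -- case of interest is a = 0.
  value : ∀ {n} → (Fin n → Polynomial) → ℕ → Carrier
  value q a = sumᴿ (λ j → evalᴿ (q j) W * Z ^ (a ℕ.+ toℕ j))

  value-suc : ∀ {n} (q : Fin (suc n) → Polynomial) a →
    value q a ≈ evalᴿ (q Fin.zero) W * Z ^ a + value (λ j → q (Fin.suc j)) (suc a)
  value-suc q a = +-cong (*-congˡ {evalᴿ (q Fin.zero) W} (exponent (ℕP.+-identityʳ a)))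
    (sumᴿ-cong (λ j → *-congˡ {evalᴿ (q (Fin.suc j)) W} (exponent (ℕP.+-suc a (toℕ j)))))
    where
    exponent : ∀ {a b} → a ≡ b → Z ^ a ≈ Z ^ b
    exponent {a} ≡.refl = refl {Z ^ a}
    sumᴿ-cong : ∀ {n} {g h : Fin n → Carrier} → (∀ j → g j ≈ h j) → sumᴿ g ≈ sumᴿ h
    sumᴿ-cong {zero}  p = refl {0#}
    sumᴿ-cong {suc n} p = +-cong (p Fin.zero) (sumᴿ-cong (λ j → p (Fin.suc j)))

  value-0 : ∀ n a → value {n} (λ _ → []) a ≈ 0#
  value-0 zero    a = refl {0#}
  value-0 (suc n) a = trans (value-suc {n} (λ _ → []) a) (trans
    (+-cong (zeroˡ (Z ^ a)) (value-0 n (suc a))) (+-identityˡ 0#))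

  value-add : ∀ n (q q′ : Fin n → Polynomial) a → value (λ j → addᴾ (q j) (q′ j)) a ≈ value q a + value q′ a
  value-add zero    q q′ a = sym (+-identityˡ 0#)
  value-add (suc n) q q′ a = begin
    value (λ j → addᴾ (q j) (q′ j)) a
      ≈⟨ value-suc (λ j → addᴾ (q j) (q′ j)) a ⟩
    evalᴿ (addᴾ (q Fin.zero) (q′ Fin.zero)) W * Z ^ a + value (λ j → addᴾ (q (Fin.suc j)) (q′ (Fin.suc j))) (suc a)
      ≈⟨ +-cong (*-congʳ {Z ^ a} (evalᴿ-add (q Fin.zero) (q′ Fin.zero) W)) (value-add n (λ j → q (Fin.suc j)) (λ j → q′ (Fin.suc j)) (suc a)) ⟩
    (x + x′) * Z ^ a + (y + y′)
      ≈⟨ solve 5 (λ x x′ z y y′ → (x :+ x′) :* z :+ (y :+ y′) := x :* z :+ y :+ (x′ :* z :+ y′)) refl x x′ (Z ^ a) y y′ ⟩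
    x * Z ^ a + y + (x′ * Z ^ a + y′)
      ≈⟨ +-cong (value-suc q a) (value-suc q′ a) ⟨
    value q a + value q′ a ∎
    where
    x = evalᴿ (q Fin.zero) W
    x′ = evalᴿ (q′ Fin.zero) W
    y = value (λ j → q (Fin.suc j)) (suc a)
    y′ = value (λ j → q′ (Fin.suc j)) (suc a)

  single : ∀ {n} → ℕ → Polynomial → Fin n → Polynomial
  single zero    p Fin.zero    = p
  single zero    p (Fin.suc j) = []
  single (suc i) p Fin.zero    = []
  single (suc i) p (Fin.suc j) = single i p j

  value-single : ∀ n i p a → i ℕ.< n → value {n} (single i p) a ≈ evalᴿ p W * Z ^ (a ℕ.+ i)
  value-single (suc n) zero    p a _ = begin
    value {suc n} (single 0 p) a ≈⟨ value-suc {n} (single 0 p) a ⟩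
    evalᴿ p W * Z ^ a + value {n} (λ _ → []) (suc a) ≈⟨ +-congˡ {evalᴿ p W * Z ^ a} (value-0 n (suc a)) ⟩
    evalᴿ p W * Z ^ a + 0# ≈⟨ +-identityʳ (evalᴿ p W * Z ^ a) ⟩
    evalᴿ p W * Z ^ a ≡⟨ ≡.cong (λ b → evalᴿ p W * Z ^ b) (ℕP.+-identityʳ a) ⟨
    evalᴿ p W * Z ^ (a ℕ.+ 0) ∎
  value-single (suc n) (suc i) p a (ℕ.s≤s i<n) = begin
    value {suc n} (single (suc i) p) a ≈⟨ value-suc {n} (single (suc i) p) a ⟩
    0# * Z ^ a + value {n} (single i p) (suc a) ≈⟨ +-cong (zeroˡ (Z ^ a)) (value-single n i p (suc a) i<n) ⟩
    0# + evalᴿ p W * Z ^ (suc a ℕ.+ i) ≈⟨ +-identityˡ (evalᴿ p W * Z ^ (suc a ℕ.+ i)) ⟩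
    evalᴿ p W * Z ^ (suc a ℕ.+ i) ≡⟨ ≡.cong (λ b → evalᴿ p W * Z ^ b) (ℕP.+-suc a i) ⟨
    evalᴿ p W * Z ^ (a ℕ.+ suc i) ∎

  coefficients : ∀ {n P} → ZSpan n P → ∃ λ (q : Fin (suc n) → Polynomial) → P ≈ value q 0
  coefficients {n} (mono c i j i≤n) = single i (monomialᴾ c j) , sym (begin
    value {suc n} (single i (monomialᴾ c j)) 0 ≈⟨ value-single (suc n) i (monomialᴾ c j) 0 (ℕ.s≤s i≤n) ⟩
    evalᴿ (monomialᴾ c j) W * Z ^ i ≈⟨ *-congʳ {Z ^ i} (evalᴿ-monomial c j W) ⟩
    κ c * W ^ j * Z ^ i ≈⟨ *-assoc (κ c) (W ^ j) (Z ^ i) ⟩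
    κ c * (W ^ j * Z ^ i) ∎)
  coefficients {n} none       = (λ _ → []) , sym (value-0 (suc n) 0)
  coefficients {n} (add s t)  with coefficients s | coefficients t
  ... | q , e | q′ , e′ = (λ j → addᴾ (q j) (q′ j)) , trans (+-cong e e′) (sym (value-add (suc n) q q′ 0))
  coefficients     (resp p s) with coefficients s
  ... | q , e = q , trans (sym p) e

  F-rational : ∀ n → ∃ λ (q : Fin (suc (suc n)) → Polynomial) → F (suc (suc n)) ≈ W ^ 2 * I ^ (3 ℕ.* suc n) * value q 0
  F-rational n = conclude (F-form n)
    where
    conclude : (∃ λ P → ZSpan (suc n) P ∧ F (suc (suc n)) ≈ W * W * (I ^ triple (suc n) * P)) →
      ∃ λ (q : Fin (suc (suc n)) → Polynomial) → F (suc (suc n)) ≈ W ^ 2 * I ^ (3 ℕ.* suc n) * value q 0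
    conclude (P , s , e) = proj₁ (coefficients s) , (begin
      F (suc (suc n)) ≈⟨ e ⟩
      W * W * (I ^ triple (suc n) * P) ≈⟨ solve 3 (λ w i p → w :* w :* (i :* p) := w :* (w :* con 1) :* i :* p) refl W (I ^ triple (suc n)) P ⟩
      W ^ 2 * I ^ triple (suc n) * P ≈⟨ *-cong (*-congˡ (reflexive (≡.cong (I ^_) triple-3))) (proj₂ (coefficients s)) ⟩
      W ^ 2 * I ^ (3 ℕ.* suc n) * value (proj₁ (coefficients s)) 0 ∎)
      where
      triple-3 : triple (suc n) ≡ 3 ℕ.* suc n
      triple-3 = ≡.cong (λ m → suc n ℕ.+ (suc n ℕ.+ m)) (≡.sym (ℕP.+-identityʳ (suc n)))

-- The power series of the theorem

open ℤ using (+_)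
import Data.Integer.Properties as ℤP
open import Data.Rational.Unnormalised.Base as ℚᵘ using (mkℚᵘ; *≡*)
import Data.Rational.Unnormalised.Properties as ℚᵘP
open Defs using (F; eval; sumℚ; constant; _⁻¹; f)

ℚ-ring : Ring₀
ℚ-ring = ℚP.+-*-commutativeRing

module ℚR = CommutativeRing ℚ-ring
open SemiringMult ℚR.semiring using () renaming
  (_×_ to _×ℚ_; ×-assoc-* to ×ℚ-assoc-*; ×-comm-* to ×ℚ-comm-*; ×-assocˡ to ×ℚ-assocˡ)

-- A quotient `_/_` is `fromℚᵘ` of a fraction that may be unreduced, so identities between quotients
-- become identities of integers.
fromℚᵘ-* : ∀ p q → fromℚᵘ p ℚ.* fromℚᵘ q ≡ fromℚᵘ (p ℚᵘ.* q)
fromℚᵘ-* p q = ℚP.toℚᵘ-injective (begin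
  toℚᵘ (fromℚᵘ p ℚ.* fromℚᵘ q) ≈⟨ ℚP.toℚᵘ-homo-* (fromℚᵘ p) (fromℚᵘ q) ⟩
  toℚᵘ (fromℚᵘ p) ℚᵘ.* toℚᵘ (fromℚᵘ q) ≈⟨ ℚᵘP.*-cong (ℚP.toℚᵘ-fromℚᵘ p) (ℚP.toℚᵘ-fromℚᵘ q) ⟩
  p ℚᵘ.* q ≈⟨ ℚP.toℚᵘ-fromℚᵘ (p ℚᵘ.* q) ⟨
  toℚᵘ (fromℚᵘ (p ℚᵘ.* q)) ∎)
  where open SetoidReasoning ℚᵘP.≃-setoid

fromℚᵘ-+ : ∀ p q → fromℚᵘ p ℚ.+ fromℚᵘ q ≡ fromℚᵘ (p ℚᵘ.+ q)
fromℚᵘ-+ p q = ℚP.toℚᵘ-injective (begin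
  toℚᵘ (fromℚᵘ p ℚ.+ fromℚᵘ q) ≈⟨ ℚP.toℚᵘ-homo-+ (fromℚᵘ p) (fromℚᵘ q) ⟩
  toℚᵘ (fromℚᵘ p) ℚᵘ.+ toℚᵘ (fromℚᵘ q) ≈⟨ ℚᵘP.+-cong (ℚP.toℚᵘ-fromℚᵘ p) (ℚP.toℚᵘ-fromℚᵘ q) ⟩
  p ℚᵘ.+ q ≈⟨ ℚP.toℚᵘ-fromℚᵘ (p ℚᵘ.+ q) ⟨
  toℚᵘ (fromℚᵘ (p ℚᵘ.+ q)) ∎)
  where open SetoidReasoning ℚᵘP.≃-setoid

×ℚ1 : ∀ n → n ×ℚ 1ℚ ≡ + n / 1
×ℚ1 zero    = ≡.refl
×ℚ1 (suc n) = ≡.trans (≡.cong (1ℚ ℚ.+_) (×ℚ1 n)) (≡.trans (fromℚᵘ-+ (mkℚᵘ (+ 1) 0) (mkℚᵘ (+ n) 0))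
  (ℚP.fromℚᵘ-cong {mkℚᵘ (+ 1) 0 ℚᵘ.+ mkℚᵘ (+ n) 0} {mkℚᵘ (+ suc n) 0}
    (*≡* (≡.cong (λ z → (+ 1 ℤ.* + 1 ℤ.+ z) ℤ.* + 1) (ℤP.*-identityʳ (+ n))))))

×ℚ-/ : ∀ n x → n ×ℚ x ≡ (+ n / 1) ℚ.* x
×ℚ-/ n x = ≡.trans (≡.cong (n ×ℚ_) (≡.sym (ℚP.*-identityˡ x)))
  (≡.trans (≡.sym (×ℚ-assoc-* n 1ℚ x)) (≡.cong (ℚ._* x) (×ℚ1 n)))

/-reciprocal : ∀ n d .{{_ : ℕ.NonZero d}} → + n / d ≡ n ×ℚ reciprocal d
/-reciprocal n (suc d) = ≡.sym (≡.trans (×ℚ-/ n (+ 1 / suc d)) (≡.trans (fromℚᵘ-* (mkℚᵘ (+ n) 0) (mkℚᵘ (+ 1) d))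
  (ℚP.fromℚᵘ-cong {mkℚᵘ (+ n) 0 ℚᵘ.* mkℚᵘ (+ 1) d} {mkℚᵘ (+ n) d}
    (*≡* (≡.cong₂ ℤ._*_ (ℤP.*-identityʳ (+ n)) (≡.cong (λ m → + suc m) (≡.sym (ℕP.+-identityʳ d))))))))

reciprocal-inverse : ∀ n → suc n ×ℚ reciprocal (suc n) ≡ 1ℚ
reciprocal-inverse n = ≡.trans (≡.sym (/-reciprocal (suc n) (suc n)))
  (ℚP.fromℚᵘ-cong {mkℚᵘ (+ suc n) n} {mkℚᵘ (+ 1) 0} (*≡* (ℤP.*-comm (+ suc n) (+ 1))))

reciprocal-cancel : ∀ n x → reciprocal (suc n) ℚ.* (suc n ×ℚ x) ≡ x
reciprocal-cancel n x = begin
  reciprocal (suc n) ℚ.* (suc n ×ℚ x) ≡⟨ ×ℚ-comm-* (suc n) (reciprocal (suc n)) x ⟩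
  suc n ×ℚ (reciprocal (suc n) ℚ.* x) ≡⟨ ×ℚ-assoc-* (suc n) (reciprocal (suc n)) x ⟨
  (suc n ×ℚ reciprocal (suc n)) ℚ.* x ≡⟨ ≡.cong (ℚ._* x) (reciprocal-inverse n) ⟩
  1ℚ ℚ.* x ≡⟨ ℚP.*-identityˡ x ⟩
  x ∎
  where
  open ≡.≡-Reasoning

ℚ-torsionFree : Notions.TorsionFree ℚ-ring
ℚ-torsionFree n {x} {y} p =
  ≡.trans (≡.sym (reciprocal-cancel n x)) (≡.trans (≡.cong (reciprocal (suc n) ℚ.*_) p) (reciprocal-cancel n y))

-- Power series in u and the numbers of connected graphs

K : Ring₀
K = PS ℚ-ring

module K = CommutativeRing K
open SemiringMult K.semiring using () renaming (_×_ to _×ᴷ_)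
open Exp K.commutativeSemiring using (^-homo-*) renaming (_^_ to _^ᴷ_)

u : K.Carrier
u zero    = 0ℚ
u (suc n) = Convolution.one ℚ-ring n

u-zero : ∀ h → (u K.* h) 0 ≡ 0ℚ
u-zero h = ℚP.*-zeroˡ (h 0)

u-suc : ∀ h e → (u K.* h) (suc e) ≡ h e
u-suc h e = ≡.trans (≡.cong₂ ℚ._+_ (ℚP.*-zeroˡ (h (suc e))) (Convolution.⊛-identityˡ ℚ-ring h e)) (ℚP.+-identityˡ (h e))

u^-low : ∀ n h e → e ℕ.< n → (u ^ᴷ n K.* h) e ≡ 0ℚ
u^-low (suc n) h e e<n = ≡.trans (K.*-assoc u (u ^ᴷ n) h e) (shift e e<n)
  where
  shift : ∀ e → e ℕ.< suc n → (u K.* (u ^ᴷ n K.* h)) e ≡ 0ℚ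
  shift zero    _           = u-zero (u ^ᴷ n K.* h)
  shift (suc e) (ℕ.s≤s e<n) = ≡.trans (u-suc (u ^ᴷ n K.* h) e) (u^-low n h e e<n)

u^-high : ∀ n h k → (u ^ᴷ n K.* h) (n ℕ.+ k) ≡ h k
u^-high zero    h k = K.*-identityˡ h k
u^-high (suc n) h k = ≡.trans (K.*-assoc u (u ^ᴷ n) h (suc n ℕ.+ k))
  (≡.trans (u-suc (u ^ᴷ n K.* h) (n ℕ.+ k)) (u^-high n h k))

kronecker : ℕ → ℕ → ℚ
kronecker n e = Sums.ind ℚ-ring (n ℕP.≟ e)

u^-coefficient : ∀ n e → (u ^ᴷ n) e ≡ kronecker n e
u^-coefficient n e with n ℕP.≟ e
... | yes ≡.refl = ≡.trans (≡.sym (K.*-identityʳ (u ^ᴷ n) n)) (≡.trans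
        (≡.cong (u ^ᴷ n K.* K.1#) (≡.sym (ℕP.+-identityʳ n))) (u^-high n K.1# 0))
... | no n≢e = ≡.trans (≡.sym (K.*-identityʳ (u ^ᴷ n) e)) (other (ℕP.<-cmp n e))
  where
  open import Relation.Binary.Definitions using (Tri; tri<; tri≈; tri>)
  other : Tri (n ℕ.< e) (n ≡ e) (e ℕ.< n) → (u ^ᴷ n K.* K.1#) e ≡ 0ℚ
  other (tri> _ _ e<n) = u^-low n K.1# e e<n
  other (tri≈ _ n≡e _) = contradiction n≡e n≢e
  other (tri< n<e _ _) with e ∸ n in eq | ℕP.m+[n∸m]≡n (ℕP.<⇒≤ n<e)
  ... | zero  | p = contradiction (≡.trans (≡.sym (ℕP.+-identityʳ n)) p) n≢e
  ... | suc k | p = ≡.trans (≡.cong (u ^ᴷ n K.* K.1#) (≡.sym p)) (u^-high n K.1# (suc k))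

module Γ = Decomposition K u
module ΣQ = Sums ℚ-ring

sumVec-pointwise : ∀ {A : Set} {S : Γ.Functional A} {S′ : ΣQ.Functional A} →
  ΣQ.IsAdditive S′ → (∀ f e → S f e ≡ S′ (λ x → f x e)) →
  ∀ n f e → Γ.sumVec S n f e ≡ ΣQ.sumVec S′ n (λ v → f v e)
sumVec-pointwise add p zero    f e = ≡.refl
sumVec-pointwise add p (suc n) f e =
  ≡.trans (p _ e) (ΣQ.IsAdditive.S-cong add (λ x → sumVec-pointwise add p n (λ v → f (x ∷ v)) e))

sumGraph-pointwise : ∀ r s f e → Γ.sumGraph r s f e ≡ ΣQ.sumGraph r s (λ G → f G e)
sumGraph-pointwise r s = sumVec-pointwise (ΣQ.IsSum.isAdditive (ΣQ.sumSubset-isSum s))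
  (sumVec-pointwise (ΣQ.IsSum.isAdditive ΣQ.sumBool-isSum) (λ f e → ≡.refl) s) r

sumList : ∀ {A : Set} → List A → ΣQ.Functional A
sumList []       f = 0ℚ
sumList (x ∷ xs) f = f x ℚ.+ sumList xs f

sumList-++ : ∀ {A : Set} (xs ys : List A) f → sumList (xs ++ ys) f ≡ sumList xs f ℚ.+ sumList ys f
sumList-++ []       ys f = ≡.sym (ℚP.+-identityˡ _)
sumList-++ (x ∷ xs) ys f = ≡.trans (≡.cong (f x ℚ.+_) (sumList-++ xs ys f)) (≡.sym (ℚP.+-assoc (f x) _ _))

sumList-map : ∀ {A B : Set} (g : A → B) xs f → sumList (List.map g xs) f ≡ sumList xs (f ∘ g)
sumList-map g []       f = ≡.refl
sumList-map g (x ∷ xs) f = ≡.cong (f (g x) ℚ.+_) (sumList-map g xs f)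

sumList-cartesianProductWith : ∀ {A B C : Set} (g : A → B → C) xs ys f →
  sumList (cartesianProductWith g xs ys) f ≡ sumList xs (λ x → sumList ys (λ y → f (g x y)))
sumList-cartesianProductWith g []       ys f = ≡.refl
sumList-cartesianProductWith g (x ∷ xs) ys f = ≡.trans (sumList-++ (List.map (g x) ys) _ f)
  (≡.cong₂ ℚ._+_ (sumList-map (g x) ys f) (sumList-cartesianProductWith g xs ys f))

sumList-allVecs : ∀ {A : Set} (xs : List A) {S : ΣQ.Functional A} → ΣQ.IsAdditive S →
  (∀ f → sumList xs f ≡ S f) → ∀ n f → sumList (allVecs xs n) f ≡ ΣQ.sumVec S n f
sumList-allVecs xs add p zero    f = ℚP.+-identityʳ (f [])
sumList-allVecs xs add p (suc n) f = ≡.trans (sumList-cartesianProductWith _∷_ xs (allVecs xs n) f)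
  (≡.trans (p _) (ΣQ.IsAdditive.S-cong add (λ x → sumList-allVecs xs add p n (λ v → f (x ∷ v)))))

-- Connects the list over which `Nbi` counts with the iterated functional of the algebraic part.
sumList-allGraphs : ∀ r s f → sumList (allGraphs r s) f ≡ ΣQ.sumGraph r s f
sumList-allGraphs r s = sumList-allVecs (allVecs (inside ∷ outside ∷ []) s)
  (ΣQ.IsSum.isAdditive (ΣQ.sumSubset-isSum s))
  (sumList-allVecs (inside ∷ outside ∷ []) (ΣQ.IsSum.isAdditive ΣQ.sumBool-isSum)
    (λ f → ≡.cong (f true ℚ.+_) (ℚP.+-identityʳ (f false))) s) r

sumList-filter : ∀ {A : Set} {P : A → Set} (P? : ∀ x → Dec (P x)) xs →
  sumList xs (λ x → ΣQ.ind (P? x)) ≡ length (filter P? xs) ×ℚ 1ℚ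
sumList-filter P? []       = ≡.refl
sumList-filter P? (x ∷ xs) with P? x
... | yes _ = ≡.cong (1ℚ ℚ.+_) (sumList-filter P? xs)
... | no  _ = ≡.trans (ℚP.+-identityˡ _) (sumList-filter P? xs)

connectedGraphs-coefficient : ∀ r s e → Γ.connectedGraphs r s e ≡
  ΣQ.sumGraph r s (λ G → ΣQ.ind (connected? G ×-dec (edges G ℕP.≟ e)))
connectedGraphs-coefficient r s e = ≡.trans (sumGraph-pointwise r s _ e)
  (ΣQ.IsSum.S-cong (ΣQ.sumGraph-isSum r s) term)
  where
  term : ∀ G → (Γ.ind (connected? G) K.* u ^ᴷ edges G) e ≡ ΣQ.ind (connected? G ×-dec (edges G ℕP.≟ e))
  term G with connected? G
  ... | yes c = ≡.trans (K.*-identityˡ (u ^ᴷ edges G) e) (≡.trans (u^-coefficient (edges G) e)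
                  (≡.trans (≡.sym (ℚP.*-identityˡ (kronecker (edges G) e)))
                    (≡.sym (ΣQ.ind-× (yes c) (edges G ℕP.≟ e)))))
  ... | no  _ = ≡.trans (K.zeroˡ (u ^ᴷ edges G) e) ≡.refl

connectedGraphs-count : ∀ r s e → Γ.connectedGraphs r s e ≡
  length (filter (λ G → connected? G ×-dec (edges G ℕP.≟ e)) (allGraphs r s)) ×ℚ 1ℚ
connectedGraphs-count r s e = ≡.trans (connectedGraphs-coefficient r s e)
  (≡.trans (≡.sym (sumList-allGraphs r s _)) (sumList-filter _ (allGraphs r s)))

×ᴷ-pointwise : ∀ n f e → (n ×ᴷ f) e ≡ n ×ℚ f e
×ᴷ-pointwise = Euler.×-pointwise ℚ-ring

_!!_ : ℕ → ℕ → ℕ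
r !! s = r ! ℕ.* s !

reciprocal-!! : ∀ r s → (r !! s) ×ℚ reciprocal (r !! s) ≡ 1ℚ
reciprocal-!! r s with r !! s | ℕP._!*_!≢0 r s
... | suc n | _ = reciprocal-inverse n

normalised : ℕ → ℕ → K.Carrier → K.Carrier
normalised r s f e = reciprocal (r !! s) ℚ.* f e

normalised-egf : ∀ r s f → (r !) ×ᴷ ((s !) ×ᴷ normalised r s f) K.≈ f
normalised-egf r s f e = begin
  ((r !) ×ᴷ ((s !) ×ᴷ normalised r s f)) e ≡⟨ ×ᴷ-pointwise (r !) _ e ⟩
  (r !) ×ℚ ((s !) ×ᴷ normalised r s f) e ≡⟨ ≡.cong ((r !) ×ℚ_) (×ᴷ-pointwise (s !) _ e) ⟩
  (r !) ×ℚ ((s !) ×ℚ normalised r s f e) ≡⟨ ×ℚ-assocˡ (normalised r s f e) (r !) (s !) ⟩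
  (r !! s) ×ℚ (reciprocal (r !! s) ℚ.* f e) ≡⟨ ×ℚ-assoc-* (r !! s) (reciprocal (r !! s)) (f e) ⟨
  ((r !! s) ×ℚ reciprocal (r !! s)) ℚ.* f e ≡⟨ ≡.cong (ℚ._* f e) (reciprocal-!! r s) ⟩
  1ℚ ℚ.* f e ≡⟨ ℚP.*-identityˡ (f e) ⟩
  f e ∎
  where open ≡.≡-Reasoning

-- Row 0 of C is given separately: `Connected` is vacuous on the empty vertex set, so
-- `connectedGraphs 0 0` is 1, while the logarithm of G has constant term 0.
G C : ℕ → ℕ → K.Carrier
G r s = normalised r s (Γ.graphs r s)

C zero    zero          = K.0#
C zero    (suc zero)    = K.1#
C zero    (suc (suc s)) = K.0#
C (suc r) s             = normalised (suc r) s (Γ.connectedGraphs (suc r) s)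

∈⇒card≢0 : ∀ {n} {i : Fin n} {p} → i ∈ p → card p ≢ 0
∈⇒card≢0 here ()
∈⇒card≢0 {p = inside  ∷ _} (there i∈p) ()
∈⇒card≢0 {p = outside ∷ _} (there i∈p) = ∈⇒card≢0 i∈p

-- A path from vertex 0 of V₁ to another vertex starts with an edge. This excludes connected graphs
-- without edges on several vertices, and connected graphs with s = 0 and r ≥ 2.
escape : ∀ {r s} (H : BipartiteGraph (suc r) s) → Connected H → ∀ (w : Vertex (suc r) s) → w ≢ inj₁ Fin.zero →
  ∃ λ j → j ∈ lookup H Fin.zero
escape H conn w w≢ with conn (inj₁ Fin.zero) w
... | ε           = contradiction ≡.refl w≢
... | forth p ◅ _ = _ , p

escape-edges : ∀ {r s} (H : BipartiteGraph (suc r) s) → Connected H → ∀ (w : Vertex (suc r) s) → w ≢ inj₁ Fin.zero → edges H ≢ 0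
escape-edges (row ∷ H) conn w w≢ e≡0 with escape (row ∷ H) conn w w≢
... | j , j∈row = ∈⇒card≢0 j∈row (ℕP.m+n≡0⇒m≡0 (card row) e≡0)

connectedGraphs-vanish : ∀ r s e → (∀ G → Connected {r} {s} G → edges G ≢ e) → Γ.connectedGraphs r s e ≡ 0ℚ
connectedGraphs-vanish r s e none = ≡.trans (connectedGraphs-coefficient r s e)
  (≡.trans (ΣQ.IsSum.S-cong (ΣQ.sumGraph-isSum r s) {λ G → ΣQ.ind (connected? G ×-dec (edges G ℕP.≟ e))} {λ _ → 0ℚ} (λ G → ΣQ.ind-no (connected? G ×-dec (edges G ℕP.≟ e)) (λ (c , p) → none G c p)))
    (ΣQ.IsSum.S-0 (ΣQ.sumGraph-isSum r s)))

normalised-0 : ∀ r s f e → f e ≡ 0ℚ → normalised r s f e ≡ 0ℚ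
normalised-0 r s f e p = ≡.trans (≡.cong (reciprocal (r !! s) ℚ.*_) p) (ℚP.*-zeroʳ (reciprocal (r !! s)))

C-vanish : ∀ r s e → (∀ (H : BipartiteGraph (suc r) s) → Connected H → edges H ≢ e) → C (suc r) s e ≡ 0ℚ
C-vanish r s e none = normalised-0 (suc r) s (Γ.connectedGraphs (suc r) s) e (connectedGraphs-vanish (suc r) s e none)

euler-u : Euler.euler ℚ-ring u K.≈ u
euler-u zero          = ≡.refl
euler-u (suc zero)    = ≡.refl
euler-u (suc (suc n)) = Euler.×-zeroʳ ℚ-ring (suc (suc n))

K-torsionFree : Notions.TorsionFree K
K-torsionFree = Euler.PS-torsionFree ℚ-ring ℚ-torsionFree

module E = Exponential K K-torsionFree u (Euler.euler ℚ-ring) (Euler.euler-isDerivation ℚ-ring)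
  euler-u

G-egf : ∀ r s → (r !) ×ᴷ ((s !) ×ᴷ G r s) K.≈ Γ.graphs r s
G-egf r s = normalised-egf r s (Γ.graphs r s)

C-egf : ∀ r s → (suc r !) ×ᴷ ((s !) ×ᴷ C (suc r) s) K.≈ Γ.connectedGraphs (suc r) s
C-egf r s = normalised-egf (suc r) s (Γ.connectedGraphs (suc r) s)

module Q = E.Functions G C G-egf C-egf K.refl K.refl (λ _ → K.refl)

C-low-0 : ∀ r s → 1 ℕ.< r ℕ.+ s → C r s 0 ≡ 0ℚ
C-low-0 zero          zero          ()
C-low-0 zero          (suc zero)    (ℕ.s≤s ())
C-low-0 zero          (suc (suc s)) _ = ≡.refl
C-low-0 (suc zero)    zero          (ℕ.s≤s ())
C-low-0 (suc zero)    (suc s)       _ = C-vanish 0 (suc s) 0 (λ H c → escape-edges H c (inj₂ Fin.zero) (λ ()))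
C-low-0 (suc (suc r)) s             _ = C-vanish (suc r) s 0 (λ H c → escape-edges H c (inj₁ (Fin.suc Fin.zero)) (λ ()))

module A = CommutativeRing (PS (PS K))

⊠-vanish : ∀ (f g : A.Carrier) r s e →
  (∀ a b c a′ b′ c′ → a ℕ.+ a′ ≡ r → b ℕ.+ b′ ≡ s → c ℕ.+ c′ ≡ e → f a b c ℚ.* g a′ b′ c′ ≡ 0ℚ) → (f A.* g) r s e ≡ 0ℚ
⊠-vanish f g r s e h = Closure.⊛-closed (PS K) {λ x → x s e ≡ 0ℚ} add f g r (λ a a′ p →
  Closure.⊛-closed K {λ x → x e ≡ 0ℚ} add (f a) (g a′) s (λ b b′ q →
  Closure.⊛-closed ℚ-ring {_≡ 0ℚ} add (f a b) (g a′ b′) e (λ c c′ t → h a b c a′ b′ c′ p q t)))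
  where
  add : ∀ {x y} → x ≡ 0ℚ → y ≡ 0ℚ → x ℚ.+ y ≡ 0ℚ
  add ≡.refl ≡.refl = ≡.refl

×ℚ-0 : ∀ n {x} → x ≡ 0ℚ → n ×ℚ x ≡ 0ℚ
×ℚ-0 n ≡.refl = Euler.×-zeroʳ ℚ-ring n

Dx-pointwise : ∀ f r s e → E.Dx f r s e ≡ r ×ℚ f r s e
Dx-pointwise f r s e = ≡.trans (≡.cong (λ h → h e) (E.Dx-apply f r s)) (×ᴷ-pointwise r (f r s) e)

Dy-pointwise : ∀ f r s e → E.Dy f r s e ≡ s ×ℚ f r s e
Dy-pointwise f r s e = ×ᴷ-pointwise s (f r s) e

U-suc : ∀ f r s e → (E.U A.* f) r s (suc e) ≡ f r s e
U-suc f r s e = ≡.trans (E.constant₂-* u f r s (suc e)) (u-suc (f r s) e)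

U-zero : ∀ f r s → (E.U A.* f) r s 0 ≡ 0ℚ
U-zero f r s = ≡.trans (E.constant₂-* u f r s 0) (u-zero (f r s))

V-suc : ∀ f r s e → (E.V A.* f) r s (suc e) ≡ f r s (suc e) ℚ.+ f r s e
V-suc f r s e = ≡.trans (A.distribʳ f A.1# E.U r s (suc e)) (≡.cong₂ ℚ._+_ (A.*-identityˡ f r s (suc e)) (U-suc f r s e))

-- A connected graph on n vertices has at least n - 1 edges; instead of a combinatorial argument, the edge
-- equation gives this by induction on the number e of edges.
C-low : ∀ e r s → suc e ℕ.< r ℕ.+ s → C r s e ≡ 0ℚ
C-low e = below (suc e) e (ℕP.n<1+n e)
  where
  below : ∀ n e → e ℕ.< n → ∀ r s → suc e ℕ.< r ℕ.+ s → C r s e ≡ 0ℚ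
  below (suc n) zero    _           r s lt = C-low-0 r s lt
  below (suc n) (suc e) (ℕ.s≤s e<n) r s lt = ℚ-torsionFree e (begin
    suc e ×ℚ C r s (suc e) ≡⟨ ℚP.+-identityʳ _ ⟨
    suc e ×ℚ C r s (suc e) ℚ.+ 0ℚ ≡⟨ ≡.cong (suc e ×ℚ C r s (suc e) ℚ.+_) (×ℚ-0 e (below n e e<n r s (ℕP.<-trans (ℕP.n<1+n (suc e)) lt))) ⟨
    suc e ×ℚ C r s (suc e) ℚ.+ e ×ℚ C r s e ≡⟨ V-suc (E.Du C) r s e ⟨
    (E.V A.* E.Du C) r s (suc e) ≡⟨ Q.edge-equation r s (suc e) ⟩
    (E.U A.* (E.Dx (E.Dy C) A.+ E.Dx C A.* E.Dy C)) r s (suc e)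
      ≡⟨ U-suc _ r s e ⟩
    E.Dx (E.Dy C) r s e ℚ.+ (E.Dx C A.* E.Dy C) r s e
      ≡⟨ ≡.cong₂ ℚ._+_ (≡.trans (Dx-pointwise (E.Dy C) r s e) (×ℚ-0 r (≡.trans (Dy-pointwise C r s e) (×ℚ-0 s (below n e e<n r s (ℕP.<-trans (ℕP.n<1+n (suc e)) lt))))))
           (⊠-vanish (E.Dx C) (E.Dy C) r s e product) ⟩
    0ℚ ≡⟨ ×ℚ-0 (suc e) ≡.refl ⟨
    suc e ×ℚ 0ℚ ∎)
    where
    open ≡.≡-Reasoning
    open import Algebra.Properties.CommutativeSemigroup ℕP.+-commutativeSemigroup using (interchange)
    -- By induction a nonzero term has a + b ≤ c + 1 and a′ + b′ ≤ c′ + 1, which add up to r + s ≤ e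
    -- + 2.
    product : ∀ a b c a′ b′ c′ → a ℕ.+ a′ ≡ r → b ℕ.+ b′ ≡ s → c ℕ.+ c′ ≡ e → E.Dx C a b c ℚ.* E.Dy C a′ b′ c′ ≡ 0ℚ
    product a b c a′ b′ c′ p q t with suc c ℕP.<? a ℕ.+ b
    ... | yes lo = ≡.trans (≡.cong (ℚ._* E.Dy C a′ b′ c′) (≡.trans (Dx-pointwise C a b c)
            (×ℚ-0 a (below n c (ℕP.≤-<-trans (ℕP.m+n≤o⇒m≤o c (ℕP.≤-reflexive t)) e<n) a b lo)))) (ℚP.*-zeroˡ (E.Dy C a′ b′ c′))
    ... | no hi with suc c′ ℕP.<? a′ ℕ.+ b′
    ...   | yes lo = ≡.trans (≡.cong (E.Dx C a b c ℚ.*_) (≡.trans (Dy-pointwise C a′ b′ c′)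
              (×ℚ-0 b′ (below n c′ (ℕP.≤-<-trans (ℕP.m+n≤o⇒n≤o c (ℕP.≤-reflexive t)) e<n) a′ b′ lo)))) (ℚP.*-zeroʳ (E.Dx C a b c))
    ...   | no hi′ = contradiction lt (ℕP.≤⇒≯ (ℕP.≤-trans (ℕP.≤-reflexive (≡.trans (≡.cong₂ ℕ._+_ (≡.sym p) (≡.sym q)) (interchange a a′ b b′)))
              (ℕP.≤-trans (ℕP.+-mono-≤ (ℕP.≮⇒≥ hi) (ℕP.≮⇒≥ hi′)) (ℕP.≤-reflexive (≡.cong suc (≡.trans (ℕP.+-suc c c′) (≡.cong suc t)))))))

F-reciprocal : ∀ k r s → F k r s ≡ Nbi r s k ×ℚ reciprocal (r !! s)
F-reciprocal k r s = /-reciprocal (Nbi r s k) (r !! s) {{ℕP._!*_!≢0 r s}}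

Nbi-zeroˡ : ∀ s k → Nbi 0 (suc (suc s)) k ≡ 0
Nbi-zeroˡ s zero    = ≡.refl
Nbi-zeroˡ s (suc k) = ≡.refl

Nbi-zeroʳ : ∀ r k → Nbi (suc (suc r)) 0 k ≡ 0
Nbi-zeroʳ r zero    = ≡.refl
Nbi-zeroʳ r (suc k) = ≡.refl

Nbi-suc : ∀ r s k → Nbi (suc r) (suc s) k ≡ length (filter
  (λ G → connected? G ×-dec (edges G ℕP.≟ suc r ℕ.+ suc s ℕ.+ k ∸ 1)) (allGraphs (suc r) (suc s)))
Nbi-suc zero    s k = ≡.refl
Nbi-suc (suc r) s k = ≡.refl

-- The exponent of u counts edges, so the Betti number k is read off at e = r + s + k - 1.
C-high : ∀ r s k e → suc e ≡ r ℕ.+ s ℕ.+ k → 0 ℕ.< r ℕ.+ s → C r s e ≡ F k r s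
C-high zero    zero          k e p ()
C-high zero    (suc zero)    zero    zero    p _ = ≡.refl
C-high zero    (suc zero)    (suc k) (suc e) p _ = ≡.sym (F-reciprocal (suc k) 0 1)
C-high zero    (suc (suc s)) k       e       p _ = ≡.sym (≡.trans (F-reciprocal k 0 (suc (suc s))) (≡.cong (_×ℚ reciprocal (0 !! suc (suc s))) (Nbi-zeroˡ s k)))
C-high (suc zero)    zero zero    zero    p _ = ≡.refl
C-high (suc zero)    zero (suc k) (suc e) p _ = ≡.trans
  (C-vanish 0 0 (suc e) (λ { ([] ∷ []) c () }))
  (≡.sym (F-reciprocal (suc k) 1 0))
C-high (suc (suc r)) zero k       e       p _ = ≡.trans
  (C-vanish (suc r) 0 e (λ H c _ → contradiction (proj₁ (escape H c (inj₁ (Fin.suc Fin.zero)) (λ ()))) (λ ())))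
  (≡.sym (≡.trans (F-reciprocal k (suc (suc r)) 0) (≡.cong (_×ℚ reciprocal (suc (suc r) !! 0)) (Nbi-zeroʳ r k))))
C-high (suc r) (suc s) k e p _ = begin
  reciprocal (suc r !! suc s) ℚ.* Γ.connectedGraphs (suc r) (suc s) e
    ≡⟨ ≡.cong (reciprocal (suc r !! suc s) ℚ.*_) (connectedGraphs-count (suc r) (suc s) e) ⟩
  reciprocal (suc r !! suc s) ℚ.* (N e ×ℚ 1ℚ)
    ≡⟨ ×ℚ-comm-* (N e) (reciprocal (suc r !! suc s)) 1ℚ ⟩
  N e ×ℚ (reciprocal (suc r !! suc s) ℚ.* 1ℚ)
    ≡⟨ ≡.cong (N e ×ℚ_) (ℚP.*-identityʳ _) ⟩
  N e ×ℚ reciprocal (suc r !! suc s)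
    ≡⟨ ≡.cong (_×ℚ reciprocal (suc r !! suc s)) (≡.trans (≡.cong N (ℕP.suc-injective p)) (≡.sym (Nbi-suc r s k))) ⟩
  Nbi (suc r) (suc s) k ×ℚ reciprocal (suc r !! suc s)
    ≡⟨ F-reciprocal k (suc r) (suc s) ⟨
  F k (suc r) (suc s) ∎
  where
  open ≡.≡-Reasoning
  N : ℕ → ℕ
  N e = length (filter (λ G → connected? G ×-dec (edges G ℕP.≟ e)) (allGraphs (suc r) (suc s)))

u-regular : Notions.Regular K u
u-regular {x} {y} p e = ≡.trans (≡.sym (u-suc x e)) (≡.trans (K.*-comm u x (suc e)) (≡.trans (p (suc e))
  (≡.trans (K.*-comm y u (suc e)) (u-suc y e))))

module R = Rescaling K K-torsionFree u u-regular (Euler.euler ℚ-ring) (Euler.euler-isDerivation ℚ-ring)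
  euler-u

Ĉ : A.Carrier
Ĉ r s k = F k r s

F₀₀ : ∀ k → F k 0 0 ≡ 0ℚ
F₀₀ k = F-reciprocal k 0 0

rescale-Ĉ : ∀ r s e → R.rescale Ĉ r s e ≡ (u ^ᴷ (r ℕ.+ s) K.* Ĉ r s) e
rescale-Ĉ r s e = ≡.trans (≡.sym (K.*-assoc (u ^ᴷ r) (u ^ᴷ s) (Ĉ r s) e)) (K.*-congʳ {Ĉ r s} (K.sym (^-homo-* u r s)) e)

-- From the exponent r + s on, `C-high` applies. Below it the right-hand side is 0 because of its
-- factor u^(r+s), and `C-low` gives the same for the left.
C-shift : ∀ r s e n → r ℕ.+ s ≡ suc n → Dec (suc n ℕ.≤ suc e) → C r s e ≡ (u ^ᴷ suc n K.* Ĉ r s) (suc e)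
C-shift r s e n eq (yes n≤e) = ≡.trans
  (C-high r s (suc e ∸ suc n) e
    (≡.trans (≡.sym (ℕP.m+[n∸m]≡n n≤e)) (≡.cong (ℕ._+ (suc e ∸ suc n)) (≡.sym eq)))
    (ℕP.≤-trans (ℕ.s≤s ℕ.z≤n) (ℕP.≤-reflexive (≡.sym eq))))
  (≡.trans (≡.sym (u^-high (suc n) (Ĉ r s) (suc e ∸ suc n)))
    (≡.cong (u ^ᴷ suc n K.* Ĉ r s) (ℕP.m+[n∸m]≡n n≤e)))
C-shift r s e n eq (no n≰e) = ≡.trans
  (C-low e r s (ℕP.≤-trans (ℕP.≰⇒> n≰e) (ℕP.≤-reflexive (≡.sym eq))))
  (≡.sym (u^-low (suc n) (Ĉ r s) (suc e) (ℕP.≰⇒> n≰e)))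

U*C-shift : ∀ r s n → r ℕ.+ s ≡ suc n → ∀ e → (E.U A.* C) r s e ≡ (u ^ᴷ suc n K.* Ĉ r s) e
U*C-shift r s n eq zero    = ≡.trans (U-zero C r s) (≡.sym (u^-low (suc n) (Ĉ r s) 0 (ℕ.s≤s ℕ.z≤n)))
U*C-shift r s n eq (suc e) = ≡.trans (U-suc C r s e) (C-shift r s e n eq (suc n ℕP.≤? suc e))

U*C₀₀ : ∀ e → (E.U A.* C) 0 0 e ≡ 0ℚ
U*C₀₀ zero    = U-zero C 0 0
U*C₀₀ (suc e) = U-suc C 0 0 e

U*C : E.U A.* C A.≈ R.rescale Ĉ
U*C zero    zero    e = ≡.trans (U*C₀₀ e) (≡.sym (≡.trans (rescale-Ĉ 0 0 e) (≡.trans (K.*-identityˡ (Ĉ 0 0) e) (F₀₀ e))))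
U*C zero    (suc s) e = ≡.trans (U*C-shift 0 (suc s) s ≡.refl e) (≡.sym (rescale-Ĉ 0 (suc s) e))
U*C (suc r) s       e = ≡.trans (U*C-shift (suc r) s (r ℕ.+ s) ≡.refl e) (≡.sym (rescale-Ĉ (suc r) s e))

module H = R.Rescaled C Ĉ U*C Q.edge-equation Q.Dx-equation Q.Dy-equation Q.Du-equation

-- Equations between the coefficients of the powers of u

SeriesRing : Ring₀
SeriesRing = PS (PS ℚ-ring)

module Ser = CommutativeRing SeriesRing
module CS = Convolution SeriesRing
open SemiringMult Ser.semiring using () renaming (_×_ to _×ˢ_)
open Exp Ser.commutativeSemiring using () renaming (_^_ to _^ˢ_)
open CS using (_⊛_)
open Constants ℚ-ring using (constant₂; constant₂-*; constant₂-+; constant₂-1)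

-- coefficients of the powers of u
rotate : A.Carrier → ℕ → Ser.Carrier
rotate f k r s = f r s k

-- The index of u is innermost; it is exchanged first with that of y, then with that of x, and both
-- exchanges are multiplicative.
rotate-* : ∀ f g k → rotate (f A.* g) k Ser.≈ (rotate f ⊛ rotate g) k
rotate-* f g k r s = ≡.trans (L.h-* f g r k s) (Swap.swap-* K′ (inner f) (inner g) k r s)
  where
  K′ = PS ℚ-ring
  inner : A.Carrier → A.Carrier
  inner = Euler.lift (PS K) (Swap.swap ℚ-ring)
  module L = Notions.IsEndo (Euler.lift-isEndo (PS K) (Swap.swap-isEndo ℚ-ring))

×ˢ-pointwise : ∀ n f r s → (n ×ˢ f) r s ≡ n ×ℚ f r s
×ˢ-pointwise zero    f r s = ≡.refl
×ˢ-pointwise (suc n) f r s = ≡.cong (f r s ℚ.+_) (×ˢ-pointwise n f r s)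

DX DY : Ser.Carrier → Ser.Carrier
DX f r s = r ×ℚ f r s
DY f r s = s ×ℚ f r s

rotate-Dx : ∀ f k → rotate (E.Dx f) k Ser.≈ DX (rotate f k)
rotate-Dx f k r s = Dx-pointwise f r s k

rotate-Dy : ∀ f k → rotate (E.Dy f) k Ser.≈ DY (rotate f k)
rotate-Dy f k r s = Dy-pointwise f r s k

rotate-Du : ∀ f k → rotate (E.Du f) k Ser.≈ k ×ˢ rotate f k
rotate-Du f k r s = ≡.sym (×ˢ-pointwise k (rotate f k) r s)

S : ℕ → Ser.Carrier
S = rotate H.Ŝ

private
  product : ∀ {f g f′ g′ : ℕ → Ser.Carrier} k → (∀ i → f i Ser.≈ f′ i) → (∀ i → g i Ser.≈ g′ i) → (f ⊛ g) k Ser.≈ (f′ ⊛ g′) k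
  product k p q = CS.⊛-cong p q k

betti-equation : ∀ k →
  suc k ×ˢ F (suc k) Ser.+ DX (F (suc k)) Ser.+ DY (F (suc k)) Ser.+ (k ×ˢ F k Ser.+ DX (F k) Ser.+ DY (F k)) Ser.≈
  F (suc k) Ser.+ F k Ser.+ (DX (DY (F k)) Ser.+ ((λ i → DX (F i)) ⊛ (λ j → DY (F j))) (suc k))
betti-equation k r s = ≡.trans (≡.sym lhs) (≡.trans (H.hat-edge-equation r s (suc k)) rhs)
  where
  total : ∀ k → rotate (E.Du Ĉ A.+ E.Dx Ĉ A.+ E.Dy Ĉ) k Ser.≈ k ×ˢ F k Ser.+ DX (F k) Ser.+ DY (F k)
  total k r s = ≡.cong₂ ℚ._+_ (≡.cong₂ ℚ._+_ (rotate-Du Ĉ k r s) (rotate-Dx Ĉ k r s)) (rotate-Dy Ĉ k r s)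
  lhs : (E.V A.* (E.Du Ĉ A.+ E.Dx Ĉ A.+ E.Dy Ĉ)) r s (suc k) ≡ _
  lhs = ≡.trans (V-suc (E.Du Ĉ A.+ E.Dx Ĉ A.+ E.Dy Ĉ) r s k) (≡.cong₂ ℚ._+_ (total (suc k) r s) (total k r s))
  rhs : (E.V A.* Ĉ A.+ (E.U A.* E.Dx (E.Dy Ĉ) A.+ E.Dx Ĉ A.* E.Dy Ĉ)) r s (suc k) ≡ _
  rhs = ≡.cong₂ ℚ._+_ (V-suc Ĉ r s k) (≡.cong₂ ℚ._+_
    (≡.trans (U-suc (E.Dx (E.Dy Ĉ)) r s k) (≡.trans (rotate-Dx (E.Dy Ĉ) k r s) (≡.cong (r ×ℚ_) (rotate-Dy Ĉ k r s))))
    (≡.trans (rotate-* (E.Dx Ĉ) (E.Dy Ĉ) (suc k) r s) (product (suc k) (rotate-Dx Ĉ) (rotate-Dy Ĉ) r s)))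

DX-equation : DX (DX (F 0)) Ser.≈ DX (F 0) Ser.+ DX (F 0) Ser.* DX (S 0)
DX-equation r s = ≡.trans (≡.sym (≡.trans (rotate-Dx (E.Dx Ĉ) 0 r s) (≡.cong (r ×ℚ_) (rotate-Dx Ĉ 0 r s))))
  (≡.trans (H.hat-Dx-equation r s 0) (≡.cong₂ ℚ._+_ (rotate-Dx Ĉ 0 r s)
    (≡.trans (rotate-* (E.Dx Ĉ) (E.Dx H.Ŝ) 0 r s) (product 0 (rotate-Dx Ĉ) (rotate-Dx H.Ŝ) r s))))

DY-equation : DY (DX (F 0)) Ser.≈ DX (F 0) Ser.* DY (S 0)
DY-equation r s = ≡.trans (≡.sym (≡.trans (rotate-Dy (E.Dx Ĉ) 0 r s) (≡.cong (s ×ℚ_) (rotate-Dx Ĉ 0 r s))))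
  (≡.trans (H.hat-Dy-equation r s 0)
    (≡.trans (rotate-* (E.Dx Ĉ) (E.Dy H.Ŝ) 0 r s) (product 0 (rotate-Dx Ĉ) (rotate-Dy H.Ŝ) r s)))

root-recursion : ∀ k → k ×ˢ DX (F k) Ser.≈ ((λ i → DX (F i)) ⊛ (λ j → j ×ˢ S j)) k
root-recursion k r s = ≡.trans (≡.trans (×ˢ-pointwise k (DX (F k)) r s)
    (≡.sym (≡.trans (rotate-Du (E.Dx Ĉ) k r s) (≡.trans (×ˢ-pointwise k _ r s) (≡.cong (k ×ℚ_) (rotate-Dx Ĉ k r s))))))
  (≡.trans (H.hat-Du-equation r s k)
    (≡.trans (rotate-* (E.Dx Ĉ) (E.Du H.Ŝ) k r s) (product k (rotate-Dx Ĉ) (rotate-Du H.Ŝ) r s)))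

-- The operator binom(DY, i + 1): the coefficient of y^s is multiplied by binom(s, i + 1), taken
-- from `gap`.
β : ℕ → Ser.Carrier → Ser.Carrier
β i f r s = R.gap s i ℚ.* f r s

S-expansion : ∀ m → S m Ser.≈ S-sum SeriesRing β F m
S-expansion m r s = go (R.gap s) (λ i f r s → R.gap s i ℚ.* f r s) m (λ _ _ → ≡.refl)
  where
  -- The coefficients of `gap s` are generalised to g because both sides recurse through `tail`.
  go : ∀ g γ m → (∀ i f → γ i f r s ≡ g i ℚ.* f r s) → Convolution._⊛_ ℚ-ring g (Ĉ r s) m ≡ S-sum SeriesRing γ F m r s
  go g γ zero    h = ≡.sym (h 0 (F 0))
  go g γ (suc m) h = ≡.cong₂ ℚ._+_ (≡.sym (h 0 (F (suc m)))) (go (tail g) (tail γ) m (λ i f → h (suc i) f))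

-- v d/du applied to v^s = 1 + u (gap s)
gap-equation : ∀ s → E.v K.* (R.gap s K.+ Euler.euler ℚ-ring (R.gap s)) K.≈ E.KM._×_ s (E.v Q.KE.^ s)
gap-equation s = R.u-cancel (begin
  u K.* (E.v K.* (R.gap s K.+ e (R.gap s)))
    ≈⟨ solve 4 (λ u v g h → u :* (v :* (g :+ h)) := v :* (u :* g :+ u :* h)) K.refl u E.v (R.gap s) (e (R.gap s)) ⟩
  E.v K.* (u K.* R.gap s K.+ u K.* e (R.gap s))
    ≈⟨ K.*-congˡ {E.v} d-power ⟨
  E.v K.* e (E.v Q.KE.^ s)
    ≈⟨ ≡.subst (Q.PowerLike (E.v Q.KE.^ s)) (ℕP.*-identityʳ s) (Q.PowerLike-^ {E.v} {1} s Q.PowerLike-v) ⟩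
  s E.KM.× (u K.* (E.v Q.KE.^ s))
    ≈⟨ E.KM.×-comm-* s u (E.v Q.KE.^ s) ⟨
  u K.* (s E.KM.× (E.v Q.KE.^ s)) ∎)
  where
  open SetoidReasoning K.setoid
  open NatSolver K.commutativeSemiring
  e = Euler.euler ℚ-ring
  module e = Notions.IsDerivation (Euler.euler-isDerivation ℚ-ring)
  d-power : e (E.v Q.KE.^ s) K.≈ u K.* R.gap s K.+ u K.* e (R.gap s)
  d-power = K.trans (e.d-cong (R.v^-gap s)) (K.trans (e.d-+ K.1# (u K.* R.gap s))
    (K.trans (K.+-cong e.d-1 (e.d-* u (R.gap s))) (K.trans (K.+-identityˡ _) (K.+-congʳ {u K.* e (R.gap s)} (K.*-congʳ {R.gap s} euler-u)))))

v-suc : ∀ h i → (E.v K.* h) (suc i) ≡ h (suc i) ℚ.+ h i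
v-suc h i = ≡.trans (K.distribʳ h K.1# u (suc i)) (≡.cong₂ ℚ._+_ (K.*-identityˡ h (suc i)) (u-suc h i))

v-zero : ∀ h → (E.v K.* h) 0 ≡ h 0
v-zero h = ≡.trans (K.distribʳ h K.1# u 0) (≡.trans (≡.cong₂ ℚ._+_ (K.*-identityˡ h 0) (u-zero h)) (ℚP.+-identityʳ (h 0)))

gap-zero : ∀ s → R.gap s 0 ≡ s ×ℚ 1ℚ
gap-zero s = begin
  R.gap s 0 ≡⟨ ℚP.+-identityʳ (R.gap s 0) ⟨
  R.gap s 0 ℚ.+ 0ℚ ≡⟨ v-zero (R.gap s K.+ Euler.euler ℚ-ring (R.gap s)) ⟨
  (E.v K.* (R.gap s K.+ Euler.euler ℚ-ring (R.gap s))) 0 ≡⟨ gap-equation s 0 ⟩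
  (s E.KM.× (E.v Q.KE.^ s)) 0 ≡⟨ ×ᴷ-pointwise s (E.v Q.KE.^ s) 0 ⟩
  s ×ℚ (E.v Q.KE.^ s) 0 ≡⟨ ≡.cong (s ×ℚ_) (≡.trans (R.v^-gap s 0) (≡.cong (1ℚ ℚ.+_) (u-zero (R.gap s)))) ⟩
  s ×ℚ 1ℚ ∎
  where open ≡.≡-Reasoning

-- The coefficient of u^(i+1) in `gap-equation`; for binomial coefficients, (i + 2) binom(s, i + 2)
-- = (s - i - 1) binom(s, i + 1).
gap-suc : ∀ s i → suc (suc i) ×ℚ R.gap s (suc i) ℚ.+ suc i ×ℚ R.gap s i ≡ s ×ℚ R.gap s i
gap-suc s i = begin
  suc (suc i) ×ℚ R.gap s (suc i) ℚ.+ suc i ×ℚ R.gap s i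
    ≡⟨ v-suc (R.gap s K.+ Euler.euler ℚ-ring (R.gap s)) i ⟨
  (E.v K.* (R.gap s K.+ Euler.euler ℚ-ring (R.gap s))) (suc i) ≡⟨ gap-equation s (suc i) ⟩
  (s E.KM.× (E.v Q.KE.^ s)) (suc i) ≡⟨ ×ᴷ-pointwise s (E.v Q.KE.^ s) (suc i) ⟩
  s ×ℚ (E.v Q.KE.^ s) (suc i) ≡⟨ ≡.cong (s ×ℚ_) (≡.trans (R.v^-gap s (suc i)) (≡.trans (ℚP.+-identityˡ _) (u-suc (R.gap s) i))) ⟩
  s ×ℚ R.gap s i ∎
  where open ≡.≡-Reasoning

β-zero : ∀ f → β 0 f Ser.≈ DY f
β-zero f r s = ≡.trans (≡.cong (ℚ._* f r s) (gap-zero s))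
  (≡.trans (×ℚ-assoc-* s 1ℚ (f r s)) (≡.cong (s ×ℚ_) (ℚP.*-identityˡ (f r s))))

β-suc : ∀ i f → suc (suc i) ×ˢ β (suc i) f Ser.+ suc i ×ˢ β i f Ser.≈ DY (β i f)
β-suc i f r s = begin
  (suc (suc i) ×ˢ β (suc i) f) r s ℚ.+ (suc i ×ˢ β i f) r s
    ≡⟨ ≡.cong₂ ℚ._+_ (×ˢ-pointwise (suc (suc i)) (β (suc i) f) r s) (×ˢ-pointwise (suc i) (β i f) r s) ⟩
  suc (suc i) ×ℚ (g (suc i) ℚ.* x) ℚ.+ suc i ×ℚ (g i ℚ.* x)
    ≡⟨ ≡.cong₂ ℚ._+_ (×ℚ-assoc-* (suc (suc i)) (g (suc i)) x) (×ℚ-assoc-* (suc i) (g i) x) ⟨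
  (suc (suc i) ×ℚ g (suc i)) ℚ.* x ℚ.+ (suc i ×ℚ g i) ℚ.* x
    ≡⟨ ℚP.*-distribʳ-+ x (suc (suc i) ×ℚ g (suc i)) (suc i ×ℚ g i) ⟨
  (suc (suc i) ×ℚ g (suc i) ℚ.+ suc i ×ℚ g i) ℚ.* x
    ≡⟨ ≡.cong (ℚ._* x) (gap-suc s i) ⟩
  (s ×ℚ g i) ℚ.* x
    ≡⟨ ×ℚ-assoc-* s (g i) x ⟩
  s ×ℚ (g i ℚ.* x) ∎
  where
  open ≡.≡-Reasoning
  g = R.gap s
  x = f r s

σ : Ser.Carrier → Ser.Carrier
σ = Swap.swap ℚ-ring

-- Read off from the symmetry of C at the exponent e with e + 1 = r + s + k.
F-symmetric : ∀ k → σ (F k) Ser.≈ F k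
F-symmetric k zero    zero    = ≡.refl
F-symmetric k zero    (suc s) = ≡.trans (≡.sym (C-high (suc s) 0 k (s ℕ.+ 0 ℕ.+ k) ≡.refl (ℕ.s≤s ℕ.z≤n)))
  (≡.trans (Q.C-symmetric (suc s) 0 (s ℕ.+ 0 ℕ.+ k))
    (C-high 0 (suc s) k (s ℕ.+ 0 ℕ.+ k) (≡.cong (λ n → suc n ℕ.+ k) (ℕP.+-identityʳ s)) (ℕ.s≤s ℕ.z≤n)))
F-symmetric k (suc r) s       = ≡.trans (≡.sym (C-high s (suc r) k (r ℕ.+ s ℕ.+ k) (≡.cong (ℕ._+ k) (ℕP.+-comm (suc r) s))
    (ℕP.≤-trans (ℕ.s≤s ℕ.z≤n) (ℕP.≤-reflexive (ℕP.+-comm (suc r) s)))))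
  (≡.trans (Q.C-symmetric s (suc r) (r ℕ.+ s ℕ.+ k)) (C-high (suc r) s k (r ℕ.+ s ℕ.+ k) ≡.refl (ℕ.s≤s ℕ.z≤n)))

private module NS = Notions SeriesRing

DX-euler : ∀ g → DX g Ser.≈ Euler.euler (PS ℚ-ring) g
DX-euler g r s = ≡.sym (×ᴷ-pointwise r (g r) s)

DX-isDerivation : NS.IsDerivation DX
DX-isDerivation = record
  { d-cong = λ p r s → ≡.cong (r ×ℚ_) (p r s)
  ; d-+    = λ g h r s → CMult.×-distrib-+ ℚR.+-commutativeMonoid (g r s) (h r s) r
  ; d-*    = λ g h → Ser.trans (DX-euler (g Ser.* h)) (Ser.trans (Eu.d-* g h)
      (Ser.+-cong (Ser.*-congʳ {h} (Ser.sym (DX-euler g))) (Ser.*-congˡ {g} (Ser.sym (DX-euler h)))))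
  }
  where
  module Eu = NS.IsDerivation (Euler.euler-isDerivation (PS ℚ-ring))

DY-isDerivation : NS.IsDerivation DY
DY-isDerivation = Euler.lift-isDerivation (PS ℚ-ring) (Euler.euler-isDerivation ℚ-ring)

×ℚ-zero : ∀ n → n ×ℚ 0ℚ ≡ 0ℚ
×ℚ-zero = Euler.×-zeroʳ ℚ-ring

DX-constant : ∀ c → DX (constant₂ c) Ser.≈ Ser.0#
DX-constant c zero    s = ≡.refl
DX-constant c (suc r) s = ×ℚ-zero (suc r)

DY-constant : ∀ c → DY (constant₂ c) Ser.≈ Ser.0#
DY-constant c zero    zero    = ≡.refl
DY-constant c zero    (suc s) = ×ℚ-zero (suc s)
DY-constant c (suc r) s       = ×ℚ-zero s

swap-constant : ∀ c → σ (constant₂ c) Ser.≈ constant₂ c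
swap-constant c zero    zero    = ≡.refl
swap-constant c zero    (suc s) = ≡.refl
swap-constant c (suc r) zero    = ≡.refl
swap-constant c (suc r) (suc s) = ≡.refl

constant-* : ∀ a b → constant₂ a Ser.* constant₂ b Ser.≈ constant₂ (a ℚ.* b)
constant-* a b zero    zero    = ≡.refl
constant-* a b zero    (suc s) = ≡.trans (constant₂-* a (constant₂ b) 0 (suc s)) (ℚP.*-zeroʳ a)
constant-* a b (suc r) s       = ≡.trans (constant₂-* a (constant₂ b) (suc r) s) (ℚP.*-zeroʳ a)

constant-neg : ∀ a → constant₂ (ℚ.- a) Ser.≈ Ser.- constant₂ a
constant-neg a zero    zero    = ≡.refl
constant-neg a zero    (suc s) = ≡.refl
constant-neg a (suc r) s       = ≡.refl

constant-cancel : ∀ n x → constant₂ (reciprocal (suc n)) Ser.* (suc n ×ˢ x) Ser.≈ x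
constant-cancel n x r s = ≡.trans (constant₂-* (reciprocal (suc n)) (suc n ×ˢ x) r s)
  (≡.trans (≡.cong (reciprocal (suc n) ℚ.*_) (×ˢ-pointwise (suc n) x r s)) (reciprocal-cancel n (x r s)))

-- Inverses of power series

⊠-closed : ∀ {P : ℚ → Set} → (∀ {x y} → P x → P y → P (x ℚ.+ y)) → ∀ g h m n →
  (∀ a a′ b b′ → a ℕ.+ a′ ≡ m → b ℕ.+ b′ ≡ n → P (g a b ℚ.* h a′ b′)) → P ((g Ser.* h) m n)
⊠-closed {P} P-+ g h m n k = Closure.⊛-closed (PS ℚ-ring) {λ x → P (x n)} P-+ g h m (λ a a′ p →
  Closure.⊛-closed ℚ-ring {P} P-+ (g a) (h a′) n (λ b b′ q → k a a′ b b′ p q))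

⊠-agree : ∀ g h h′ m n → (∀ a b → a ℕ.≤ m → b ℕ.≤ n → h a b ≡ h′ a b) → (g Ser.* h) m n ≡ (g Ser.* h′) m n
⊠-agree g h h′ m n k = Closure.⊛-agree (PS ℚ-ring) g h h′ (λ x y → x n ≡ y n) (≡.cong₂ ℚ._+_) m (λ a a′ p →
  Closure.⊛-agree ℚ-ring (g a) (h a′) (h′ a′) _≡_ (≡.cong₂ ℚ._+_) n (λ b b′ q →
    ≡.cong (g a b ℚ.*_) (k a′ b′ (ℕP.m+n≤o⇒n≤o a (ℕP.≤-reflexive p)) (ℕP.m+n≤o⇒n≤o b (ℕP.≤-reflexive q)))))

-- As t has no constant term, each of the l factors takes at least one from the total degree m + n.
power-vanish : ∀ t → t 0 0 ≡ 0ℚ → ∀ l m n → m ℕ.+ n ℕ.< l → (t ^ˢ l) m n ≡ 0ℚ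
power-vanish t t₀ (suc l) m n m+n<l = ⊠-closed {_≡ 0ℚ} (≡.cong₂ ℚ._+_) t (t ^ˢ l) m n term
  where
  open import Algebra.Properties.CommutativeSemigroup ℕP.+-commutativeSemigroup using (interchange)
  term : ∀ a a′ b b′ → a ℕ.+ a′ ≡ m → b ℕ.+ b′ ≡ n → t a b ℚ.* (t ^ˢ l) a′ b′ ≡ 0ℚ
  term zero a′ zero b′ p q = ≡.trans (≡.cong (ℚ._* (t ^ˢ l) a′ b′) t₀) (ℚP.*-zeroˡ ((t ^ˢ l) a′ b′))
  term zero a′ (suc b) b′ ≡.refl ≡.refl = ≡.trans (≡.cong (t 0 (suc b) ℚ.*_) (power-vanish t t₀ l a′ b′
    (ℕP.≤-trans (ℕ.s≤s (ℕP.+-monoʳ-≤ a′ (ℕP.m≤n+m b′ b))) (ℕP.≤-trans (ℕP.≤-reflexive (≡.sym (ℕP.+-suc a′ (b ℕ.+ b′)))) (ℕP.≤-pred m+n<l))))) (ℚP.*-zeroʳ (t 0 (suc b)))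
  term (suc a) a′ b b′ ≡.refl ≡.refl = ≡.trans (≡.cong (t (suc a) b ℚ.*_) (power-vanish t t₀ l a′ b′
    (ℕP.≤-trans (ℕ.s≤s (ℕP.+-mono-≤ (ℕP.m≤n+m a′ a) (ℕP.m≤n+m b′ b))) (ℕP.≤-pred m+n<l)))) (ℚP.*-zeroʳ (t (suc a) b))

-- The partial sum t^a + ... + t^(a+N) of the geometric series; the offset a lets it be peeled from
-- the front.
geometric : Ser.Carrier → ℕ → ℕ → Ser.Carrier
geometric t a zero    = t ^ˢ a
geometric t a (suc N) = t ^ˢ a Ser.+ geometric t (suc a) N

geometric-sum : ∀ h t → h Ser.+ t Ser.≈ Ser.1# → ∀ a N → h Ser.* geometric t a N Ser.+ t ^ˢ (a ℕ.+ suc N) Ser.≈ t ^ˢ a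
geometric-sum h t e a zero = begin
  h Ser.* t ^ˢ a Ser.+ t ^ˢ (a ℕ.+ 1) ≡⟨ ≡.cong (λ n → h Ser.* t ^ˢ a Ser.+ t ^ˢ n) (ℕP.+-comm a 1) ⟩
  h Ser.* t ^ˢ a Ser.+ t Ser.* t ^ˢ a ≈⟨ Ser.distribʳ (t ^ˢ a) h t ⟨
  (h Ser.+ t) Ser.* t ^ˢ a ≈⟨ Ser.*-congʳ {t ^ˢ a} e ⟩
  Ser.1# Ser.* t ^ˢ a ≈⟨ Ser.*-identityˡ (t ^ˢ a) ⟩
  t ^ˢ a ∎
  where open SetoidReasoning Ser.setoid
geometric-sum h t e a (suc N) = begin
  h Ser.* (t ^ˢ a Ser.+ geometric t (suc a) N) Ser.+ t ^ˢ (a ℕ.+ suc (suc N))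
    ≡⟨ ≡.cong (λ n → h Ser.* (t ^ˢ a Ser.+ geometric t (suc a) N) Ser.+ t ^ˢ n) (ℕP.+-suc a (suc N)) ⟩
  h Ser.* (t ^ˢ a Ser.+ geometric t (suc a) N) Ser.+ t ^ˢ (suc a ℕ.+ suc N)
    ≈⟨ Ser.+-congʳ {t ^ˢ (suc a ℕ.+ suc N)} (Ser.distribˡ h (t ^ˢ a) (geometric t (suc a) N)) ⟩
  h Ser.* t ^ˢ a Ser.+ h Ser.* geometric t (suc a) N Ser.+ t ^ˢ (suc a ℕ.+ suc N)
    ≈⟨ Ser.+-assoc (h Ser.* t ^ˢ a) (h Ser.* geometric t (suc a) N) (t ^ˢ (suc a ℕ.+ suc N)) ⟩
  h Ser.* t ^ˢ a Ser.+ (h Ser.* geometric t (suc a) N Ser.+ t ^ˢ (suc a ℕ.+ suc N))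
    ≈⟨ Ser.+-congˡ {h Ser.* t ^ˢ a} (geometric-sum h t e (suc a) N) ⟩
  h Ser.* t ^ˢ a Ser.+ t Ser.* t ^ˢ a ≈⟨ Ser.distribʳ (t ^ˢ a) h t ⟨
  (h Ser.+ t) Ser.* t ^ˢ a ≈⟨ Ser.*-congʳ {t ^ˢ a} e ⟩
  Ser.1# Ser.* t ^ˢ a ≈⟨ Ser.*-identityˡ (t ^ˢ a) ⟩
  t ^ˢ a ∎
  where open SetoidReasoning Ser.setoid

geometric-stable : ∀ t → t 0 0 ≡ 0ℚ → ∀ a N d m n → m ℕ.+ n ℕ.≤ a ℕ.+ N →
  geometric t a N m n ≡ geometric t a (N ℕ.+ d) m n
geometric-stable t t₀ a zero    zero    m n le = ≡.refl
geometric-stable t t₀ a zero    (suc d) m n le = ≡.sym (≡.trans (≡.cong ((t ^ˢ a) m n ℚ.+_)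
    (≡.trans (≡.sym (geometric-stable t t₀ (suc a) 0 d m n (ℕP.≤-trans le (ℕP.n≤1+n _))))
      (power-vanish t t₀ (suc a) m n (ℕ.s≤s (ℕP.≤-trans le (ℕP.≤-reflexive (ℕP.+-identityʳ a)))))))
  (ℚP.+-identityʳ _))
geometric-stable t t₀ a (suc N) d m n le =
  ≡.cong ((t ^ˢ a) m n ℚ.+_) (geometric-stable t t₀ (suc a) N d m n (ℕP.≤-trans le (ℕP.≤-reflexive (ℕP.+-suc a N))))

-- In g the length of the partial sum varies with the coefficient. For the coefficient (m, n) of h *
-- g all entries involved may be taken from the one partial sum with N = m + n, and the telescoping
-- remainder t^(N+1) vanishes there.
geometric-inverse : ∀ h t g → h Ser.+ t Ser.≈ Ser.1# → t 0 0 ≡ 0ℚ → (∀ m n → g m n ≡ geometric t 0 (m ℕ.+ n) m n) → h Ser.* g Ser.≈ Ser.1#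
geometric-inverse h t g e t₀ eq m n = begin
  (h Ser.* g) m n ≡⟨ ⊠-agree h g (geometric t 0 (m ℕ.+ n)) m n stable ⟩
  (h Ser.* geometric t 0 N) m n ≡⟨ ℚP.+-identityʳ _ ⟨
  (h Ser.* geometric t 0 N) m n ℚ.+ 0ℚ ≡⟨ ≡.cong ((h Ser.* geometric t 0 N) m n ℚ.+_) (power-vanish t t₀ (suc N) m n ℕP.≤-refl) ⟨
  (h Ser.* geometric t 0 N Ser.+ t ^ˢ suc N) m n ≡⟨ geometric-sum h t e 0 N m n ⟩
  Ser.1# m n ∎
  where
  open ≡.≡-Reasoning
  N = m ℕ.+ n
  stable : ∀ a b → a ℕ.≤ m → b ℕ.≤ n → g a b ≡ geometric t 0 N a b
  stable a b a≤m b≤n = ≡.trans (eq a b) (≡.trans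
    (geometric-stable t t₀ 0 (a ℕ.+ b) (N ∸ (a ℕ.+ b)) a b ℕP.≤-refl)
    (≡.cong (λ k → geometric t 0 k a b) (ℕP.m+[n∸m]≡n (ℕP.+-mono-≤ a≤m b≤n))))

-- The operations of Defs agree with those of the ring of iterated power series.

conv-bridge : ∀ (g h : ℕ → ℚ) n → sumℚ {suc n} (λ j → g (toℕ j) ℚ.* h (n ∸ toℕ j)) ≡ Convolution._⊛_ ℚ-ring g h n
conv-bridge g h zero    = ℚP.+-identityʳ _
conv-bridge g h (suc n) = ≡.cong (g 0 ℚ.* h (suc n) ℚ.+_) (conv-bridge (tail g) h n)

*-bridge : ∀ g h → g Defs.* h Ser.≈ g Ser.* h
*-bridge g h zero    n = ≡.trans (ℚP.+-identityʳ _) (conv-bridge (g 0) (h 0) n)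
*-bridge g h (suc m) n = ≡.cong₂ ℚ._+_ (conv-bridge (g 0) (h (suc m)) n) (*-bridge (tail g) h m n)

*-bridge-cong : ∀ {g g′ h h′} → g Ser.≈ g′ → h Ser.≈ h′ → g Defs.* h Ser.≈ g′ Ser.* h′
*-bridge-cong {g} {g′} {h} {h′} p q = Ser.trans (*-bridge g h) (Ser.*-cong p q)

constant-bridge : ∀ c → constant c Ser.≈ constant₂ c
constant-bridge c zero    zero    = ≡.refl
constant-bridge c zero    (suc s) = ≡.refl
constant-bridge c (suc r) s       = ≡.refl

one-bridge : Defs.1# Ser.≈ Ser.1#
one-bridge = Ser.trans (constant-bridge 1ℚ) constant₂-1

zero-bridge : Defs.0# Ser.≈ Ser.0#
zero-bridge zero    zero    = ≡.refl
zero-bridge zero    (suc s) = ≡.refl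
zero-bridge (suc r) s       = ≡.refl

^-bridge : ∀ {g g′} → g Ser.≈ g′ → ∀ n → g Defs.^ n Ser.≈ g′ ^ˢ n
^-bridge p zero    = one-bridge
^-bridge p (suc n) = *-bridge-cong p (^-bridge p n)

sumˢ : ∀ {n} → (Fin n → Ser.Carrier) → Ser.Carrier
sumˢ = RawMonoidDefs.sum Ser.+-rawMonoid

sum-bridge : ∀ {n} {g g′ : Fin n → Ser.Carrier} → (∀ j → g j Ser.≈ g′ j) → Defs.sum g Ser.≈ sumˢ g′
sum-bridge {zero}  p = zero-bridge
sum-bridge {suc n} p = Ser.+-cong (p Fin.zero) (sum-bridge (λ j → p (Fin.suc j)))

⁻¹-inverse : ∀ {h h′} → h Ser.≈ h′ → h 0 0 ≡ 1ℚ → h′ Ser.* h ⁻¹ Ser.≈ Ser.1#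
⁻¹-inverse {h} {h′} e h₀ = geometric-inverse h′ t (h ⁻¹) complement t₀ (λ m n → expand 0 (m ℕ.+ n) m n)
  where
  t : Ser.Carrier
  t = Ser.1# Ser.+ Ser.- h′
  complement : h′ Ser.+ t Ser.≈ Ser.1#
  complement = begin
    h′ Ser.+ (Ser.1# Ser.+ Ser.- h′) ≈⟨ Ser.+-comm h′ (Ser.1# Ser.+ Ser.- h′) ⟩
    Ser.1# Ser.+ Ser.- h′ Ser.+ h′ ≈⟨ Ser.+-assoc Ser.1# (Ser.- h′) h′ ⟩
    Ser.1# Ser.+ (Ser.- h′ Ser.+ h′) ≈⟨ Ser.+-congˡ {Ser.1#} (Ser.-‿inverseˡ h′) ⟩
    Ser.1# Ser.+ Ser.0# ≈⟨ Ser.+-identityʳ Ser.1# ⟩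
    Ser.1# ∎
    where open SetoidReasoning Ser.setoid
  t₀ : t 0 0 ≡ 0ℚ
  t₀ = ≡.trans (≡.cong (λ x → 1ℚ ℚ.+ ℚ.- x) (≡.trans (≡.sym (e 0 0)) h₀)) (ℚP.+-inverseʳ 1ℚ)
  t-bridge : Defs.1# Defs.- h Ser.≈ t
  t-bridge = Ser.+-cong one-bridge (Ser.-‿cong e)
  expand : ∀ a N m n → sumℚ {suc N} (λ l → ((Defs.1# Defs.- h) Defs.^ (a ℕ.+ toℕ l)) m n) ≡ geometric t a N m n
  expand a zero    m n = ≡.trans (ℚP.+-identityʳ _) (≡.trans (≡.cong (λ k → ((Defs.1# Defs.- h) Defs.^ k) m n) (ℕP.+-identityʳ a))
    (^-bridge t-bridge a m n))
  expand a (suc N) m n = ≡.cong₂ ℚ._+_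
    (≡.trans (≡.cong (λ k → ((Defs.1# Defs.- h) Defs.^ k) m n) (ℕP.+-identityʳ a)) (^-bridge t-bridge a m n))
    (≡.trans (sum-cong {suc N} (λ l → ≡.cong (λ k → ((Defs.1# Defs.- h) Defs.^ k) m n) (ℕP.+-suc a (toℕ l)))) (expand (suc a) N m n))
    where
    sum-cong : ∀ {N} {g g′ : Fin N → ℚ} → (∀ l → g l ≡ g′ l) → sumℚ g ≡ sumℚ g′
    sum-cong {zero}  p = ≡.refl
    sum-cong {suc N} p = ≡.cong₂ ℚ._+_ (p Fin.zero) (sum-cong (λ l → p (Fin.suc l)))

Wˢ Mˢ Iˢ : Ser.Carrier
Wˢ = DX (F 0) Ser.* DY (F 0)
Mˢ = Ser.1# Ser.+ Ser.- Wˢ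
Iˢ = (Defs.1# Defs.- Defs.W) ⁻¹

Tx-bridge : Defs.Tx Ser.≈ DX (F 0)
Tx-bridge r s = ≡.sym (×ℚ-/ r (F 0 r s))

Ty-bridge : Defs.Ty Ser.≈ DY (F 0)
Ty-bridge r s = ≡.sym (×ℚ-/ s (F 0 r s))

W-bridge : Defs.W Ser.≈ Wˢ
W-bridge = *-bridge-cong Tx-bridge Ty-bridge

M-bridge : Defs.1# Defs.- Defs.W Ser.≈ Mˢ
M-bridge = Ser.+-cong one-bridge (Ser.-‿cong W-bridge)

M₀₀ : Mˢ 0 0 ≡ 1ℚ
M₀₀ = ≡.cong (λ x → 1ℚ ℚ.+ ℚ.- x) (ℚP.*-zeroˡ (DY (F 0) 0 0))

M^₀₀ : ∀ p → (Mˢ ^ˢ p) 0 0 ≡ 1ℚ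
M^₀₀ zero    = ≡.refl
M^₀₀ (suc p) = ≡.cong₂ ℚ._*_ M₀₀ (M^₀₀ p)

M*I : Mˢ Ser.* Iˢ Ser.≈ Ser.1#
M*I = ⁻¹-inverse M-bridge (≡.trans (M-bridge 0 0) M₀₀)

I-inverse : Iˢ Ser.≈ Ser.1# Ser.+ Wˢ Ser.* Iˢ
I-inverse = Inverses.inverse-fixpoint SeriesRing {Wˢ} {Iˢ} M*I

-- The theorem inverts the power (1 - W)^p as one series, while the proof works with powers of I;
-- the two agree because inverses are unique.
power-inverse : ∀ p → ((Defs.1# Defs.- Defs.W) Defs.^ p) ⁻¹ Ser.≈ Iˢ ^ˢ p
power-inverse p = Inverses.inverse-power SeriesRing {Mˢ} {Iˢ} {((Defs.1# Defs.- Defs.W) Defs.^ p) ⁻¹} M*I p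
  (⁻¹-inverse bridge (≡.trans (bridge 0 0) (M^₀₀ p)))
  where
  bridge : (Defs.1# Defs.- Defs.W) Defs.^ p Ser.≈ Mˢ ^ˢ p
  bridge = ^-bridge M-bridge p

-- Application to the generating functions F k

setting : Setting SeriesRing
setting = record
  { κ         = constant₂
  ; κ-1       = constant₂-1
  ; κ-+       = constant₂-+
  ; κ-*       = constant-*
  ; κ-neg     = constant-neg
  ; κ-cancel  = constant-cancel
  ; DX = DX ; DY = DY ; σ = σ
  ; DX-isDerivation = DX-isDerivation
  ; DY-isDerivation = DY-isDerivation
  ; σ-isEndo  = Swap.swap-isEndo ℚ-ring
  ; DX-κ      = DX-constant
  ; DY-κ      = DY-constant
  ; σ-κ       = swap-constant
  ; σ-σ       = λ g → Ser.refl {g}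
  ; σ-DX      = λ g → Ser.refl {DY (σ g)}
  ; F = F ; S = S ; β = β
  ; F-symmetric = F-symmetric
  ; I         = Iˢ
  ; I-inverse = I-inverse
  ; DX-equation = DX-equation
  ; DY-equation = DY-equation
  ; betti-equation = betti-equation
  ; root-recursion = root-recursion
  ; S-expansion = S-expansion
  ; β-zero    = β-zero
  ; β-suc     = β-suc
  }

module Zs = ZSpans SeriesRing setting

eval-bridge : ∀ {w w′} → w Ser.≈ w′ → ∀ p → eval p w Ser.≈ Zs.evalᴿ p w′
eval-bridge e []      = zero-bridge
eval-bridge e (c ∷ p) = Ser.+-cong (constant-bridge c) (*-bridge-cong e (eval-bridge e p))

Z-bridge : Defs.Z Ser.≈ Zs.Z
Z-bridge = Ser.+-cong Tx-bridge Ty-bridge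

sums : ∀ {n} (q : Fin n → Polynomial) → Defs.sum (λ j → eval (q j) Defs.W Defs.* Defs.Z Defs.^ toℕ j) Ser.≈ Zs.value q 0
sums q = sum-bridge (λ j → *-bridge-cong (eval-bridge W-bridge (q j)) (^-bridge Z-bridge (toℕ j)))

rational-bridge : ∀ {n} p (q : Fin n → Polynomial) →
  Wˢ ^ˢ 2 Ser.* Iˢ ^ˢ p Ser.* Zs.value q 0 Ser.≈
  Defs.W Defs.^ 2 Defs.* ((Defs.1# Defs.- Defs.W) Defs.^ p) ⁻¹ Defs.* Defs.sum (λ j → eval (q j) Defs.W Defs.* Defs.Z Defs.^ toℕ j)
rational-bridge p q = Ser.sym {right} {left} (*-bridge-cong {Defs.W Defs.^ 2 Defs.* J} {Wˢ ^ˢ 2 Ser.* Iˢ ^ˢ p} {Σ} {Zs.value q 0}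
  (*-bridge-cong {Defs.W Defs.^ 2} {Wˢ ^ˢ 2} {J} {Iˢ ^ˢ p} (^-bridge W-bridge 2) (power-inverse p)) (sums q))
  where
  J = ((Defs.1# Defs.- Defs.W) Defs.^ p) ⁻¹
  Σ = Defs.sum (λ j → eval (q j) Defs.W Defs.* Defs.Z Defs.^ toℕ j)
  left = Wˢ ^ˢ 2 Ser.* Iˢ ^ˢ p Ser.* Zs.value q 0
  right = Defs.W Defs.^ 2 Defs.* J Defs.* Σ

f-unfold : ∀ n (q : Fin (suc (suc n)) → Polynomial) z w → f (suc (suc n)) q z w ≡
  w Defs.^ 2 Defs.* ((Defs.1# Defs.- w) Defs.^ (3 ℕ.* suc n)) ⁻¹ Defs.* Defs.sum (λ j → eval (q j) w Defs.* z Defs.^ toℕ j)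
f-unfold n q z w = ≡.refl

finish : ∀ n (q : Fin (suc (suc n)) → Polynomial) g → g Ser.≈ Wˢ ^ˢ 2 Ser.* Iˢ ^ˢ (3 ℕ.* suc n) Ser.* Zs.value q 0 →
  g Ser.≈ f (suc (suc n)) q Defs.Z Defs.W
finish n q g e r s = ≡.trans (e r s) (≡.trans (rational-bridge (3 ℕ.* suc n) q r s)
  (≡.sym (≡.cong (λ h → h r s) (f-unfold n q Defs.Z Defs.W))))

open Defs using (_≈_; Z; W)

theorem1p7 : (k : ℕ) → 2 ≤ k →
    ∃ λ (q : Fin k → Polynomial) → F k ≈ f k q Z W
theorem1p7 (suc zero) (s≤s ())
theorem1p7 (suc (suc n)) _ =
  proj₁ (Zs.F-rational n) , finish n (proj₁ (Zs.F-rational n)) (F (suc (suc n))) (proj₂ (Zs.F-rational n))
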